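{- Let $n,k\geq 1$. Let $A^{(k)}_n(x)$ be the $1/k$-Eulerian polynomial, and let $a^{(k)}_n(x)=\frac{A^{(k)}_n(x)-x^{n}A^{(k)}_n(1/x)}{1-x}$ and $b^{(k)}_n(x)=\frac{x^{n-1}A^{(k)}_n(1/x)-A^{(k)}_n(x)}{1-x}$ (so that $A^{(k)}_n(x)=a^{(k)}_n(x)+x\,b^{(k)}_n(x)$ is its symmetric decomposition). Then $$a^{(k)}_{n}(x)=\sum_{F\in \overline{\mathcal{F}}_{n}(k)}x^{\mathrm{lleaf}(F)-\mathrm{si}(F)}=\sum_{i=0}^{\lfloor (n-1)/2\rfloor} \overline{\gamma}_{n,k,i}\,x^i(1+x)^{n-1-2i}$$ and $$x\,b^{(k)}_{n}(x)=\sum_{F\in \widehat{\mathcal{F}}_{n}(k)}x^{\mathrm{lleaf}(F)-\mathrm{si}(F)}=\sum_{i=1}^{\lfloor n/2\rfloor} \widehat{\gamma}_{n,k,i}\,x^i(1+x)^{n-2i},$$ where $\overline{\gamma}_{n,k,i}$ (resp. $\widehat{\gamma}_{n,k,i}$) is the number of forests in $\overline{\mathcal{F}}_{n}(k)$ (resp. $\widehat{\mathcal{F}}_{n}(k)$) having exactly $i$ old leaves and having no young leaves and no removable old leaves.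
   Context: The $1/k$-Eulerian polynomials are defined by $\sum_{n\geq 0}A^{(k)}_n(x)\frac{z^n}{n!}=\left(\frac{1-x}{e^{kz(x-1)}-x}\right)^{1/k}$. Trees: all trees are ordered (plane) rooted trees; the level of a node is its distance from the root (root at level 0); a leaf is a node with no children. An even $k$-ary tree is an ordered tree in which every node on an even level has exactly $k$ children. A pruned even $k$-ary tree is obtained from an even $k$-ary tree by deleting, for every even-level node all of whose children are leaves, all those children. For a finite set $M$ of positive integers, an increasing pruned even $k$-ary tree on $M$ is a pruned even $k$-ary tree whose nodes on even levels are labeled bijectively by $M$ (odd-level nodes are unlabeled) such that labels increase along every path from the root downward and, for each node, the labels of its children increase from left to right. An increasing pruned even $k$-ary forest on $M$ is a sequence $F=(T_1,\dots,T_m)$ of increasing pruned even $k$-ary trees whose label sets form a set partition of $M$ and whose root labels increase from left to right. $\mathcal{F}_n(k)$ is the set of such forests on $[n]=\{1,\dots,n\}$. For a labeled node $v$, its grand parent is the labeled node $u$ such that a child of $u$ is the parent of $v$; $v$ is then a grand child of $u$. A labeled non-root node $v$ is old if its label is the greatest among all grand children of its grand parent, and young otherwise; roots are neither old nor young. A labeled leaf is a leaf on an even level; $\mathrm{lleaf}(F)$ is the total number of labeled leaves of $F$. A singleton is a tree with only one node; $\mathrm{si}(F)$ is the number of singletons of $F$. For $F=(T_1,\dots,T_m)\in\mathcal{F}_n(k)$, an old leaf $u$ of $T_i$ is removable if: (1) $u$ is a grand child of the root of $T_i$ and is the only leaf among all grand children of the root of $T_i$; (2) the first $k-1$ children of the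 root of $T_i$ (from the left) are leaves; (3) if $i<m$, the label of $u$ is smaller than the label of the root of $T_{i+1}$. $\overline{\mathcal{F}}_n(k)$ is the set of $F\in\mathcal{F}_n(k)$ such that either the rightmost tree of $F$ is a singleton or the first $k-1$ children of the root of the rightmost tree of $F$ are leaves; $\widehat{\mathcal{F}}_n(k)=\mathcal{F}_n(k)\setminus\overline{\mathcal{F}}_n(k)$. -}

module Defs where

open import Data.Bool using (Bool; true; false; if_then_else_; _∧_; _∨_; not; _≟_)
open import Data.Bool.ListAction using (all; any)
open import Data.Unit using (⊤)
open import Data.Nat as ℕ using (ℕ; zero; suc; _∸_; _<_; _^_; _≤ᵇ_; _≡ᵇ_)
open import Data.Nat.Combinatorics using (_C_)
open import Data.Integer using (+_)
open import Data.List using (List; []; _∷_; map; foldr; applyUpTo; length; take; _++_; filter; last)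
open import Data.List.Relation.Unary.All using (All)
open import Data.List.Relation.Unary.Linked using (Linked)
open import Data.List.Relation.Binary.Permutation.Propositional using (_↭_)
open import Data.Maybe using (Maybe; just; nothing)
open import Data.Product using (Σ; _×_)
open import Data.Sum using (_⊎_)
open import Data.Fin using (Fin)
open import Data.Irrelevant using (Irrelevant)
open import Data.Rational using (ℚ; 0ℚ; 1ℚ; _+_; _*_; _-_; _/_)
open import Function.Bundles using (_↔_)
open import Relation.Nullary using (¬_)
open import Relation.Binary.PropositionalEquality using (_≡_)

-- Formal power series in x with rational coefficients: coefficient maps.
-- (Polynomials are series with finitely many nonzero coefficients.)

Series : Set
Series = ℕ → ℚ

ℕ→ℚ : ℕ → ℚ
ℕ→ℚ n = + n / 1

_≗ₛ_ : Series → Series → Set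
p ≗ₛ q = ∀ m → p m ≡ q m

range : ℕ → ℕ → List ℕ
range lo hi = applyUpTo (λ i → lo ℕ.+ i) (suc hi ∸ lo)

sumℚ : List ℚ → ℚ
sumℚ = foldr _+_ 0ℚ

zeroS : Series
zeroS _ = 0ℚ

constS : ℚ → Series
constS c zero    = c
constS c (suc _) = 0ℚ

X : Series
X 1 = 1ℚ
X _ = 0ℚ

_⊕_ : Series → Series → Series
(p ⊕ q) m = p m + q m

_⊖_ : Series → Series → Series
(p ⊖ q) m = p m - q m

scale : ℚ → Series → Series
scale c p m = c * p m

_⊗_ : Series → Series → Series
(p ⊗ q) m = sumℚ (map (λ i → p i * q (m ∸ i)) (range 0 m))

powS : Series → ℕ → Series
powS p zero    = constS 1ℚ
powS p (suc j) = p ⊗ powS p j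

ΣS : List ℕ → (ℕ → Series) → Series
ΣS is f m = sumℚ (map (λ i → f i m) is)

-- 1/(1-x) = Σ_j x^j ; multiplying by it is division by (1 - x) in ℚ[[x]]
geom : Series
geom _ = 1ℚ

-- x^n p(1/x)  (for p of degree ≤ n)
rev : ℕ → Series → Series
rev n p m = if m ≤ᵇ n then p (n ∸ m) else 0ℚ

-- Exponential generating functions in z with coefficients in ℚ[[x]]:
-- a family F : ℕ → Series stands for Σ_n F n · z^n / n!.

Fam : Set
Fam = ℕ → Series

_⋆_ : Fam → Fam → Fam
(F ⋆ G) n = ΣS (range 0 n) (λ i → scale (ℕ→ℚ (n C i)) (F i ⊗ G (n ∸ i)))

unitF : Fam
unitF zero    = constS 1ℚ
unitF (suc _) = zeroS

powF : Fam → ℕ → Fam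
powF F zero    = unitF
powF F (suc j) = F ⋆ powF F j

-- e^{k z (x-1)} - x   as an EGF
denomF : ℕ → Fam
denomF k zero    = constS 1ℚ ⊖ X
denomF k (suc n) = scale (ℕ→ℚ (k ^ suc n)) (powS (X ⊖ constS 1ℚ) (suc n))

numerF : Fam
numerF zero    = constS 1ℚ ⊖ X
numerF (suc _) = zeroS

-- A is the family of 1/k-Eulerian polynomials:
--   Σ_n A_n(x) z^n/n! = ((1-x)/(e^{kz(x-1)} - x))^{1/k},
-- i.e. the constant term A_0 is 1 and (Σ A_n z^n/n!)^k · (e^{kz(x-1)} - x) = 1 - x.
-- (This determines A uniquely in ℚ[[x]][[z]].)
IsOneOverKEulerian : ℕ → Fam → Set
IsOneOverKEulerian k A =
  (A 0 ≗ₛ constS 1ℚ) × (∀ n → (powF A k ⋆ denomF k) n ≗ₛ numerF n)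

aPoly : Fam → ℕ → Series
aPoly A n = geom ⊗ (A n ⊖ rev n (A n))

bPoly : Fam → ℕ → Series
bPoly A n = geom ⊗ (rev (n ∸ 1) (A n) ⊖ A n)

-- Pruned even k-ary trees (raw syntax).
-- ETree = node on an even level, carrying its label and its (unlabeled,
-- odd-level) children; OTree = node on an odd level with its (labeled,
-- even-level) children.

data ETree : Set
data OTree : Set

data ETree where
  enode : ℕ → List OTree → ETree

data OTree where
  onode : List ETree → OTree

label : ETree → ℕ
label (enode l _) = l

kids : ETree → List OTree
kids (enode _ cs) = cs

okids : OTree → List ETree
okids (onode es) = es

grandchildren : ETree → List ETree
grandchildren (enode _ cs) = foldr (λ o gs → okids o ++ gs) [] cs

isLeaf : ETree → Bool
isLeaf (enode _ []) = true
isLeaf (enode _ (_ ∷ _)) = false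

isOLeaf : OTree → Bool
isOLeaf (onode []) = true
isOLeaf (onode (_ ∷ _)) = false

isOld : ETree → ETree → Bool
isOld u g = all (λ h → label h ≤ᵇ label g) (grandchildren u)

labelsE  : ETree → List ℕ
labelsOs : List OTree → List ℕ
labelsEs : List ETree → List ℕ
labelsE (enode l cs) = l ∷ labelsOs cs
labelsOs [] = []
labelsOs (onode es ∷ os) = labelsEs es ++ labelsOs os
labelsEs [] = []
labelsEs (e ∷ es) = labelsE e ++ labelsEs es

sumE  : (ETree → ℕ) → ETree → ℕ
sumOs : (ETree → ℕ) → List OTree → ℕ
sumEs : (ETree → ℕ) → List ETree → ℕ
sumE f (enode l cs) = f (enode l cs) ℕ.+ sumOs f cs
sumOs f [] = 0
sumOs f (onode es ∷ os) = sumEs f es ℕ.+ sumOs f os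
sumEs f [] = 0
sumEs f (e ∷ es) = sumE f e ℕ.+ sumEs f es

-- Well-formedness of an increasing pruned even k-ary tree:
--  * an even-level node is either a leaf, or has exactly k children not all
--    of which are leaves (pruning);
--  * labels increase downward (each labeled node is smaller than its grand
--    children, hence than all its labeled descendants);
--  * children of each odd-level node have increasing labels left to right.
PrunedShape : ℕ → List OTree → Set
PrunedShape k cs = (cs ≡ []) ⊎ ((length cs ≡ k) × ¬ All (λ o → o ≡ onode []) cs)

WfE  : ℕ → ETree → Set
WfOs : ℕ → List OTree → Set
WfEs : ℕ → List ETree → Set
WfE k (enode l cs) =
  PrunedShape k cs × All (λ g → l < label g) (grandchildren (enode l cs)) × WfOs k cs
WfOs k [] = ⊤
WfOs k (onode es ∷ os) = Linked _<_ (map label es) × WfEs k es × WfOs k os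
WfEs k [] = ⊤
WfEs k (e ∷ es) = WfE k e × WfEs k es

Forest : Set
Forest = List ETree

InF : ℕ → ℕ → Forest → Set
InF n k F = WfEs k F × Linked _<_ (map label F)
          × (labelsEs F ↭ applyUpTo suc n)

lleaf : Forest → ℕ
lleaf F = sumEs (λ v → if isLeaf v then 1 else 0) F

si : Forest → ℕ
si F = length (filter (λ t → isLeaf t ≟ true) F)

oldLeaves : Forest → ℕ
oldLeaves F = sumEs (λ u → length (filter (λ g → (isLeaf g ∧ isOld u g) ≟ true) (grandchildren u))) F

youngLeaves : Forest → ℕ
youngLeaves F = sumEs (λ u → length (filter (λ g → (isLeaf g ∧ not (isOld u g)) ≟ true) (grandchildren u))) F

firstLeaves : ℕ → ETree → Bool
firstLeaves k t = all isOLeaf (take (k ∸ 1) (kids t))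

-- tree t = T_i has a removable old leaf, where next is the root label of
-- T_{i+1} (nothing if i = m)
belowNext : Maybe ℕ → ETree → Bool
belowNext nothing  u = true
belowNext (just r) u = suc (label u) ≤ᵇ r

hasRemovableT : ℕ → ETree → Maybe ℕ → Bool
hasRemovableT k t nxt =
  any (λ u → isLeaf u ∧ isOld t u
             ∧ (length (filter (λ g → isLeaf g ≟ true) (grandchildren t)) ≡ᵇ 1)
             ∧ firstLeaves k t ∧ belowNext nxt u)
      (grandchildren t)

hasRemovable : ℕ → Forest → Bool
hasRemovable k [] = false
hasRemovable k (t ∷ []) = hasRemovableT k t nothing
hasRemovable k (t ∷ t' ∷ ts) = hasRemovableT k t (just (label t')) ∨ hasRemovable k (t' ∷ ts)

-- F ∈ 𝓕̄_n(k) (given F ∈ 𝓕_n(k)): rightmost tree is a singleton or the first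
-- k-1 children of its root are leaves.  F ∈ 𝓕̂_n(k) iff this is false.
isBar : ℕ → Forest → Bool
isBar k F with last F
... | nothing = false
... | just t  = isLeaf t ∨ firstLeaves k t

Card : (Forest → Set) → ℕ → Set
Card P c = Fin c ↔ Σ Forest (λ F → Irrelevant (P F))

{-# OPTIONS --safe #-}
-- Build the forests on [n + 1] from those on [n] by inserting the largest label n + 1, either as a new last singleton
-- or in one of the k slots below any labelled node.  Let L be the number of non-root leaves, which is lleaf - si, and
-- let O be the number of old leaves, not counting the old leaf of a root whose first k - 1 children are leaves and
-- whose grand children are all smaller than the next root.  The effect of an insertion on (O , L) depends only on the
-- node below which it happens, and all node classes are counted by O, L and n, the last root of a bar forest being the
-- only exception.  By induction on n the states are therefore a union of blocks: a block (i , M) consists of the states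
-- (i , i + y) with multiplicity C(M , y), where 2 i + M is n - 1 for bar forests and n for hat forests, and contributes
-- x^i (1 + x)^M.  Blocks correspond to the states with O = L, which are those without young leaves and removable old
-- leaves; this gives the gamma expansions, and hence the palindromicity that identifies the symmetric decomposition.
-- Summing over all states gives A_{n+1,m} = (1 + k m) A_{n,m} + k (n - m + 1) A_{n,m-1}.  The 1/k-Eulerian polynomials
-- satisfy the same recurrence: it says that their generating function A is fixed by the derivation
-- d/dz - k x z d/dz - k x (1 - x) d/dx, which follows by applying that derivation to A^k (e^{kz(x-1)} - x) = 1 - x.
module Submission where

-- Blocks survive an insertion because the four classes of nodes form two balanced pairs. Counted
-- old leaves and their owners are equally many, i on a block; inserting below them fixes O and
-- moves L by 0 or 1, a factor 1 + x. In the state (i , i + y) the other non-root leaves number y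
-- and the nodes of the last class M - y; inserting below them raises O and moves L by 0 or 1.
-- Weighted by C(M , y), each of these two classes contributes M x^(i+1) (1 + x)^(M-1). The last
-- root of a bar forest would spoil this. Leaving its old leaf out of O makes its one bar-preserving
-- slot lead to (O , L + 1), which pairs with the new singleton, leading to (O , L), to give 1 + x
-- once more. The clause about the next root keeps O unchanged when a singleton is appended behind
-- such a tree. Sums over forests are taken against an arbitrary test function of the state, so they
-- are identities between multisets of states, free of subtraction and of explicit binomial
-- coefficients.

module PowerSeries where
  open import Algebra.Bundles using (CommutativeRing)
  open import Algebra.Structures using (IsAbelianGroup)
  import Algebra.Properties.Group as GroupProperties
  open import Level using (0ℓ)
  open import Data.Nat using (ℕ; zero; suc)
  open import Data.Product using (_,_)
  import Algebra.Solver.Ring.NaturalCoefficients.Default as NatSolver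
  import Relation.Binary.Reasoning.Setoid as SetoidReasoning

  -- Rings of sequences: the Cauchy product and the binomial product.

  module Sequences (R : CommutativeRing 0ℓ 0ℓ) where
    open CommutativeRing R

    Seq : Set
    Seq = ℕ → Carrier

    infix 4 _≋_
    infixl 6 _+ₛ_
    _≋_ : Seq → Seq → Set
    p ≋ q = ∀ m → p m ≈ q m

    _+ₛ_ : Seq → Seq → Seq
    (p +ₛ q) m = p m + q m

    -ₛ_ : Seq → Seq
    (-ₛ p) m = - p m

    0ₛ : Seq
    0ₛ _ = 0#

    const : Carrier → Seq
    const c zero = c
    const c (suc _) = 0#

    tail : Seq → Seq
    tail p m = p (suc m)

    +ₛ-isAbelianGroup : IsAbelianGroup _≋_ _+ₛ_ 0ₛ -ₛ_
    +ₛ-isAbelianGroup = record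
      { isGroup = record
        { isMonoid = record
          { isSemigroup = record
            { isMagma = record
              { isEquivalence = record { refl = λ _ → refl ; sym = λ e m → sym (e m) ; trans = λ e f m → trans (e m) (f m) }
              ; ∙-cong = λ e f m → +-cong (e m) (f m) }
            ; assoc = λ p q r m → +-assoc (p m) (q m) (r m) }
          ; identity = (λ p m → +-identityˡ (p m)) , (λ p m → +-identityʳ (p m)) }
        ; inverse = (λ p m → -‿inverseˡ (p m)) , (λ p m → -‿inverseʳ (p m))
        ; ⁻¹-cong = λ e m → -‿cong (e m) }
      ; comm = λ p q m → +-comm (p m) (q m) }

    -- The Cauchy and the binomial product share the additive group and the unit `const 1#`, so both
    -- obtain their ring structure here; right identity and left distributivity come from
    -- commutativity.
    module Product
      (_·_ : Seq → Seq → Seq)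
      (·-cong : ∀ {p p' q q'} → p ≋ p' → q ≋ q' → (p · q) ≋ (p' · q'))
      (·-assoc : ∀ p q r → ((p · q) · r) ≋ (p · (q · r)))
      (·-comm : ∀ p q → (p · q) ≋ (q · p))
      (·-identityˡ : ∀ p → (const 1# · p) ≋ p)
      (·-distribʳ : ∀ r p q → ((p +ₛ q) · r) ≋ ((p · r) +ₛ (q · r)))
      where
      ringOfSequences : CommutativeRing 0ℓ 0ℓ
      ringOfSequences = record
        { Carrier = Seq ; _≈_ = _≋_ ; _+_ = _+ₛ_ ; _*_ = _·_ ; -_ = -ₛ_ ; 0# = 0ₛ ; 1# = const 1#
        ; isCommutativeRing = record
          { isRing = record
            { +-isAbelianGroup = +ₛ-isAbelianGroup
            ; *-cong = ·-cong
            ; *-assoc = ·-assoc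
            ; *-identity = ·-identityˡ , (λ p m → trans (·-comm p (const 1#) m) (·-identityˡ p m))
            ; distrib = (λ r p q m → trans (·-comm r (p +ₛ q) m) (trans (·-distribʳ r p q m) (+-cong (·-comm p r m) (·-comm q r m)))) , ·-distribʳ }
          ; *-comm = ·-comm } }

  module Cauchy (R : CommutativeRing 0ℓ 0ℓ) where
    open CommutativeRing R
    open Sequences R public
    open SetoidReasoning setoid
    open NatSolver commutativeSemiring using (solve; _:+_; _:*_; _:=_)

    infixl 7 _·_
    -- Recursion along p = p 0 + x · `tail p`, so that the ring laws follow by induction on the
    -- index, without reindexing of sums.
    _·_ : Seq → Seq → Seq
    (p · q) zero = p 0 * q 0
    (p · q) (suc m) = p 0 * q (suc m) + (tail p · q) m

    private
      distrib-rearrange : ∀ a b x y z → (a + b) * x + (y + z) ≈ (a * x + y) + (b * x + z)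
      distrib-rearrange = solve 5 (λ a b x y z → (a :+ b) :* x :+ (y :+ z) := (a :* x :+ y) :+ (b :* x :+ z)) refl
      swap-rearrange : ∀ a b c → a + (b + c) ≈ b + (a + c)
      swap-rearrange = solve 3 (λ a b c → a :+ (b :+ c) := b :+ (a :+ c)) refl
      scale-rearrange : ∀ c a b y → (c * a) * b + c * y ≈ c * (a * b + y)
      scale-rearrange = solve 4 (λ c a b y → (c :* a) :* b :+ c :* y := c :* (a :* b :+ y)) refl
      assoc-rearrange : ∀ a b r x y → (a * b) * r + (a * x + y) ≈ a * (b * r + x) + y
      assoc-rearrange = solve 5 (λ a b r x y → (a :* b) :* r :+ (a :* x :+ y) := a :* (b :* r :+ x) :+ y) refl

    ·-cong : ∀ {p p' q q'} → p ≋ p' → q ≋ q' → p · q ≋ p' · q'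
    ·-cong e f zero = *-cong (e 0) (f 0)
    ·-cong e f (suc m) = +-cong (*-cong (e 0) (f (suc m))) (·-cong (λ i → e (suc i)) f m)

    ·-distribʳ : ∀ r p q → (p +ₛ q) · r ≋ (p · r) +ₛ (q · r)
    ·-distribʳ r p q zero = distribʳ (r 0) (p 0) (q 0)
    ·-distribʳ r p q (suc m) = trans (+-congˡ (·-distribʳ r (tail p) (tail q) m)) (distrib-rearrange (p 0) (q 0) (r (suc m)) _ _)

    ·-scale : ∀ c p q → (λ i → c * p i) · q ≋ (λ m → c * (p · q) m)
    ·-scale c p q zero = *-assoc c (p 0) (q 0)
    ·-scale c p q (suc m) = trans (+-congˡ (·-scale c (tail p) q m)) (scale-rearrange c (p 0) (q (suc m)) _)

    -- The recursion peels the left factor; this mirror image peels the right one, which is what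
    -- commutativity needs.
    ·-tailʳ : ∀ p q m → (p · q) (suc m) ≈ p (suc m) * q 0 + (p · tail q) m
    ·-tailʳ p q zero = +-comm _ _
    ·-tailʳ p q (suc m) = trans (+-congˡ (·-tailʳ (tail p) q m)) (swap-rearrange _ _ _)

    ·-comm : ∀ p q → p · q ≋ q · p
    ·-comm p q zero = *-comm (p 0) (q 0)
    ·-comm p q (suc m) = trans (+-cong (*-comm _ _) (·-comm (tail p) q m)) (sym (·-tailʳ q p m))

    ·-assoc : ∀ p q r → (p · q) · r ≋ p · (q · r)
    ·-assoc p q r zero = *-assoc (p 0) (q 0) (r 0)
    ·-assoc p q r (suc m) = begin
        (p 0 * q 0) * r (suc m) + (tail (p · q) · r) m
      ≈⟨ +-congˡ (·-distribʳ r (λ i → p 0 * tail q i) (tail p · q) m) ⟩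
        (p 0 * q 0) * r (suc m) + (((λ i → p 0 * tail q i) · r) m + ((tail p · q) · r) m)
      ≈⟨ +-congˡ (+-cong (·-scale (p 0) (tail q) r m) (·-assoc (tail p) q r m)) ⟩
        (p 0 * q 0) * r (suc m) + (p 0 * (tail q · r) m + (tail p · (q · r)) m)
      ≈⟨ assoc-rearrange (p 0) (q 0) (r (suc m)) _ _ ⟩
        p 0 * (q · r) (suc m) + (tail p · (q · r)) m ∎

    0·p : ∀ p → 0ₛ · p ≋ 0ₛ
    0·p p zero = zeroˡ (p 0)
    0·p p (suc m) = trans (+-cong (zeroˡ _) (0·p p m)) (+-identityˡ 0#)

    const-· : ∀ c p m → (const c · p) m ≈ c * p m
    const-· c p zero = refl
    const-· c p (suc m) = trans (+-congˡ (0·p p m)) (+-identityʳ _)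

    open Product _·_ ·-cong ·-assoc ·-comm (λ p m → trans (const-· 1# p m) (*-identityˡ (p m))) ·-distribʳ public

  module Naturals (R : CommutativeRing 0ℓ 0ℓ) where
    open CommutativeRing R

    ν : ℕ → Carrier
    ν zero = 0#
    ν (suc n) = 1# + ν n

    pow : Carrier → ℕ → Carrier
    pow a zero = 1#
    pow a (suc n) = a * pow a n

  -- Derivations and logarithmic differentiation.

  record Derivation (R : CommutativeRing 0ℓ 0ℓ) : Set where
    open CommutativeRing R
    field
      d : Carrier → Carrier
      d-cong : ∀ {a b} → a ≈ b → d a ≈ d b
      d-+ : ∀ a b → d (a + b) ≈ d a + d b
      d-* : ∀ a b → d (a * b) ≈ d a * b + a * d b

  module DerivationLemmas (R : CommutativeRing 0ℓ 0ℓ) (D : Derivation R) where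
    open CommutativeRing R
    open Derivation D
    open Naturals R
    open SetoidReasoning setoid
    open NatSolver commutativeSemiring using (solve; _:+_; _:*_; _:=_)

    d-0 : d 0# ≈ 0#
    d-0 = GroupProperties.identityˡ-unique +-group (d 0#) (d 0#) (trans (sym (d-+ 0# 0#)) (d-cong (+-identityˡ 0#)))

    d-1 : d 1# ≈ 0#
    d-1 = GroupProperties.identityˡ-unique +-group (d 1#) (d 1#)
      (trans (sym (trans (d-* 1# 1#) (+-cong (*-identityʳ _) (*-identityˡ _)))) (d-cong (*-identityˡ 1#)))

    private
      power-rearrange₁ : ∀ a p da dp → a * (da * p + a * dp) ≈ (a * p) * da + a * (a * dp)
      power-rearrange₁ = solve 4 (λ a p da dp → a :* (da :* p :+ a :* dp) := (a :* p) :* da :+ a :* (a :* dp)) refl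
      power-rearrange₂ : ∀ a p da n → a * (n * (p * da)) ≈ n * ((a * p) * da)
      power-rearrange₂ = solve 4 (λ a p da n → a :* (n :* (p :* da)) := n :* ((a :* p) :* da)) refl

    -- The power rule, multiplied by a so that no predecessor of the exponent occurs.
    power-rule : ∀ a n → a * d (pow a n) ≈ ν n * (pow a n * d a)
    power-rule a zero = trans (*-congˡ d-1) (trans (zeroʳ a) (sym (zeroˡ _)))
    power-rule a (suc n) = begin
        a * d (a * pow a n)
      ≈⟨ *-congˡ (d-* a (pow a n)) ⟩
        a * (d a * pow a n + a * d (pow a n))
      ≈⟨ power-rearrange₁ a (pow a n) (d a) (d (pow a n)) ⟩
        (a * pow a n) * d a + a * (a * d (pow a n))
      ≈⟨ +-cong (sym (*-identityˡ _)) (trans (*-congˡ (power-rule a n)) (power-rearrange₂ a (pow a n) (d a) (ν n))) ⟩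
        1# * ((a * pow a n) * d a) + ν n * ((a * pow a n) * d a)
      ≈⟨ sym (distribʳ _ _ _) ⟩
        ν (suc n) * (pow a (suc n) * d a) ∎

    private
      root₁ : ∀ a p q dp dq → a * (dp * q + p * dq) ≈ (a * dp) * q + a * (p * dq)
      root₁ = solve 5 (λ a p q dp dq → a :* (dp :* q :+ p :* dq) := (a :* dp) :* q :+ a :* (p :* dq)) refl
      root₂ : ∀ k p q da → (k * (p * da)) * q ≈ k * ((p * q) * da)
      root₂ = solve 4 (λ k p q da → (k :* (p :* da)) :* q := k :* ((p :* q) :* da)) refl
      root₃ : ∀ k n a p q → a * (p * (k * (n * q))) ≈ k * (n * (a * (p * q)))
      root₃ = solve 5 (λ k n a p q → a :* (p :* (k :* (n :* q))) := k :* (n :* (a :* (p :* q)))) refl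
      root₄ : ∀ a k x n → a * (k * (x * n)) + k * (n * (a * n)) ≈ k * (n * ((n + x) * a))
      root₄ = solve 4 (λ a k x n → a :* (k :* (x :* n)) :+ k :* (n :* (a :* n)) := k :* (n :* ((n :+ x) :* a))) refl
      root₅ : ∀ a p y z → a * (p * (y + z)) ≈ a * (p * y) + a * (p * z)
      root₅ = solve 4 (λ a p y z → a :* (p :* (y :+ z)) := a :* (p :* y) :+ a :* (p :* z)) refl

    -- Logarithmic differentiation of a^k q = n, cleared of denominators.
    root-equation : ∀ k a q n x → pow a k * q ≈ n → d q + ν k * (n * q) ≈ 0# → d n ≈ ν k * (x * n) → n + x ≈ 1# →
      ν k * (n * d a) ≈ ν k * (n * a)
    root-equation k a q n x root dq dn sum = begin
        κ * (n * d a)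
      ≈⟨ *-congˡ (*-congʳ (sym root)) ⟩
        κ * ((P * q) * d a)
      ≈⟨ sym (root₂ κ P q (d a)) ⟩
        (κ * (P * d a)) * q
      ≈⟨ *-congʳ (sym (power-rule a k)) ⟩
        (a * d P) * q
      ≈⟨ sym (+-identityʳ _) ⟩
        (a * d P) * q + 0#
      -- The hypothesis on `d q` enters as an added zero, so that Leibniz' rule can assemble
      -- `d (P * q)` without any subtraction.
      ≈⟨ +-congˡ (sym (trans (*-congˡ (trans (*-congˡ dq) (zeroʳ P))) (zeroʳ a))) ⟩
        (a * d P) * q + a * (P * (d q + κ * (n * q)))
      ≈⟨ +-congˡ (root₅ a P (d q) (κ * (n * q))) ⟩
        (a * d P) * q + (a * (P * d q) + a * (P * (κ * (n * q))))
      ≈⟨ sym (+-assoc _ _ _) ⟩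
        ((a * d P) * q + a * (P * d q)) + a * (P * (κ * (n * q)))
      ≈⟨ +-cong (sym (root₁ a P q (d P) (d q))) (root₃ κ n a P q) ⟩
        a * (d P * q + P * d q) + κ * (n * (a * (P * q)))
      ≈⟨ +-cong (*-congˡ (trans (sym (d-* P q)) (trans (d-cong root) dn))) (*-congˡ (*-congˡ (*-congˡ root))) ⟩
        a * (κ * (x * n)) + κ * (n * (a * n))
      ≈⟨ root₄ a κ x n ⟩
        κ * (n * ((n + x) * a))
      ≈⟨ *-congˡ (*-congˡ (trans (*-congʳ sum) (*-identityˡ a))) ⟩
        κ * (n * a) ∎
      where
      κ = ν k
      P = pow a k

  -- Sequences as exponential generating functions; the product is determined by its constant term and Leibniz' rule.
  module Hurwitz (R : CommutativeRing 0ℓ 0ℓ) where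
    open CommutativeRing R
    open Sequences R public
    open Naturals R
    open SetoidReasoning setoid
    open NatSolver commutativeSemiring using (solve; _:+_; _:*_; _:=_)

    infixl 7 _∗_
    _∗_ : Seq → Seq → Seq
    (F ∗ G) zero = F 0 * G 0
    (F ∗ G) (suc n) = (tail F ∗ G) n + (F ∗ tail G) n

    private
      interchange : ∀ a b c e → (a + b) + (c + e) ≈ (a + c) + (b + e)
      interchange = solve 4 (λ a b c e → (a :+ b) :+ (c :+ e) := (a :+ c) :+ (b :+ e)) refl

    ∗-cong : ∀ {F F' G G'} → F ≋ F' → G ≋ G' → F ∗ G ≋ F' ∗ G'
    ∗-cong e f zero = *-cong (e 0) (f 0)
    ∗-cong e f (suc n) = +-cong (∗-cong (λ i → e (suc i)) f n) (∗-cong e (λ i → f (suc i)) n)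

    ∗-comm : ∀ F G → F ∗ G ≋ G ∗ F
    ∗-comm F G zero = *-comm (F 0) (G 0)
    ∗-comm F G (suc n) = trans (+-cong (∗-comm (tail F) G n) (∗-comm F (tail G) n)) (+-comm _ _)

    ∗-distribʳ : ∀ H F G → (F +ₛ G) ∗ H ≋ (F ∗ H) +ₛ (G ∗ H)
    ∗-distribʳ H F G zero = distribʳ (H 0) (F 0) (G 0)
    ∗-distribʳ H F G (suc n) = trans (+-cong (∗-distribʳ H (tail F) (tail G) n) (∗-distribʳ (tail H) F G n)) (interchange _ _ _ _)

    ∗-distribˡ : ∀ H F G → H ∗ (F +ₛ G) ≋ (H ∗ F) +ₛ (H ∗ G)
    ∗-distribˡ H F G n = trans (∗-comm H (F +ₛ G) n) (trans (∗-distribʳ H F G n) (+-cong (∗-comm F H n) (∗-comm G H n)))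

    ∗-assoc : ∀ F G H → (F ∗ G) ∗ H ≋ F ∗ (G ∗ H)
    ∗-assoc F G H zero = *-assoc (F 0) (G 0) (H 0)
    ∗-assoc F G H (suc n) = begin
        (tail (F ∗ G) ∗ H) n + ((F ∗ G) ∗ tail H) n
      ≈⟨ +-congʳ (∗-distribʳ H (tail F ∗ G) (F ∗ tail G) n) ⟩
        (((tail F ∗ G) ∗ H) n + ((F ∗ tail G) ∗ H) n) + ((F ∗ G) ∗ tail H) n
      ≈⟨ +-cong (+-cong (∗-assoc (tail F) G H n) (∗-assoc F (tail G) H n)) (∗-assoc F G (tail H) n) ⟩
        ((tail F ∗ (G ∗ H)) n + (F ∗ (tail G ∗ H)) n) + (F ∗ (G ∗ tail H)) n
      ≈⟨ +-assoc _ _ _ ⟩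
        (tail F ∗ (G ∗ H)) n + ((F ∗ (tail G ∗ H)) n + (F ∗ (G ∗ tail H)) n)
      ≈⟨ +-congˡ (sym (∗-distribˡ F (tail G ∗ H) (G ∗ tail H) n)) ⟩
        (tail F ∗ (G ∗ H)) n + (F ∗ tail (G ∗ H)) n ∎

    0∗F : ∀ F → 0ₛ ∗ F ≋ 0ₛ
    0∗F F zero = zeroˡ (F 0)
    0∗F F (suc n) = trans (+-cong (0∗F F n) (0∗F (tail F) n)) (+-identityˡ 0#)

    const-∗ : ∀ c F n → (const c ∗ F) n ≈ c * F n
    const-∗ c F zero = refl
    const-∗ c F (suc n) = trans (+-cong (0∗F F n) (const-∗ c (tail F) n)) (+-identityˡ _)

    open Product _∗_ ∗-cong ∗-assoc ∗-comm (λ F n → trans (const-∗ 1# F n) (*-identityˡ (F n))) ∗-distribʳ public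

    module _ (D : Derivation R) (a b : Carrier) where
      open Derivation D

      -- The operator z d/dz on exponential generating functions.
      Euler : Seq → Seq
      Euler F n = ν n * F n

      Euler-tail : ∀ F → tail (Euler F) ≋ tail F +ₛ Euler (tail F)
      Euler-tail F n = trans (distribʳ _ _ _) (+-congʳ (*-identityˡ _))

      private
        sixfold : ∀ x y p q r s → (x + p + q) + (r + (y + s)) ≈ (x + y) + ((p + r) + (q + s))
        sixfold = solve 6 (λ x y p q r s → (x :+ p :+ q) :+ (r :+ (y :+ s)) := (x :+ y) :+ ((p :+ r) :+ (q :+ s))) refl

      Euler-∗ : ∀ F G → Euler (F ∗ G) ≋ (Euler F ∗ G) +ₛ (F ∗ Euler G)
      Euler-∗ F G zero = trans (zeroˡ _) (sym (trans (+-cong (trans (*-congʳ (zeroˡ _)) (zeroˡ _)) (trans (*-congˡ (zeroˡ _)) (zeroʳ _))) (+-identityˡ 0#)))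
      Euler-∗ F G (suc n) = sym (begin
          ((tail (Euler F) ∗ G) n + (Euler F ∗ tail G) n) + ((tail F ∗ Euler G) n + (F ∗ tail (Euler G)) n)
        ≈⟨ +-cong (+-congʳ (trans (∗-cong (Euler-tail F) (λ _ → refl) n) (∗-distribʳ G (tail F) (Euler (tail F)) n)))
             (+-congˡ (trans (∗-cong {F = F} (λ _ → refl) (Euler-tail G) n) (∗-distribˡ F (tail G) (Euler (tail G)) n))) ⟩
          (((tail F ∗ G) n + (Euler (tail F) ∗ G) n) + (Euler F ∗ tail G) n) + ((tail F ∗ Euler G) n + ((F ∗ tail G) n + (F ∗ Euler (tail G)) n))
        ≈⟨ sixfold _ _ _ _ _ _ ⟩
          ((tail F ∗ G) n + (F ∗ tail G) n) + (((Euler (tail F) ∗ G) n + (tail F ∗ Euler G) n) + ((Euler F ∗ tail G) n + (F ∗ Euler (tail G)) n))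
        ≈⟨ +-congˡ (+-cong (sym (Euler-∗ (tail F) G n)) (sym (Euler-∗ F (tail G) n))) ⟩
          ((tail F ∗ G) n + (F ∗ tail G) n) + (ν n * (tail F ∗ G) n + ν n * (F ∗ tail G) n)
        ≈⟨ +-cong (sym (*-identityˡ _)) (sym (distribˡ _ _ _)) ⟩
          1# * (F ∗ G) (suc n) + ν n * (F ∗ G) (suc n)
        ≈⟨ sym (distribʳ _ _ _) ⟩
          ν (suc n) * (F ∗ G) (suc n) ∎)

      lift : Seq → Seq
      lift F n = d (F n)

      lift-∗ : ∀ F G → lift (F ∗ G) ≋ (lift F ∗ G) +ₛ (F ∗ lift G)
      lift-∗ F G zero = d-* (F 0) (G 0)
      lift-∗ F G (suc n) = trans (d-+ _ _) (trans (+-cong (lift-∗ (tail F) G n) (lift-∗ F (tail G) n)) (interchange _ _ _ _))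

      -- The operator d/dz + a z d/dz + b D, with D acting on the coefficients: the shift of the
      -- index is d/dz. It is a derivation because a and b do not involve z and each summand is one.
      flow : Seq → Seq
      flow F n = F (suc n) + (a * (ν n * F n) + b * d (F n))

      private
        flow-rearrange₁ : ∀ a b x x' y y' z z' → (x + x') + (a * (y + y') + b * (z + z'))
          ≈ (x + (a * y + b * z)) + (x' + (a * y' + b * z'))
        flow-rearrange₁ = solve 8 (λ a b x x' y y' z z' → (x :+ x') :+ (a :* (y :+ y') :+ b :* (z :+ z')) := (x :+ (a :* y :+ b :* z)) :+ (x' :+ (a :* y' :+ b :* z'))) refl

        scaleˡ : ∀ c F G n → ((λ i → c * F i) ∗ G) n ≈ c * (F ∗ G) n
        scaleˡ c F G n = trans (∗-cong {G = G} (λ i → sym (const-∗ c F i)) (λ _ → refl) n) (trans (∗-assoc (const c) F G n) (const-∗ c (F ∗ G) n))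

        flow-∗-split : ∀ F G n → (flow F ∗ G) n ≈ (tail F ∗ G) n + (a * (Euler F ∗ G) n + b * (lift F ∗ G) n)
        flow-∗-split F G n = trans (∗-distribʳ G (tail F) (λ i → a * Euler F i + b * lift F i) n)
          (+-congˡ (trans (∗-distribʳ G (λ i → a * Euler F i) (λ i → b * lift F i) n) (+-cong (scaleˡ a (Euler F) G n) (scaleˡ b (lift F) G n))))

      flow-derivation : Derivation ringOfSequences
      flow-derivation = record
        { d = flow
        ; d-cong = λ e n → +-cong (e (suc n)) (+-cong (*-congˡ (*-congˡ (e n))) (*-congˡ (d-cong (e n))))
        ; d-+ = λ F G n → trans (+-congˡ (+-cong (*-congˡ (distribˡ _ _ _)) (*-congˡ (d-+ _ _)))) (flow-rearrange₁ a b _ _ _ _ _ _)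
        ; d-* = λ F G n → begin
              (F ∗ G) (suc n) + (a * Euler (F ∗ G) n + b * lift (F ∗ G) n)
            ≈⟨ +-congˡ (+-cong (*-congˡ (Euler-∗ F G n)) (*-congˡ (lift-∗ F G n))) ⟩
              ((tail F ∗ G) n + (F ∗ tail G) n) + (a * ((Euler F ∗ G) n + (F ∗ Euler G) n) + b * ((lift F ∗ G) n + (F ∗ lift G) n))
            ≈⟨ flow-rearrange₁ a b _ _ _ _ _ _ ⟩
              ((tail F ∗ G) n + (a * (Euler F ∗ G) n + b * (lift F ∗ G) n)) + ((F ∗ tail G) n + (a * (F ∗ Euler G) n + b * (F ∗ lift G) n))
            ≈⟨ +-cong (sym (flow-∗-split F G n)) (sym (trans (∗-comm F (flow G) n) (trans (flow-∗-split G F n)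
                 (+-cong (∗-comm (tail G) F n) (+-cong (*-congˡ (∗-comm (Euler G) F n)) (*-congˡ (∗-comm (lift G) F n))))))) ⟩
              (flow F ∗ G) n + (F ∗ flow G) n ∎ }

  module CauchyDerivation (R : CommutativeRing 0ℓ 0ℓ) where
    open CommutativeRing R
    open Cauchy R
    open Naturals R
    open SetoidReasoning setoid
    open NatSolver commutativeSemiring using (solve; _:+_; _:*_; _:=_)
    private
      theta-rearrange : ∀ x u v w n → (x + u) + (n * w + v) ≈ n * w + (x + (u + v))
      theta-rearrange = solve 5 (λ x u v w n → (x :+ u) :+ (n :* w :+ v) := n :* w :+ (x :+ (u :+ v))) refl
      theta-commute : ∀ p q n → p * (n * q) ≈ n * (p * q)
      theta-commute = solve 3 (λ p q n → p :* (n :* q) := n :* (p :* q)) refl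

    -- The operator x d/dx. It is preferred to d/dx because it multiplies each coefficient in place.
    θ : Seq → Seq
    θ p m = ν m * p m

    θ-tail : ∀ p → tail (θ p) ≋ tail p +ₛ θ (tail p)
    θ-tail p m = trans (distribʳ _ _ _) (+-congʳ (*-identityˡ _))

    θ-· : ∀ p q → θ (p · q) ≋ (θ p · q) +ₛ (p · θ q)
    θ-· p q zero = trans (zeroˡ _) (sym (trans (+-cong (trans (*-congʳ (zeroˡ _)) (zeroˡ _)) (trans (*-congˡ (zeroˡ _)) (zeroʳ _))) (+-identityˡ 0#)))
    θ-· p q (suc m) = sym (begin
        (θ p 0 * q (suc m) + (tail (θ p) · q) m) + (p 0 * θ q (suc m) + (tail p · θ q) m)
      ≈⟨ +-cong (trans (+-cong (trans (*-congʳ (zeroˡ _)) (zeroˡ _)) (trans (·-cong (θ-tail p) (λ _ → refl) m) (·-distribʳ q (tail p) (θ (tail p)) m))) (+-identityˡ _))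
           (+-congʳ (theta-commute (p 0) (q (suc m)) (ν (suc m)))) ⟩
        ((tail p · q) m + (θ (tail p) · q) m) + (ν (suc m) * (p 0 * q (suc m)) + (tail p · θ q) m)
      ≈⟨ theta-rearrange _ _ _ _ _ ⟩
        ν (suc m) * (p 0 * q (suc m)) + ((tail p · q) m + ((θ (tail p) · q) m + (tail p · θ q) m))
      ≈⟨ +-congˡ (+-cong (sym (*-identityˡ _)) (sym (θ-· (tail p) q m))) ⟩
        ν (suc m) * (p 0 * q (suc m)) + (1# * (tail p · q) m + ν m * (tail p · q) m)
      ≈⟨ +-congˡ (sym (distribʳ _ _ _)) ⟩
        ν (suc m) * (p 0 * q (suc m)) + ν (suc m) * (tail p · q) m
      ≈⟨ sym (distribˡ _ _ _) ⟩
        ν (suc m) * (p · q) (suc m) ∎)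

    θ-derivation : Derivation ringOfSequences
    θ-derivation = record
      { d = θ
      ; d-cong = λ e m → *-congˡ (e m)
      ; d-+ = λ p q m → distribˡ (ν m) (p m) (q m)
      ; d-* = θ-· }

-- The recurrence of the 1/k-Eulerian polynomials.

module Eulerian where
  open import Algebra.Bundles using (CommutativeRing)
  import Algebra.Solver.Ring.NaturalCoefficients.Default as NatSolver
  import Relation.Binary.Reasoning.Setoid as SetoidReasoning
  open import Level using (0ℓ)
  open import Data.Nat as ℕ using (ℕ; zero; suc; _∸_; s≤s; z≤n)
  import Data.Nat.Properties as ℕ
  open import Data.Nat.Combinatorics using (_C_; nCk+nC[k+1]≡[n+1]C[k+1]; k>n⇒nCk≡0; nCk≡nC[n∸k]; nCn≡1)
  open import Data.Integer as ℤ using (+_)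
  import Data.Integer.Properties as ℤ
  open import Data.List using (map; applyUpTo)
  open import Data.List.Properties using (map-applyUpTo)
  open import Data.Product using (proj₂)
  open import Data.Rational using (ℚ; 0ℚ; 1ℚ; _+_; _*_; _-_; -_; 1/_; NonZero; toℚᵘ)
  open import Data.Rational.Properties
  open import Data.Rational.Unnormalised using (mkℚᵘ; *≡*) renaming (_≃_ to _≃ᵘ_)
  import Data.Rational.Unnormalised.Properties as ℚᵘ
  open import Data.Rational.Solver using (module +-*-Solver)
  open import Function using (_∘_)
  open import Relation.Binary.PropositionalEquality
  open import Defs
  open PowerSeries

  open +-*-Solver using (solve; _:+_; _:*_; _:-_; :-_; _:=_; con)

  -- Normalisation by the gcd blocks computation on a variable `n`, so the homomorphism laws are
  -- checked on unnormalised fractions; the `0` encodes the denominator 1.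
  toℚᵘ-ℕ : ∀ n → toℚᵘ (ℕ→ℚ n) ≃ᵘ mkℚᵘ (+ n) 0
  toℚᵘ-ℕ n = toℚᵘ-fromℚᵘ (mkℚᵘ (+ n) 0)

  ℕ→ℚ-+ : ∀ a b → ℕ→ℚ (a ℕ.+ b) ≡ ℕ→ℚ a + ℕ→ℚ b
  ℕ→ℚ-+ a b = toℚᵘ-injective (ℚᵘ.≃-trans (toℚᵘ-ℕ (a ℕ.+ b)) (ℚᵘ.≃-trans (*≡* (cong (ℤ._* (+ 1)) (cong₂ ℤ._+_ (sym (ℤ.*-identityʳ (+ a))) (sym (ℤ.*-identityʳ (+ b))))))
    (ℚᵘ.≃-sym (ℚᵘ.≃-trans (toℚᵘ-homo-+ (ℕ→ℚ a) (ℕ→ℚ b)) (ℚᵘ.+-cong (toℚᵘ-ℕ a) (toℚᵘ-ℕ b))))))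

  ℕ→ℚ-* : ∀ a b → ℕ→ℚ (a ℕ.* b) ≡ ℕ→ℚ a * ℕ→ℚ b
  ℕ→ℚ-* a b = toℚᵘ-injective (ℚᵘ.≃-trans (toℚᵘ-ℕ (a ℕ.* b)) (ℚᵘ.≃-trans (*≡* (cong (ℤ._* (+ 1)) (ℤ.pos-* a b)))
    (ℚᵘ.≃-sym (ℚᵘ.≃-trans (toℚᵘ-homo-* (ℕ→ℚ a) (ℕ→ℚ b)) (ℚᵘ.*-cong (toℚᵘ-ℕ a) (toℚᵘ-ℕ b))))))

  -- Logarithmic differentiation of a k-th power yields only k times the desired equation; this
  -- removes the k.
  ℕ→ℚ-cancel : ∀ j {u v} → ℕ→ℚ (suc j) * u ≡ ℕ→ℚ (suc j) * v → u ≡ v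
  ℕ→ℚ-cancel j {u} {v} e = trans (sym (back u)) (trans (cong (1/ K *_) e) (back v))
    where
    K = ℕ→ℚ (suc j)
    instance
      K≢0 : NonZero K
      K≢0 = pos⇒nonZero K {{normalize-pos (suc j) 1}}
    back : ∀ w → 1/ K * (K * w) ≡ w
    back w = trans (sym (*-assoc (1/ K) K w)) (trans (cong (_* w) (*-inverseˡ K)) (*-identityˡ w))

  sumUp : ℕ → (ℕ → ℚ) → ℚ
  sumUp zero f = 0ℚ
  sumUp (suc n) f = f 0 + sumUp n (f ∘ suc)

  sumℚ-applyUpTo : ∀ (f : ℕ → ℚ) n → sumℚ (applyUpTo f n) ≡ sumUp n f
  sumℚ-applyUpTo f zero = refl
  sumℚ-applyUpTo f (suc n) = cong (_+_ (f 0)) (sumℚ-applyUpTo (f ∘ suc) n)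

  sumℚ-range : ∀ (f : ℕ → ℚ) n → sumℚ (map f (range 0 n)) ≡ sumUp (suc n) f
  sumℚ-range f n = trans (cong sumℚ (map-applyUpTo (λ i → i) f (suc n))) (sumℚ-applyUpTo f (suc n))

  sumUp-cong : ∀ n {f g} → (∀ i → i ℕ.< n → f i ≡ g i) → sumUp n f ≡ sumUp n g
  sumUp-cong zero e = refl
  sumUp-cong (suc n) e = cong₂ _+_ (e 0 (s≤s z≤n)) (sumUp-cong n (λ i lt → e (suc i) (s≤s lt)))

  sumUp-+ : ∀ n f g → sumUp n (λ i → f i + g i) ≡ sumUp n f + sumUp n g
  sumUp-+ zero f g = refl
  sumUp-+ (suc n) f g = trans (cong (_+_ (f 0 + g 0)) (sumUp-+ n (f ∘ suc) (g ∘ suc)))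
    (solve 4 (λ a b c d → (a :+ b) :+ (c :+ d) := (a :+ c) :+ (b :+ d)) refl (f 0) (g 0) (sumUp n (f ∘ suc)) (sumUp n (g ∘ suc)))

  sumUp-last : ∀ n f → sumUp (suc n) f ≡ sumUp n f + f n
  sumUp-last zero f = trans (+-identityʳ (f 0)) (sym (+-identityˡ (f 0)))
  sumUp-last (suc n) f = trans (cong (_+_ (f 0)) (sumUp-last n (f ∘ suc))) (sym (+-assoc (f 0) (sumUp n (f ∘ suc)) (f (suc n))))

  module S = Cauchy +-*-commutativeRing
  open S using (_·_; _≋_; _+ₛ_; 0ₛ; tail)

  SRing : CommutativeRing 0ℓ 0ℓ
  SRing = S.ringOfSequences

  module SR = CommutativeRing SRing
  module Sν = Naturals SRing
  module Qν = Naturals +-*-commutativeRing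
  module H = Hurwitz SRing
  open H using (_∗_)

  ⊗-· : ∀ p q → (p ⊗ q) ≋ (p · q)
  ⊗-· p q m = trans (sumℚ-range (λ i → p i * q (m ∸ i)) m) (go p m)
    where
    go : ∀ p m → sumUp (suc m) (λ i → p i * q (m ∸ i)) ≡ (p · q) m
    go p zero = +-identityʳ _
    go p (suc m) = cong (_+_ (p 0 * q (suc m))) (go (tail p) m)

  -- The sum of C(n , a) g(a , b) over a + b = n, with the binomials generated by Pascal's rule. In
  -- this shape the binomial convolution visibly satisfies Leibniz' rule, which defines `_∗_`.
  BinQ : ℕ → (ℕ → ℕ → ℚ) → ℚ
  BinQ zero g = g 0 0
  BinQ (suc n) g = BinQ n (λ a b → g (suc a) b) + BinQ n (λ a b → g a (suc b))

  nC0≡1 : ∀ n → n C 0 ≡ 1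
  nC0≡1 n = trans (nCk≡nC[n∸k] {0} {n} z≤n) (nCn≡1 n)

  BinQ-sum : ∀ n g → BinQ n g ≡ sumUp (suc n) (λ i → ℕ→ℚ (n C i) * g i (n ∸ i))
  BinQ-sum zero g = sym (trans (+-identityʳ _) (*-identityˡ (g 0 0)))
  BinQ-sum (suc n) g = begin
      BinQ n (λ a b → g (suc a) b) + BinQ n (λ a b → g a (suc b))
    ≡⟨ cong₂ _+_ (BinQ-sum n (λ a b → g (suc a) b)) (BinQ-sum n (λ a b → g a (suc b))) ⟩
      P + sumUp (suc n) (λ i → c i * g i (suc (n ∸ i)))
    ≡⟨ cong (_+_ P) (sumUp-cong (suc n) (λ { i (s≤s le) → cong (λ z → c i * g i z) (sym (ℕ.+-∸-assoc 1 le)) })) ⟩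
      P + sumUp (suc n) T
    -- The term of index n + 1 is added for free, since C(n , n + 1) = 0. The sum can then be peeled
    -- at index 0 and aligned with `P`, where Pascal's rule applies termwise.
    ≡⟨ cong (_+_ P) (trans (sym (+-identityʳ _)) (cong (_+_ (sumUp (suc n) T)) (sym top))) ⟩
      P + (sumUp (suc n) T + T (suc n))
    ≡⟨ cong (_+_ P) (sym (sumUp-last (suc n) T)) ⟩
      P + (T 0 + sumUp (suc n) (T ∘ suc))
    ≡⟨ solve 3 (λ p t r → p :+ (t :+ r) := t :+ (p :+ r)) refl P (T 0) (sumUp (suc n) (T ∘ suc)) ⟩
      T 0 + (P + sumUp (suc n) (T ∘ suc))
    ≡⟨ cong₂ _+_ (cong (λ z → ℕ→ℚ z * g 0 (suc n)) (trans (nC0≡1 n) (sym (nC0≡1 (suc n))))) (sym (sumUp-+ (suc n) (λ i → c i * g (suc i) (n ∸ i)) (T ∘ suc))) ⟩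
      ℕ→ℚ (suc n C 0) * g 0 (suc n) + sumUp (suc n) (λ i → c i * g (suc i) (n ∸ i) + c (suc i) * g (suc i) (n ∸ i))
    ≡⟨ cong (_+_ (ℕ→ℚ (suc n C 0) * g 0 (suc n))) (sumUp-cong (suc n) (λ i _ → trans (sym (*-distribʳ-+ (g (suc i) (n ∸ i)) (c i) (c (suc i))))
         (cong (_* g (suc i) (n ∸ i)) (trans (sym (ℕ→ℚ-+ (n C i) (n C suc i))) (cong ℕ→ℚ (nCk+nC[k+1]≡[n+1]C[k+1] n i)))))) ⟩
      ℕ→ℚ (suc n C 0) * g 0 (suc n) + sumUp (suc n) (λ i → ℕ→ℚ (suc n C suc i) * g (suc i) (n ∸ i)) ∎
    where
    open ≡-Reasoning
    c : ℕ → ℚ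
    c i = ℕ→ℚ (n C i)
    P = sumUp (suc n) (λ i → c i * g (suc i) (n ∸ i))
    T : ℕ → ℚ
    T i = c i * g i (suc n ∸ i)
    top : T (suc n) ≡ 0ℚ
    top = trans (cong (λ z → ℕ→ℚ z * g (suc n) (suc n ∸ suc n)) (k>n⇒nCk≡0 (ℕ.n<1+n n))) (*-zeroˡ (g (suc n) (suc n ∸ suc n)))

  ⋆-∗ : ∀ F G → (F ⋆ G) H.≋ (F ∗ G)
  ⋆-∗ F G n m = begin
      sumℚ (map (λ i → ℕ→ℚ (n C i) * (F i ⊗ G (n ∸ i)) m) (range 0 n))
    ≡⟨ sumℚ-range (λ i → ℕ→ℚ (n C i) * (F i ⊗ G (n ∸ i)) m) n ⟩
      sumUp (suc n) (λ i → ℕ→ℚ (n C i) * (F i ⊗ G (n ∸ i)) m)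
    ≡⟨ sumUp-cong (suc n) (λ i _ → cong (ℕ→ℚ (n C i) *_) (⊗-· (F i) (G (n ∸ i)) m)) ⟩
      sumUp (suc n) (λ i → ℕ→ℚ (n C i) * (F i · G (n ∸ i)) m)
    ≡⟨ sym (BinQ-sum n (λ a b → (F a · G b) m)) ⟩
      BinQ n (λ a b → (F a · G b) m)
    ≡⟨ go n F G ⟩
      (F ∗ G) n m ∎
    where
    open ≡-Reasoning
    go : ∀ n F G → BinQ n (λ a b → (F a · G b) m) ≡ (F ∗ G) n m
    go zero F G = refl
    go (suc n) F G = cong₂ _+_ (go n (λ i → F (suc i)) G) (go n F (λ i → G (suc i)))

  constS-const : ∀ c → constS c ≋ S.const c
  constS-const c zero = refl
  constS-const c (suc m) = refl

  powS-pow : ∀ p n → powS p n ≋ Sν.pow p n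
  powS-pow p zero = constS-const 1ℚ
  powS-pow p (suc n) m = trans (⊗-· p (powS p n) m) (S.·-cong {p} (λ _ → refl) (powS-pow p n) m)

  module HR = CommutativeRing H.ringOfSequences
  module Hν = Naturals H.ringOfSequences

  powF-pow : ∀ F n → powF F n H.≋ Hν.pow F n
  powF-pow F zero zero m = constS-const 1ℚ m
  powF-pow F zero (suc n) m = refl
  powF-pow F (suc j) n m = trans (⋆-∗ F (powF F j) n m) (H.∗-cong {F} (λ _ _ → refl) (powF-pow F j) n m)

  ν-ℚ : ∀ n → Qν.ν n ≡ ℕ→ℚ n
  ν-ℚ zero = refl
  ν-ℚ (suc n) = trans (cong (_+_ 1ℚ) (ν-ℚ n)) (sym (ℕ→ℚ-+ 1 n))

  ν-S : ∀ n → Sν.ν n ≋ S.const (ℕ→ℚ n)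
  ν-S zero zero = refl
  ν-S zero (suc m) = refl
  ν-S (suc n) zero = trans (cong (_+_ 1ℚ) (ν-S n zero)) (sym (ℕ→ℚ-+ 1 n))
  ν-S (suc n) (suc m) = trans (+-identityˡ _) (ν-S n (suc m))

  ν-scale : ∀ n p m → (Sν.ν n · p) m ≡ ℕ→ℚ n * p m
  ν-scale n p m = trans (S.·-cong {q = p} (ν-S n) (λ _ → refl) m) (S.const-· (ℕ→ℚ n) p m)

  ν-H : ∀ n → Hν.ν n H.≋ H.const (Sν.ν n)
  ν-H zero zero m = refl
  ν-H zero (suc i) m = refl
  ν-H (suc n) zero m = cong (_+_ (S.const 1ℚ m)) (ν-H n zero m)
  ν-H (suc n) (suc i) m = trans (+-identityˡ _) (ν-H n (suc i) m)

  ν-∗ : ∀ k F n → (Hν.ν k ∗ F) n ≋ (Sν.ν k · F n)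
  ν-∗ k F n m = trans (H.∗-cong {G = F} (ν-H k) (λ _ _ → refl) n m) (H.const-∗ (Sν.ν k) F n m)

  module Flow (j : ℕ) where
    open CauchyDerivation +-*-commutativeRing using (θ; θ-derivation)
    module θL = DerivationLemmas SRing θ-derivation

    k : ℕ
    k = suc j

    K : ℚ
    K = ℕ→ℚ k

    -- `κ` is k as a series and `N₀` is 1 - x. `y` = k (x - 1) is the rate in e^(kz(x-1)), and the
    -- operator `y` θ is - k x (1 - x) d/dx. `a` = - k x is forced by the cancellation in `flow-D`.
    κ N₀ y a : Series
    κ = Sν.ν k
    N₀ = constS 1ℚ ⊖ X
    y = scale K (X ⊖ constS 1ℚ)
    a = scale (- K) X

    -- This encodes d/dz - k x z d/dz - k x (1 - x) d/dx.
    flow : Fam → Fam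
    flow = H.flow θ-derivation a y

    module FL = DerivationLemmas H.ringOfSequences (H.flow-derivation θ-derivation a y)

    κ-· : ∀ p → (κ · p) ≋ scale K p
    κ-· p = ν-scale k p

    -- That y is - k (1 - x) is stated as a vanishing sum, and likewise for `a` and `θ N₀` below, so
    -- that the ring identities can be solved over a semiring.
    y+κN : (y +ₛ (κ · N₀)) ≋ 0ₛ
    y+κN m = trans (cong (_+_ (y m)) (κ-· N₀ m)) (solve 3 (λ K x c → K :* (x :- c) :+ K :* (c :- x) := con 0ℚ) refl K (X m) (constS 1ℚ m))

    a+κX : (a +ₛ (κ · X)) ≋ 0ₛ
    a+κX m = trans (cong (_+_ (a m)) (κ-· X m)) (solve 2 (λ K x → (:- K) :* x :+ K :* x := con 0ℚ) refl K (X m))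

    N+X : (N₀ +ₛ X) ≋ S.const 1ℚ
    N+X m = trans (solve 2 (λ c x → (c :- x) :+ x := c) refl (constS 1ℚ m) (X m)) (constS-const 1ℚ m)

    θy : θ y ≋ (κ · X)
    θy m = trans (go m) (sym (κ-· X m))
      where
      go : ∀ m → θ y m ≡ K * X m
      go zero = trans (*-zeroˡ (y 0)) (sym (*-zeroʳ K))
      go (suc zero) = solve 1 (λ K → (con 1ℚ :+ con 0ℚ) :* (K :* (con 1ℚ :- con 0ℚ)) := K :* con 1ℚ) refl K
      go (suc (suc m)) = solve 2 (λ K v → v :* (K :* (con 0ℚ :- con 0ℚ)) := K :* con 0ℚ) refl K (Qν.ν (suc (suc m)))

    θN : (θ N₀ +ₛ X) ≋ 0ₛ
    θN zero = refl
    θN (suc zero) = refl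
    θN (suc (suc m)) = solve 1 (λ v → v :* (con 0ℚ :- con 0ℚ) :+ con 0ℚ := con 0ℚ) refl (Qν.ν (suc (suc m)))

    module Sol = NatSolver SR.commutativeSemiring

    module _ where
      open SetoidReasoning SR.setoid

      -- The factors are the negatives of k (1 - x) and of x, and the signs cancel. Each negation is
      -- traded by adding or dropping one of the vanishing sums.
      yθN : (y · θ N₀) ≋ (κ · (X · N₀))
      yθN = begin
          y · t
        ≈⟨ SR.+-identityʳ (y · t) ⟨
          y · t +ₛ 0ₛ
        ≈⟨ SR.+-congˡ {y · t} (SR.trans (SR.*-congʳ {X} y+κN) (SR.zeroˡ X)) ⟨
          y · t +ₛ (y +ₛ κ · N₀) · X
        ≈⟨ Sol.solve 5 (λ y t κ n x → y Sol.:* t Sol.:+ (y Sol.:+ κ Sol.:* n) Sol.:* x Sol.:= y Sol.:* (t Sol.:+ x) Sol.:+ κ Sol.:* (x Sol.:* n)) SR.refl y t κ N₀ X ⟩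
          y · (t +ₛ X) +ₛ κ · (X · N₀)
        ≈⟨ SR.+-congʳ {κ · (X · N₀)} (SR.trans (SR.*-congˡ {y} θN) (SR.zeroʳ y)) ⟩
          0ₛ +ₛ κ · (X · N₀)
        ≈⟨ SR.+-identityˡ (κ · (X · N₀)) ⟩
          κ · (X · N₀) ∎
        where t = θ N₀

      D : Fam
      D = denomF k

      scale-·ʳ : ∀ c p q → (p · scale c q) ≋ scale c (p · q)
      scale-·ʳ c p q m = trans (S.·-comm p (scale c q) m) (trans (S.·-scale c q p m) (cong (c *_) (S.·-comm q p m)))

      -- Positive indices only: the summand - x of the denominator makes its constant term 1 - x
      -- instead of 1. This is why `flow-D` treats index 0 separately.
      D-suc : ∀ n → D (suc n) ≋ Sν.pow y (suc n)
      D-suc n m = trans (cong (ℕ→ℚ (k ℕ.^ suc n) *_) (powS-pow (X ⊖ constS 1ℚ) (suc n) m)) (sym (go (suc n) m))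
        where
        p = X ⊖ constS 1ℚ
        go : ∀ n → Sν.pow y n ≋ scale (ℕ→ℚ (k ℕ.^ n)) (Sν.pow p n)
        go zero m = sym (*-identityˡ (S.const 1ℚ m))
        go (suc n) m = trans (S.·-scale K p (Sν.pow y n) m) (trans (cong (K *_) (trans (S.·-cong {p} (λ _ → refl) (go n) m) (scale-·ʳ (ℕ→ℚ (k ℕ.^ n)) p (Sν.pow p n) m)))
          (trans (sym (*-assoc K (ℕ→ℚ (k ℕ.^ n)) _)) (cong (_* (p · Sν.pow p n) m) (sym (ℕ→ℚ-* k (k ℕ.^ n))))))

      N : Fam
      N = H.const N₀

      X₁ : Fam
      X₁ = H.const X

      κ-const : ∀ c F n → (Hν.ν k ∗ (H.const c ∗ F)) n ≋ (κ · (c · F n))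
      κ-const c F n m = trans (ν-∗ k (H.const c ∗ F) n m) (S.·-cong {κ} (λ _ → refl) (H.const-∗ c F n) m)

      -- 1 - x is constant in z, so only the summand y θ of the flow acts on it, and `yθN` evaluates
      -- that.
      flow-N : flow N H.≋ (Hν.ν k ∗ (X₁ ∗ N))
      flow-N zero = begin
          0ₛ +ₛ (a · (0ₛ · N₀) +ₛ y · θ N₀)
        ≈⟨ SR.+-identityˡ (a · (0ₛ · N₀) +ₛ y · θ N₀) ⟩
          a · (0ₛ · N₀) +ₛ y · θ N₀
        ≈⟨ SR.+-cong {a · (0ₛ · N₀)} {0ₛ} (SR.trans (SR.*-congˡ {a} (SR.zeroˡ N₀)) (SR.zeroʳ a)) yθN ⟩
          0ₛ +ₛ κ · (X · N₀)
        ≈⟨ SR.+-identityˡ (κ · (X · N₀)) ⟩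
          κ · (X · N₀)
        ≈⟨ κ-const X N 0 ⟨
          (Hν.ν k ∗ (X₁ ∗ N)) 0 ∎
      flow-N (suc n) = begin
          0ₛ +ₛ (a · (Sν.ν (suc n) · 0ₛ) +ₛ y · θ 0ₛ)
        ≈⟨ SR.+-identityˡ (a · (Sν.ν (suc n) · 0ₛ) +ₛ y · θ 0ₛ) ⟩
          a · (Sν.ν (suc n) · 0ₛ) +ₛ y · θ 0ₛ
        ≈⟨ SR.+-cong {a · (Sν.ν (suc n) · 0ₛ)} {0ₛ} {y · θ 0ₛ} {0ₛ}
             (SR.trans (SR.*-congˡ {a} (SR.zeroʳ (Sν.ν (suc n)))) (SR.zeroʳ a)) (SR.trans (SR.*-congˡ {y} θL.d-0) (SR.zeroʳ y)) ⟩
          0ₛ +ₛ 0ₛ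
        ≈⟨ SR.+-identityˡ 0ₛ ⟩
          0ₛ
        ≈⟨ SR.trans (SR.*-congˡ {κ} (SR.zeroʳ X)) (SR.zeroʳ κ) ⟨
          κ · (X · 0ₛ)
        ≈⟨ κ-const X N (suc n) ⟨
          (Hν.ν k ∗ (X₁ ∗ N)) (suc n) ∎

      -- With D = e^(yz) - x: since θ y = k x, the summands a z d/dz and y θ turn e^(yz) into (a + k
      -- x) z y e^(yz) = 0, and d/dz gives y e^(yz). Together with y θ(- x) = - y x this is y D, and
      -- y = - k (1 - x).
      flow-D : (flow D H.+ₛ (Hν.ν k ∗ (N ∗ D))) H.≋ H.0ₛ
      flow-D zero = begin
          (D 1 +ₛ (a · (0ₛ · N₀) +ₛ y · θ N₀)) +ₛ (Hν.ν k ∗ (N ∗ D)) 0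
        ≈⟨ SR.+-cong {D 1 +ₛ (a · (0ₛ · N₀) +ₛ y · θ N₀)}
             (SR.+-cong {D 1} (SR.trans (D-suc 0) (SR.*-identityʳ y)) (SR.trans (SR.+-cong {a · (0ₛ · N₀)} {0ₛ} (SR.trans (SR.*-congˡ {a} (SR.zeroˡ N₀)) (SR.zeroʳ a)) yθN) (SR.+-identityˡ (κ · (X · N₀)))))
             (κ-const N₀ D 0) ⟩
          (y +ₛ κ · (X · N₀)) +ₛ κ · (N₀ · N₀)
        ≈⟨ Sol.solve 4 (λ y κ x n → (y Sol.:+ κ Sol.:* (x Sol.:* n)) Sol.:+ κ Sol.:* (n Sol.:* n) Sol.:= y Sol.:+ (κ Sol.:* n) Sol.:* (n Sol.:+ x)) SR.refl y κ X N₀ ⟩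
          y +ₛ (κ · N₀) · (N₀ +ₛ X)
        ≈⟨ SR.+-congˡ {y} (SR.trans (SR.*-congˡ {κ · N₀} N+X) (SR.*-identityʳ (κ · N₀))) ⟩
          y +ₛ κ · N₀
        ≈⟨ y+κN ⟩
          0ₛ ∎
      flow-D (suc n) = begin
          (D (2 ℕ.+ n) +ₛ (a · (v · D (suc n)) +ₛ y · θ (D (suc n)))) +ₛ (Hν.ν k ∗ (N ∗ D)) (suc n)
        ≈⟨ SR.+-cong {D (2 ℕ.+ n) +ₛ (a · (v · D (suc n)) +ₛ y · θ (D (suc n)))}
             (SR.+-cong {D (2 ℕ.+ n)} (D-suc (suc n)) (SR.+-cong {a · (v · D (suc n))} (SR.*-congˡ {a} (SR.*-congˡ {v} (D-suc n)))
               -- The coefficient `y` of θ in the flow is exactly the extra factor that `power-rule`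
               -- asks for.
               (SR.trans (SR.*-congˡ {y} (Derivation.d-cong θ-derivation (D-suc n))) (SR.trans (θL.power-rule y (suc n)) (SR.*-congˡ {v} (SR.*-congˡ {P} θy))))))
             (SR.trans (κ-const N₀ D (suc n)) (SR.*-congˡ {κ} (SR.*-congˡ {N₀} (D-suc n)))) ⟩
          (y · P +ₛ (a · (v · P) +ₛ v · (P · (κ · X)))) +ₛ κ · (N₀ · P)
        ≈⟨ Sol.solve 7 (λ y P a v κ x n → (y Sol.:* P Sol.:+ (a Sol.:* (v Sol.:* P) Sol.:+ v Sol.:* (P Sol.:* (κ Sol.:* x)))) Sol.:+ κ Sol.:* (n Sol.:* P)
               Sol.:= (y Sol.:+ κ Sol.:* n) Sol.:* P Sol.:+ (a Sol.:+ κ Sol.:* x) Sol.:* (v Sol.:* P)) SR.refl y P a v κ X N₀ ⟩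
          (y +ₛ κ · N₀) · P +ₛ (a +ₛ κ · X) · (v · P)
        ≈⟨ SR.+-cong {(y +ₛ κ · N₀) · P} {0ₛ} {(a +ₛ κ · X) · (v · P)} {0ₛ} (SR.trans (SR.*-congʳ {P} y+κN) (SR.zeroˡ P)) (SR.trans (SR.*-congʳ {v · P} a+κX) (SR.zeroˡ (v · P))) ⟩
          0ₛ +ₛ 0ₛ
        ≈⟨ SR.+-identityˡ 0ₛ ⟩
          0ₛ ∎
        where
        v = Sν.ν (suc n)
        P = Sν.pow y (suc n)

      N+X₁ : (N H.+ₛ X₁) H.≋ H.const (S.const 1ℚ)
      N+X₁ zero = N+X
      N+X₁ (suc n) m = refl

    geom-N : (geom · N₀) ≋ S.const 1ℚ
    geom-N zero = refl
    geom-N (suc m) = trans (cong (_+_ (1ℚ * N₀ (suc m))) (geom-N m)) (edge m)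
      where
      edge : ∀ m → 1ℚ * N₀ (suc m) + S.const 1ℚ m ≡ 0ℚ
      edge zero = refl
      edge (suc m) = refl

    module Solution (A : Fam) (isA : IsOneOverKEulerian k A) where
      root : (Hν.pow A k ∗ D) H.≋ N
      root n m = trans (sym (trans (⋆-∗ (powF A k) D n m) (H.∗-cong {G = D} (powF-pow A k) (λ _ _ → refl) n m))) (trans (proj₂ isA n m) (numer n m))
        where
        numer : numerF H.≋ N
        numer zero m = refl
        numer (suc n) m = refl

      -- `root-equation` gives this up to the factors k and 1 - x. The first is cancelled in the
      -- rationals, the second by multiplication with the geometric series.
      fixed : ∀ n → flow A n ≋ A n
      fixed n = SR.trans (SR.sym (undo (flow A n))) (SR.trans (SR.*-congˡ {geom} same) (undo (A n)))
        where
        open ≡-Reasoning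
        undo : ∀ p → (geom · (N₀ · p)) ≋ p
        undo p = SR.trans (SR.sym (SR.*-assoc geom N₀ p)) (SR.trans (SR.*-congʳ {p} geom-N) (SR.*-identityˡ p))
        same : (N₀ · flow A n) ≋ (N₀ · A n)
        same m = ℕ→ℚ-cancel j (begin
            K * (N₀ · flow A n) m
          ≡⟨ κ-· (N₀ · flow A n) m ⟨
            (κ · (N₀ · flow A n)) m
          ≡⟨ κ-const N₀ (flow A) n m ⟨
            (Hν.ν k ∗ (N ∗ flow A)) n m
          ≡⟨ FL.root-equation k A D N X₁ root flow-D flow-N N+X₁ n m ⟩
            (Hν.ν k ∗ (N ∗ A)) n m
          ≡⟨ κ-const N₀ A n m ⟩
            (κ · (N₀ · A n)) m
          ≡⟨ κ-· (N₀ · A n) m ⟩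
            K * (N₀ · A n) m ∎)

      A-zero : ∀ n → A (suc n) 0 ≡ A n 0
      A-zero n = trans (solve 5 (λ u K w y r → u := u :+ ((:- K) :* con 0ℚ :* w :+ y :* (con 0ℚ :* r))) refl (A (suc n) 0) K ((Sν.ν n · A n) 0) (y 0) (A n 0)) (fixed n 0)

      -- The coefficient of x^(m+1) in `fixed`. The negative term is moved to the left, so that the
      -- same recurrence makes sense for natural numbers.
      A-suc : ∀ n m → A (suc n) (suc m) + (K * ℕ→ℚ m) * A n m ≡ (1ℚ + K * ℕ→ℚ (suc m)) * A n (suc m) + (K * ℕ→ℚ n) * A n m
      A-suc n m = trans (cong (_+ (K * ℕ→ℚ m) * A n m) lead)
        (trans (solve 5 (λ K m n u v → ((v :+ (K :* n) :* u) :+ (K :* (con 1ℚ :+ m)) :* v :- (K :* m) :* u) :+ (K :* m) :* u := (con 1ℚ :+ K :* (con 1ℚ :+ m)) :* v :+ (K :* n) :* u)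
          refl K (ℕ→ℚ m) (ℕ→ℚ n) (A n m) (A n (suc m))) (cong (λ z → (1ℚ + K * z) * A n (suc m) + (K * ℕ→ℚ n) * A n m) (sym (ℕ→ℚ-+ 1 m))))
        where
        q r : Series
        q = Sν.ν n · A n
        r = θ (A n)
        aq : (a · q) (suc m) ≡ - K * (ℕ→ℚ n * A n m)
        aq = trans (cong₂ _+_ (solve 2 (λ K w → (:- K) :* con 0ℚ :* w := con 0ℚ) refl K (q (suc m)))
               (trans (S.·-cong {q = q} tail-a (λ _ → refl) m) (trans (S.const-· (- K) q m) (cong (- K *_) (ν-scale n (A n) m))))) (+-identityˡ _)
          where
          tail-a : tail a ≋ S.const (- K)
          tail-a zero = *-identityʳ (- K)
          tail-a (suc m) = *-zeroʳ (- K)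
        yr : (y · r) (suc m) ≡ - K * (ℕ→ℚ (suc m) * A n (suc m)) + K * (ℕ→ℚ m * A n m)
        yr = cong₂ _+_ (trans (solve 2 (λ K w → K :* (con 0ℚ :- con 1ℚ) :* w := (:- K) :* w) refl K (r (suc m))) (cong (λ z → - K * (z * A n (suc m))) (ν-ℚ (suc m))))
               (trans (S.·-cong {q = r} tail-y (λ _ → refl) m) (trans (S.const-· K r m) (cong (λ z → K * (z * A n m)) (ν-ℚ m))))
          where
          tail-y : tail y ≋ S.const K
          tail-y zero = *-identityʳ K
          tail-y (suc m) = *-zeroʳ K
        lead : A (suc n) (suc m) ≡ (A n (suc m) + (K * ℕ→ℚ n) * A n m) + (K * (1ℚ + ℕ→ℚ m)) * A n (suc m) - (K * ℕ→ℚ m) * A n m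
        lead = trans (solve 5 (λ K n u w z → w := (w :+ ((:- K) :* (n :* u) :+ z)) :+ ((K :* n) :* u :- z)) refl K (ℕ→ℚ n) (A n m) (A (suc n) (suc m)) Z)
          (trans (cong (_+ ((K * ℕ→ℚ n) * A n m - Z)) (trans (cong (_+_ (A (suc n) (suc m))) (sym (cong₂ _+_ aq (trans yr (cong (λ z → - K * (z * A n (suc m)) + K * (ℕ→ℚ m * A n m)) (ℕ→ℚ-+ 1 m)))))) (fixed n (suc m))))
            (solve 5 (λ K m n u v → v :+ ((K :* n) :* u :- ((:- K) :* ((con 1ℚ :+ m) :* v) :+ K :* (m :* u))) := (v :+ (K :* n) :* u) :+ (K :* (con 1ℚ :+ m)) :* v :- (K :* m) :* u)
              refl K (ℕ→ℚ m) (ℕ→ℚ n) (A n m) (A n (suc m))))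
          where
          Z : ℚ
          Z = - K * ((1ℚ + ℕ→ℚ m) * A n (suc m)) + K * (ℕ→ℚ m * A n m)

module Combinatorics where
  open import Defs
  open import Data.Nat using (ℕ; zero; suc; _+_; _*_; _∸_; _≤_; _<_; _≤ᵇ_; z≤n; s≤s; _≡ᵇ_)
  open import Data.Nat.Properties
  open import Data.Nat.Tactic.RingSolver using (solve-∀)
  open import Data.Bool as Bool using (Bool; true; false; _∧_; not; if_then_else_; _∨_)
  open import Data.List using (List; []; _∷_; map; _++_; concatMap; replicate; length; filter; take; concat; foldr; null; applyUpTo; last; lookup)
  open import Data.List.Relation.Unary.All as All using (All; []; _∷_)
  open import Data.Product using (_×_; _,_; proj₁; proj₂; Σ)
  open import Relation.Nullary using (Dec; yes; no; does; ¬_; recompute)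
  open import Relation.Binary.PropositionalEquality
  open import Data.Bool.Properties using (∧-zeroʳ; ∧-identityʳ; ∧-assoc; ∧-comm; T-≡; ∨-zeroʳ; ∨-identityʳ)
  open import Data.Bool.ListAction using (all; any)
  open import Data.List.Properties using (length-replicate; length-map; map-++; ∷-injectiveˡ; ∷-injectiveʳ; ++-identityʳ; ++-assoc; length-++; length-applyUpTo)
  import Data.List.Relation.Unary.All.Properties as All
  open import Data.Maybe using (Maybe; just; nothing)
  open import Data.Unit using (⊤; tt)
  open import Data.Empty using (⊥-elim; ⊥)
  open import Function using (_∘_; Equivalence; mk↔ₛ′)
  open import Data.List.Membership.Propositional using (_∈_)
  open import Data.List.Relation.Unary.Any as Any using (here; there; Any)
  open import Data.List.Relation.Unary.Linked as Linked using (Linked; []; [-]; _∷_)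
  open import Data.List.Membership.Propositional.Properties using (∈-map⁺; ∈-map⁻; ∈-++⁺ˡ; ∈-++⁺ʳ; ∈-++⁻; ∈-concatMap⁺; ∈-lookup)
  open import Data.List.Relation.Binary.Permutation.Propositional using (_↭_; ↭-refl; ↭-sym; ↭-trans; prep; ↭-reflexive; ↭⇒↭ₛ)
  open import Data.List.Relation.Binary.Permutation.Propositional.Properties using (shift; ++⁺ˡ; ++⁺ʳ; ↭-length; drop-∷; All-resp-↭; ∈-resp-↭)
  open import Data.List.Relation.Unary.Unique.Propositional using (Unique; []; _∷_)
  import Data.List.Relation.Unary.Unique.Propositional.Properties as Unique
  open import Data.Sum using (_⊎_; inj₁; inj₂)
  open import Data.Fin using (Fin; zero; suc)
  open import Data.List.Relation.Unary.Any.Properties using (lookup-index)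
  open import Data.List.Relation.Binary.Sublist.Propositional using (_⊆_; []; _∷_; _∷ʳ_; ⊆-refl)
  import Data.List.Relation.Binary.Sublist.Propositional.Properties as Sublist
  import Data.List.Relation.Binary.Permutation.Setoid.Properties as PermS
  open import Data.Irrelevant using (Irrelevant; [_])
  open import Relation.Binary.Definitions using (DecidableEquality)
  open import Data.Nat.DivMod using (_/_; /-monoˡ-≤; m*n/n≡m)

  open ≡-Reasoning

  private variable
    A B : Set

  -- Finite sums and binomial sums of natural numbers.

  Σl : List A → (A → ℕ) → ℕ
  Σl [] f = 0
  Σl (x ∷ xs) f = f x + Σl xs f

  b2n : Bool → ℕ
  b2n true = 1
  b2n false = 0

  Σl-++ : ∀ (xs ys : List A) f → Σl (xs ++ ys) f ≡ Σl xs f + Σl ys f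
  Σl-++ [] ys f = refl
  Σl-++ (x ∷ xs) ys f = trans (cong (f x +_) (Σl-++ xs ys f)) (sym (+-assoc (f x) _ _))

  Σl-map : ∀ (h : A → B) xs f → Σl (map h xs) f ≡ Σl xs (λ x → f (h x))
  Σl-map h [] f = refl
  Σl-map h (x ∷ xs) f = cong (f (h x) +_) (Σl-map h xs f)

  Σl-concatMap : ∀ (h : A → List B) xs f → Σl (concatMap h xs) f ≡ Σl xs (λ x → Σl (h x) f)
  Σl-concatMap h [] f = refl
  Σl-concatMap h (x ∷ xs) f = trans (Σl-++ (h x) _ f) (cong (Σl (h x) f +_) (Σl-concatMap h xs f))

  Σl-replicate : ∀ m (x : A) f → Σl (replicate m x) f ≡ m * f x
  Σl-replicate zero x f = refl
  Σl-replicate (suc m) x f = cong (f x +_) (Σl-replicate m x f)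

  Σl-congAll : ∀ {xs : List A} {f g} → All (λ x → f x ≡ g x) xs → Σl xs f ≡ Σl xs g
  Σl-congAll [] = refl
  Σl-congAll (e ∷ es) = cong₂ _+_ e (Σl-congAll es)

  Σl-cong : ∀ (xs : List A) {f g} → (∀ x → f x ≡ g x) → Σl xs f ≡ Σl xs g
  Σl-cong [] h = refl
  Σl-cong (x ∷ xs) h = cong₂ _+_ (h x) (Σl-cong xs h)

  +-interchange : ∀ a b c d → (a + b) + (c + d) ≡ (a + c) + (b + d)
  +-interchange = solve-∀

  Σl-+ : ∀ (xs : List A) f g → Σl xs (λ x → f x + g x) ≡ Σl xs f + Σl xs g
  Σl-+ [] f g = refl
  Σl-+ (x ∷ xs) f g = trans (cong (f x + g x +_) (Σl-+ xs f g)) (+-interchange (f x) (g x) _ _)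

  Σl-* : ∀ (xs : List A) c f → Σl xs (λ x → c * f x) ≡ c * Σl xs f
  Σl-* [] c f = sym (*-zeroʳ c)
  Σl-* (x ∷ xs) c f = trans (cong (c * f x +_) (Σl-* xs c f)) (sym (*-distribˡ-+ c (f x) _))

  Σl-constAll : ∀ {xs : List A} {f c} → All (λ x → f x ≡ c) xs → Σl xs f ≡ length xs * c
  Σl-constAll [] = refl
  Σl-constAll (e ∷ es) = cong₂ _+_ e (Σl-constAll es)

  length-filter : ∀ {P : A → Set} (P? : ∀ x → Dec (P x)) xs → length (filter P? xs) ≡ Σl xs (λ x → b2n (does (P? x)))
  length-filter P? [] = refl
  length-filter P? (x ∷ xs) with does (P? x)
  ... | true = cong suc (length-filter P? xs)
  ... | false = length-filter P? xs

  -- Bin M g is the sum of C(M,a) g(a,b) over a + b = M.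
  Bin : ℕ → (ℕ → ℕ → ℕ) → ℕ
  Bin zero g = g 0 0
  Bin (suc M) g = Bin M (λ a b → g (suc a) b + g a (suc b))

  Bin-cong : ∀ M {g h} → (∀ a b → a + b ≡ M → g a b ≡ h a b) → Bin M g ≡ Bin M h
  Bin-cong zero e = e 0 0 refl
  Bin-cong (suc M) e = Bin-cong M (λ a b q → cong₂ _+_ (e (suc a) b (cong suc q)) (e a (suc b) (trans (+-suc a b) (cong suc q))))

  Bin-+ : ∀ M g h → Bin M (λ a b → g a b + h a b) ≡ Bin M g + Bin M h
  Bin-+ zero g h = refl
  Bin-+ (suc M) g h = trans (Bin-cong M (λ a b _ → +-interchange (g (suc a) b) (h (suc a) b) (g a (suc b)) (h a (suc b))))
    (Bin-+ M (λ a b → g (suc a) b + g a (suc b)) (λ a b → h (suc a) b + h a (suc b)))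

  Bin-* : ∀ M c g → Bin M (λ a b → c * g a b) ≡ c * Bin M g
  Bin-* zero c g = refl
  Bin-* (suc M) c g = trans (Bin-cong M (λ a b _ → sym (*-distribˡ-+ c (g (suc a) b) (g a (suc b)))))
    (Bin-* M c (λ a b → g (suc a) b + g a (suc b)))

  -- By absorption, a C(M , a) = M C(M - 1 , a - 1) and b C(M , a) = M C(M - 1 , a), so both halves
  -- become the same sum; hence the 2. For M = 0 both sides vanish and the truncated `M ∸ 1` is
  -- harmless.
  Bin-derivative : ∀ M (h : ℕ → ℕ) →
    Bin M (λ a b → a * h a + b * h (suc a)) ≡ 2 * M * Bin (M ∸ 1) (λ a _ → h (suc a))
  Bin-derivative zero h = refl
  Bin-derivative (suc M) h = begin
      Bin M (λ a b → (suc a * h⁺ a + b * h⁺ (suc a)) + (a * h a + suc b * h⁺ a))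
    ≡⟨ Bin-cong M (λ a b _ → rearrange a b (h a) (h⁺ a) (h⁺ (suc a))) ⟩
      Bin M (λ a b → (D h a b + D h⁺ a b) + 2 * h⁺ a)
    ≡⟨ Bin-+ M (λ a b → D h a b + D h⁺ a b) (λ a _ → 2 * h⁺ a) ⟩
      Bin M (λ a b → D h a b + D h⁺ a b) + Bin M (λ a _ → 2 * h⁺ a)
    ≡⟨ cong₂ _+_ (Bin-+ M (D h) (D h⁺)) (Bin-* M 2 (λ a _ → h⁺ a)) ⟩
      (Bin M (D h) + Bin M (D h⁺)) + 2 * Bin M (λ a _ → h⁺ a)
    ≡⟨ cong (_+ 2 * Bin M (λ a _ → h⁺ a)) (cong₂ _+_ (Bin-derivative M h) (Bin-derivative M h⁺)) ⟩
      (2 * M * Bin (M ∸ 1) (λ a _ → h⁺ a) + 2 * M * Bin (M ∸ 1) (λ a _ → h⁺ (suc a))) + 2 * Bin M (λ a _ → h⁺ a)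
    ≡⟨ cong (_+ 2 * Bin M (λ a _ → h⁺ a)) (merge M) ⟩
      2 * M * Bin M (λ a _ → h⁺ a) + 2 * Bin M (λ a _ → h⁺ a)
    ≡⟨ collect M (Bin M (λ a _ → h⁺ a)) ⟩
      2 * suc M * Bin M (λ a _ → h⁺ a) ∎
    where
    h⁺ : ℕ → ℕ
    h⁺ a = h (suc a)
    D : (ℕ → ℕ) → ℕ → ℕ → ℕ
    D h a b = a * h a + b * h (suc a)
    rearrange : ∀ a b x y z → (suc a * y + b * z) + (a * x + suc b * y) ≡ ((a * x + b * y) + (a * y + b * z)) + 2 * y
    rearrange = solve-∀
    collect : ∀ M x → 2 * M * x + 2 * x ≡ 2 * suc M * x
    collect = solve-∀
    swap : ∀ c x y → c * x + c * y ≡ c * (y + x)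
    swap = solve-∀
    merge : ∀ M → 2 * M * Bin (M ∸ 1) (λ a _ → h⁺ a) + 2 * M * Bin (M ∸ 1) (λ a _ → h⁺ (suc a)) ≡ 2 * M * Bin M (λ a _ → h⁺ a)
    merge zero = refl
    merge (suc M) = trans (swap (2 * suc M) (Bin M (λ a _ → h⁺ a)) (Bin M (λ a _ → h⁺ (suc a))))
      (cong (2 * suc M *_) (sym (Bin-+ M (λ a _ → h⁺ (suc a)) (λ a _ → h⁺ a))))

  -- Insertion of the largest label, and its effect below a node.

  leaf : ℕ → ETree
  leaf N = enode N []

  -- A label larger than all others can only stand at the right end of its siblings, so each
  -- odd-level child offers just one position.
  appendAt : ℕ → List OTree → List (List OTree)
  appendAt N [] = []
  appendAt N (onode es ∷ os) = (onode (es ++ leaf N ∷ []) ∷ os) ∷ map (onode es ∷_) (appendAt N os)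

  -- Undoes the pruning: a leaf on an even level gets back its `k` childless children before
  -- something is inserted below it.
  slots : ℕ → List OTree → List OTree
  slots k [] = replicate k (onode [])
  slots k (c ∷ cs) = c ∷ cs

  module _ (k N : ℕ) where
    insE  : ETree → List ETree
    insOs : List OTree → List (List OTree)
    insEs : List ETree → List (List ETree)
    insE (enode l cs) = map (enode l) (appendAt N (slots k cs)) ++ map (enode l) (insOs cs)
    insOs [] = []
    insOs (onode es ∷ os) = map (λ es' → onode es' ∷ os) (insEs es) ++ map (onode es ∷_) (insOs os)
    insEs [] = []
    insEs (e ∷ es) = map (_∷ es) (insE e) ++ map (e ∷_) (insEs es)

    insF : Forest → List Forest
    insF F = (F ++ leaf N ∷ []) ∷ insEs F

  gcs : List OTree → List ETree
  gcs = foldr (λ o gs → okids o ++ gs) []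

  tot : (ETree → ℕ) → List OTree → ℕ
  tot g [] = 0
  tot g (onode es ∷ os) = Σl es g + tot g os

  tot-gcs : ∀ g cs → tot g cs ≡ Σl (gcs cs) g
  tot-gcs g [] = refl
  tot-gcs g (onode es ∷ os) = trans (cong (Σl es g +_) (tot-gcs g os)) (sym (Σl-++ es (gcs os) g))

  tot-+ : ∀ f g cs → tot (λ e → f e + g e) cs ≡ tot f cs + tot g cs
  tot-+ f g cs = trans (tot-gcs _ cs) (trans (Σl-+ (gcs cs) f g) (sym (cong₂ _+_ (tot-gcs f cs) (tot-gcs g cs))))

  tot-cong : ∀ {f g} cs → (∀ e → f e ≡ g e) → tot f cs ≡ tot g cs
  tot-cong [] h = refl
  tot-cong (onode es ∷ os) h = cong₂ _+_ (Σl-cong es h) (tot-cong os h)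

  sumEs-Σl : ∀ f es → sumEs f es ≡ Σl es (sumE f)
  sumEs-Σl f [] = refl
  sumEs-Σl f (e ∷ es) = cong (sumE f e +_) (sumEs-Σl f es)

  sumOs-tot : ∀ f cs → sumOs f cs ≡ tot (sumE f) cs
  sumOs-tot f [] = refl
  sumOs-tot f (onode es ∷ os) = cong₂ _+_ (sumEs-Σl f es) (sumOs-tot f os)

  -- The labels of the grand children, grouped by parent. Which label is the greatest and which
  -- children are leaves can be read off it, and insertions further down leave it unchanged
  -- (`insOs-skel`).
  Skeleton : Set
  Skeleton = List (List ℕ)

  skel : List OTree → Skeleton
  skel = map (λ o → map label (okids o))

  isMax : Skeleton → ℕ → Bool
  isMax sk m = all (_≤ᵇ m) (concat sk)

  leafCount : (ℕ → Bool) → List ETree → ℕ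
  leafCount p gs = Σl gs (λ g → b2n (isLeaf g ∧ p (label g)))

  -- `restN` marks an internal node that owns no old leaf. As `oldN` is at most 1 on the trees in
  -- question, leaves, owners of an old leaf and these nodes exhaust all nodes.
  oldN youngN restN leafN : ETree → ℕ
  oldN (enode l cs) = leafCount (isMax (skel cs)) (gcs cs)
  youngN (enode l cs) = leafCount (not ∘ isMax (skel cs)) (gcs cs)
  restN (enode l []) = 0
  restN (enode l (c ∷ cs)) = 1 ∸ oldN (enode l (c ∷ cs))
  leafN v = if isLeaf v then 1 else 0

  -- A subtree seen from its grand parent: p tells which labels count as old there.
  OV YV : (ℕ → Bool) → ETree → ℕ
  OV p e = b2n (isLeaf e ∧ p (label e)) + sumE oldN e
  YV p e = b2n (isLeaf e ∧ not (p (label e))) + sumE youngN e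
  -- `BV` counts the old leaves whose grand parent lies in the subtree, and thereby the owners of
  -- old leaves; `CV` counts the other internal nodes and `LV` the leaves, the root of the subtree
  -- included.
  BV CV LV : ETree → ℕ
  BV = sumE oldN
  CV = sumE restN
  LV = sumE leafN

  tot-OV : ∀ p cs → tot (OV p) cs ≡ leafCount p (gcs cs) + tot BV cs
  tot-OV p cs = trans (tot-+ (λ e → b2n (isLeaf e ∧ p (label e))) BV cs) (cong (_+ tot BV cs) (tot-gcs _ cs))

  tot-YV : ∀ p cs → tot (YV p) cs ≡ leafCount (not ∘ p) (gcs cs) + tot (sumE youngN) cs
  tot-YV p cs = trans (tot-+ (λ e → b2n (isLeaf e ∧ not (p (label e)))) (sumE youngN) cs) (cong (_+ tot (sumE youngN) cs) (tot-gcs _ cs))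

  OV-node : ∀ p l c cs → OV p (enode l (c ∷ cs)) ≡ tot (OV (isMax (skel (c ∷ cs)))) (c ∷ cs)
  OV-node p l c cs = trans (cong (leafCount (isMax (skel (c ∷ cs))) (gcs (c ∷ cs)) +_) (sumOs-tot oldN (c ∷ cs))) (sym (tot-OV (isMax (skel (c ∷ cs))) (c ∷ cs)))

  YV-node : ∀ p l c cs → YV p (enode l (c ∷ cs)) ≡ tot (YV (isMax (skel (c ∷ cs)))) (c ∷ cs)
  YV-node p l c cs = trans (cong (leafCount (not ∘ isMax (skel (c ∷ cs))) (gcs (c ∷ cs)) +_) (sumOs-tot youngN (c ∷ cs))) (sym (tot-YV (isMax (skel (c ∷ cs))) (c ∷ cs)))

  LV-node : ∀ l c cs → LV (enode l (c ∷ cs)) ≡ tot LV (c ∷ cs)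
  LV-node l c cs = sumOs-tot leafN (c ∷ cs)

  tot-slots : ∀ k g cs → tot g (slots k cs) ≡ tot g cs
  tot-slots k g (c ∷ cs) = refl
  tot-slots k g [] = go k
    where
    go : ∀ k → tot g (replicate k (onode [])) ≡ 0
    go zero = refl
    go (suc k) = go k

  gcs-slots : ∀ k cs → gcs (slots k cs) ≡ gcs cs
  gcs-slots k (c ∷ cs) = refl
  gcs-slots k [] = go k
    where
    go : ∀ k → gcs (replicate k (onode [])) ≡ []
    go zero = refl
    go (suc k) = go k

  length-appendAt : ∀ N cs → length (appendAt N cs) ≡ length cs
  length-appendAt N [] = refl
  length-appendAt N (onode es ∷ os) = cong suc (trans (length-map _ (appendAt N os)) (length-appendAt N os))

  tot-appendAt : ∀ N g cs → All (λ cs' → tot g cs' ≡ g (leaf N) + tot g cs) (appendAt N cs)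
  tot-appendAt N g [] = []
  tot-appendAt N g (onode es ∷ os) =
    trans (cong (_+ tot g os) (Σl-++ es (leaf N ∷ []) g)) (lem (Σl es g) (g (leaf N)) (tot g os))
    ∷ All.map⁺ (All.map (λ e → trans (cong (Σl es g +_) e) (lem₂ (Σl es g) (g (leaf N)) (tot g os))) (tot-appendAt N g os))
    where
    lem : ∀ a b c → (a + (b + 0)) + c ≡ b + (a + c)
    lem = solve-∀
    lem₂ : ∀ a b c → a + (b + c) ≡ b + (a + c)
    lem₂ = solve-∀

  all-++ : ∀ {A : Set} (q : A → Bool) xs ys → all q (xs ++ ys) ≡ all q xs ∧ all q ys
  all-++ q [] ys = refl
  all-++ q (x ∷ xs) ys = trans (cong (q x ∧_) (all-++ q xs ys)) (sym (∧-assoc (q x) _ _))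

  all-appendAt : ∀ N q cs → All (λ cs' → all q (concat (skel cs')) ≡ q N ∧ all q (concat (skel cs))) (appendAt N cs)
  all-appendAt N q [] = []
  all-appendAt N q (onode es ∷ os) =
    (begin
      all q (map label (es ++ leaf N ∷ []) ++ concat (skel os)) ≡⟨ all-++ q (map label (es ++ leaf N ∷ [])) _ ⟩
      all q (map label (es ++ leaf N ∷ [])) ∧ Q ≡⟨ cong (λ z → all q z ∧ Q) (map-++ label es (leaf N ∷ [])) ⟩
      all q (map label es ++ N ∷ []) ∧ Q ≡⟨ cong (_∧ Q) (all-++ q (map label es) (N ∷ [])) ⟩
      (P ∧ (q N ∧ true)) ∧ Q ≡⟨ cong (λ z → (P ∧ z) ∧ Q) (∧-identityʳ (q N)) ⟩
      (P ∧ q N) ∧ Q ≡⟨ cong (_∧ Q) (∧-comm P (q N)) ⟩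
      (q N ∧ P) ∧ Q ≡⟨ ∧-assoc (q N) P Q ⟩
      q N ∧ (P ∧ Q) ≡⟨ cong (q N ∧_) (sym (all-++ q (map label es) _)) ⟩
      q N ∧ all q (map label es ++ concat (skel os)) ∎)
    ∷ All.map⁺ (All.map (λ {cs'} e → begin
      all q (map label es ++ concat (skel cs')) ≡⟨ all-++ q (map label es) _ ⟩
      P ∧ all q (concat (skel cs')) ≡⟨ cong (P ∧_) e ⟩
      P ∧ (q N ∧ Q) ≡⟨ sym (∧-assoc P (q N) Q) ⟩
      (P ∧ q N) ∧ Q ≡⟨ cong (_∧ Q) (∧-comm P (q N)) ⟩
      (q N ∧ P) ∧ Q ≡⟨ ∧-assoc (q N) P Q ⟩
      q N ∧ (P ∧ Q) ≡⟨ cong (q N ∧_) (sym (all-++ q (map label es) _)) ⟩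
      q N ∧ all q (map label es ++ concat (skel os)) ∎) (all-appendAt N q os))
    where
    P = all q (map label es)
    Q = all q (concat (skel os))

  NonEmpty : ∀ {A : Set} → List A → Set
  NonEmpty xs = null xs ≡ false

  appendAt-nonEmpty : ∀ N cs → All NonEmpty (appendAt N cs)
  appendAt-nonEmpty N [] = []
  appendAt-nonEmpty N (onode es ∷ os) = refl ∷ All.map⁺ (All.universal (λ _ → refl) (appendAt N os))

  module _ (k N : ℕ) where
    insE-label : ∀ e → All (λ e' → label e' ≡ label e) (insE k N e)
    insE-label (enode l cs) = All.++⁺ (All.map⁺ (All.universal (λ _ → refl) (appendAt N (slots k cs)))) (All.map⁺ (All.universal (λ _ → refl) (insOs k N cs)))

    insEs-labels : ∀ es → All (λ es' → map label es' ≡ map label es) (insEs k N es)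
    insEs-labels [] = []
    insEs-labels (e ∷ es) = All.++⁺
      (All.map⁺ (All.map (cong (_∷ map label es)) (insE-label e)))
      (All.map⁺ (All.map (cong (label e ∷_)) (insEs-labels es)))

    insOs-skel : ∀ cs → All (λ cs' → skel cs' ≡ skel cs) (insOs k N cs)
    insOs-skel [] = []
    insOs-skel (onode es ∷ os) = All.++⁺
      (All.map⁺ (All.map (cong (_∷ skel os)) (insEs-labels es)))
      (All.map⁺ (All.map (cong (map label es ∷_)) (insOs-skel os)))

    -- What the counting of insertions requires: at most one old leaf per grand parent, exactly `k`
    -- slots below each node, and only smaller labels among the grand children. `goodE` derives it
    -- from well-formedness and distinct labels.
    GoodE : ETree → Set
    GoodOs : List OTree → Set
    GoodEs : List ETree → Set
    GoodE (enode l cs) = oldN (enode l cs) ≤ 1 × length (slots k cs) ≡ k × All (λ g → label g < N) (gcs cs) × GoodOs cs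
    GoodOs [] = ⊤
    GoodOs (onode es ∷ os) = GoodEs es × GoodOs os
    GoodEs [] = ⊤
    GoodEs (e ∷ es) = GoodE e × GoodEs es

  ≤ᵇ-true : ∀ {m n} → m ≤ n → (m ≤ᵇ n) ≡ true
  ≤ᵇ-true p = Equivalence.to T-≡ (≤⇒≤ᵇ p)

  ≤ᵇ-false : ∀ {m n} → n < m → (m ≤ᵇ n) ≡ false
  ≤ᵇ-false {m} {n} p with m ≤ᵇ n in eq
  ... | false = refl
  ... | true = ⊥-elim (<⇒≱ p (≤ᵇ⇒≤ m n (Equivalence.from T-≡ eq)))

  all-true : ∀ {A : Set} (q : A → Bool) {xs} → All (λ x → q x ≡ true) xs → all q xs ≡ true
  all-true q [] = refl
  all-true q (e ∷ es) = cong₂ _∧_ e (all-true q es)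

  skel-All : ∀ {P : ℕ → Set} cs → All (λ g → P (label g)) (gcs cs) → All P (concat (skel cs))
  skel-All [] _ = []
  skel-All (onode es ∷ os) ps = All.++⁺ (All.map⁺ (All.++⁻ˡ es ps)) (skel-All os (All.++⁻ʳ es ps))

  leafCount-zero : ∀ p {gs} → All (λ g → p (label g) ≡ false) gs → leafCount p gs ≡ 0
  leafCount-zero p [] = refl
  leafCount-zero p {g ∷ gs} (e ∷ es) = cong₂ _+_ (cong b2n (trans (cong (isLeaf g ∧_) e) (∧-zeroʳ _))) (leafCount-zero p es)

  -- A previously greatest grand child loses its rank to `N`. So a node owns exactly one old leaf
  -- after a direct insertion, whether it owned one before or not.
  isMax-appendAt : ∀ N cs → All (λ g → label g < N) (gcs cs) →
    All (λ cs' → isMax (skel cs') N ≡ true × (∀ {m} → m < N → isMax (skel cs') m ≡ false)) (appendAt N cs)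
  isMax-appendAt N cs lt = All.zipWith (λ z → z)
    ( All.map (λ e → trans e (cong₂ _∧_ (≤ᵇ-true (≤-refl {N})) (all-true (_≤ᵇ N) (All.map (λ q → ≤ᵇ-true (<⇒≤ q)) (skel-All {_< N} cs lt))))) (all-appendAt N (_≤ᵇ N) cs)
    , all-∀ )
    where
    all-∀ : All (λ cs' → ∀ {m} → m < N → isMax (skel cs') m ≡ false) (appendAt N cs)
    all-∀ = All.tabulate λ {cs'} i {m} lt → trans (All.lookup (all-appendAt N (_≤ᵇ m) cs) i) (cong (_∧ isMax (skel cs) m) (≤ᵇ-false lt))

  leafCount-appendAt : ∀ N p cs → All (λ cs' → leafCount p (gcs cs') ≡ b2n (p N) + leafCount p (gcs cs)) (appendAt N cs)
  leafCount-appendAt N p cs = All.map (λ {cs'} e → trans (sym (tot-gcs _ cs')) (trans e (cong (b2n (p N) +_) (tot-gcs _ cs))))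
    (tot-appendAt N (λ g → b2n (isLeaf g ∧ p (label g))) cs)

  leafCount-fresh : ∀ N p cs {cs'} → leafCount p (gcs cs') ≡ b2n (p N) + leafCount p (gcs cs) →
    All (λ g → label g < N) (gcs cs) → p N ≡ true → (∀ {m} → m < N → p m ≡ false) → leafCount p (gcs cs') ≡ 1
  leafCount-fresh N p cs e lt t f = trans e (cong₂ _+_ (cong b2n t) (leafCount-zero p (All.map f lt)))

  -- Inserting below a node moves the state (O , L) to (O , L), (O + 1 , L), (O , L + 1) or (O + 1 , L + 1) according
  -- to whether the node is an old leaf, a young leaf, the owner of an old leaf, or none of these; o, y, b and c
  -- are the numbers of nodes in these classes, and k is the number of slots below each node.
  Tk : ℕ → (ℕ → ℕ → ℕ) → (O L o y b c : ℕ) → ℕ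
  Tk k f O L o y b c = k * (o * f O L + (y * f (suc O) L + (b * f O (suc L) + c * f (suc O) (suc L))))

  Tk-linear : ∀ k f O L o y b c o' y' b' c' →
    Tk k f O L o y b c + Tk k f O L o' y' b' c' ≡ Tk k f O L (o + o') (y + y') (b + b') (c + c')
  Tk-linear k f O L = lem k (f O L) (f (suc O) L) (f O (suc L)) (f (suc O) (suc L))
    where
    lem : ∀ k p q r s o y b c o' y' b' c' → k * (o * p + (y * q + (b * r + c * s))) + k * (o' * p + (y' * q + (b' * r + c' * s)))
       ≡ k * ((o + o') * p + ((y + y') * q + ((b + b') * r + (c + c') * s)))
    lem = solve-∀

  -- An insertion happens in one of two disjoint parts, and the other part only shifts the arguments
  -- of `f` by its own state.
  Tk-join : ∀ k f O₁ O₂ L₁ L₂ y₁ b₁ c₁ y₂ b₂ c₂ {S₁ S₂} →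
    S₁ ≡ Tk k (λ a b → f (a + O₂) (b + L₂)) O₁ L₁ O₁ y₁ b₁ c₁ →
    S₂ ≡ Tk k (λ a b → f (a + O₁) (b + L₁)) O₂ L₂ O₂ y₂ b₂ c₂ →
    S₁ + S₂ ≡ Tk k f (O₁ + O₂) (L₁ + L₂) (O₁ + O₂) (y₁ + y₂) (b₁ + b₂) (c₁ + c₂)
  Tk-join k f O₁ O₂ L₁ L₂ y₁ b₁ c₁ y₂ b₂ c₂ refl refl = trans
    (cong₂ (λ x y → Tk k f (O₁ + O₂) (L₁ + L₂) O₁ y₁ b₁ c₁ + Tk k f x y O₂ y₂ b₂ c₂) (+-comm O₂ O₁) (+-comm L₂ L₁))
    (Tk-linear k f (O₁ + O₂) (L₁ + L₂) O₁ y₁ b₁ c₁ O₂ y₂ b₂ c₂)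

  Tk-zero : ∀ k f O L → Tk k f O L 0 0 0 0 ≡ 0
  Tk-zero k f O L = *-zeroʳ k

  -- `m` tells whether the node owns an old leaf beforehand. Afterwards it owns one in any case, so
  -- O is kept if m = 1 and raised if m = 0: the third and the fourth class of `Tk`.
  Tk-direct : ∀ k f m b L → m ≤ 1 → k * f (suc b) (suc L) ≡ Tk k f (m + b) L 0 0 m (1 ∸ m)
  Tk-direct k f zero b L _ = cong (k *_) (sym (+-identityʳ _))
  Tk-direct k f (suc zero) b L _ = cong (k *_) (sym (trans (+-identityʳ _) (+-identityʳ _)))
  Tk-direct k f (suc (suc m)) b L (s≤s ())

  -- The node itself joins the owners or the fourth class. In the result the number of owners equals
  -- the number `tot (OV p) cs` of counted old leaves; this equality of two class sizes is what
  -- later yields the factor 1 + x.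
  direct+deep : ∀ k (f : ℕ → ℕ → ℕ) cs (p : ℕ → Bool) → leafCount p (gcs cs) ≤ 1 →
    k * f (suc (tot BV cs)) (suc (tot LV cs)) + Tk k f (tot (OV p) cs) (tot LV cs) (tot (OV p) cs) (tot (YV p) cs) (tot BV cs) (tot CV cs)
      ≡ Tk k f (tot (OV p) cs) (tot LV cs) (tot (OV p) cs) (tot (YV p) cs) (tot (OV p) cs) ((1 ∸ leafCount p (gcs cs)) + tot CV cs)
  direct+deep k f cs p le = begin
      k * f (suc (tot BV cs)) (suc L) + Tk k f O L O (tot (YV p) cs) (tot BV cs) (tot CV cs)
    ≡⟨ cong (_+ Tk k f O L O (tot (YV p) cs) (tot BV cs) (tot CV cs)) (Tk-direct k f m (tot BV cs) L le) ⟩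
      Tk k f (m + tot BV cs) L 0 0 m (1 ∸ m) + Tk k f O L O (tot (YV p) cs) (tot BV cs) (tot CV cs)
    ≡⟨ cong (λ z → Tk k f z L 0 0 m (1 ∸ m) + Tk k f O L O (tot (YV p) cs) (tot BV cs) (tot CV cs)) (sym (tot-OV p cs)) ⟩
      Tk k f O L 0 0 m (1 ∸ m) + Tk k f O L O (tot (YV p) cs) (tot BV cs) (tot CV cs)
    ≡⟨ Tk-linear k f O L 0 0 m (1 ∸ m) O (tot (YV p) cs) (tot BV cs) (tot CV cs) ⟩
      Tk k f O L O (tot (YV p) cs) (m + tot BV cs) ((1 ∸ m) + tot CV cs)
    ≡⟨ cong (λ z → Tk k f O L O (tot (YV p) cs) z ((1 ∸ m) + tot CV cs)) (sym (tot-OV p cs)) ⟩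
      Tk k f O L O (tot (YV p) cs) O ((1 ∸ m) + tot CV cs) ∎
    where
    O = tot (OV p) cs
    L = tot LV cs
    m = leafCount p (gcs cs)

  module _ (k N : ℕ) where
    direct-sum : ∀ f cs l p → length (slots k cs) ≡ k → All (λ g → label g < N) (gcs cs) →
      Σl (appendAt N (slots k cs)) (λ cs' → f (OV p (enode l cs')) (LV (enode l cs'))) ≡ k * f (suc (tot BV cs)) (suc (tot LV cs))
    direct-sum f cs l p len lt = trans (Σl-constAll (All.tabulate each))
        (cong (_* f (suc (tot BV cs)) (suc (tot LV cs))) (trans (length-appendAt N (slots k cs)) len))
      where
      lt' : All (λ g → label g < N) (gcs (slots k cs))
      lt' = subst (All _) (sym (gcs-slots k cs)) lt
      each : ∀ {cs'} → cs' ∈ appendAt N (slots k cs) → f (OV p (enode l cs')) (LV (enode l cs')) ≡ f (suc (tot BV cs)) (suc (tot LV cs))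
      each {[]} i with All.lookup (appendAt-nonEmpty N (slots k cs)) i
      ... | ()
      each {c ∷ cs'} i = cong₂ f
        (trans (OV-node p l c cs') (trans (tot-OV (isMax (skel (c ∷ cs'))) (c ∷ cs')) (cong₂ _+_ one
           (trans (All.lookup (tot-appendAt N BV (slots k cs)) i) (tot-slots k BV cs)))))
        (trans (LV-node l c cs') (trans (All.lookup (tot-appendAt N LV (slots k cs)) i) (cong suc (tot-slots k LV cs))))
        where
        mx = All.lookup (isMax-appendAt N (slots k cs) lt') i
        one : leafCount (isMax (skel (c ∷ cs'))) (gcs (c ∷ cs')) ≡ 1
        one = leafCount-fresh N (isMax (skel (c ∷ cs'))) (slots k cs) {c ∷ cs'} (All.lookup (leafCount-appendAt N (isMax (skel (c ∷ cs'))) (slots k cs)) i) lt' (proj₁ mx) (proj₂ mx)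

    -- The test function `f` is arbitrary, so the whole distribution of states is tracked at once;
    -- the induction needs this freedom, as it passes to shifted functions in `Tk-join`.
    insE-sum : ∀ p f e → GoodE k N e → Σl (insE k N e) (λ e' → f (OV p e') (LV e'))
      ≡ Tk k f (OV p e) (LV e) (OV p e) (YV p e) (BV e) (CV e)
    insOs-sum : ∀ p f cs → GoodOs k N cs → Σl (insOs k N cs) (λ cs' → f (tot (OV p) cs') (tot LV cs'))
      ≡ Tk k f (tot (OV p) cs) (tot LV cs) (tot (OV p) cs) (tot (YV p) cs) (tot BV cs) (tot CV cs)
    insEs-sum : ∀ p f es → GoodEs k N es → Σl (insEs k N es) (λ es' → f (Σl es' (OV p)) (Σl es' LV))
      ≡ Tk k f (Σl es (OV p)) (Σl es LV) (Σl es (OV p)) (Σl es (YV p)) (Σl es BV) (Σl es CV)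

    insE-sum p f (enode l []) (_ , len , lt , _) = begin
        Σl (map (enode l) (appendAt N (slots k [])) ++ []) F
      ≡⟨ Σl-++ (map (enode l) (appendAt N (slots k []))) [] F ⟩
        Σl (map (enode l) (appendAt N (slots k []))) F + 0
      ≡⟨ +-identityʳ _ ⟩
        Σl (map (enode l) (appendAt N (slots k []))) F
      ≡⟨ Σl-map (enode l) (appendAt N (slots k [])) F ⟩
        Σl (appendAt N (slots k [])) (λ cs' → F (enode l cs'))
      ≡⟨ direct-sum f [] l p len lt ⟩
        k * f 1 1
      -- A leaf that receives `N` stops being a leaf, and `N` is old below it, so the state becomes
      -- (1 , 1). It was (1 , 1) if `l` counted as old and (0 , 1) otherwise: the first two classes
      -- of `Tk`.
      ≡⟨ byLeaf (p l) ⟩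
        Tk k f (b2n (p l) + 0) 1 (b2n (p l) + 0) (b2n (not (p l)) + 0) 0 0 ∎
      where
      F = λ e' → f (OV p e') (LV e')
      lem : ∀ x y → 1 * x + (0 * y + 0) ≡ x
      lem = solve-∀
      lem₂ : ∀ x y → 0 * x + (1 * y + 0) ≡ y
      lem₂ = solve-∀
      byLeaf : ∀ b → k * f 1 1 ≡ Tk k f (b2n b + 0) 1 (b2n b + 0) (b2n (not b) + 0) 0 0
      byLeaf true = cong (k *_) (sym (lem (f 1 1) (f 2 1)))
      byLeaf false = cong (k *_) (sym (lem₂ (f 0 1) (f 1 1)))
    insE-sum p f (enode l cs@(c ∷ cs₀)) (old≤1 , len , lt , good) = begin
        Σl (map (enode l) (appendAt N cs) ++ map (enode l) (insOs k N cs)) F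
      ≡⟨ Σl-++ (map (enode l) (appendAt N cs)) _ F ⟩
        Σl (map (enode l) (appendAt N cs)) F + Σl (map (enode l) (insOs k N cs)) F
      ≡⟨ cong₂ _+_ (Σl-map (enode l) (appendAt N cs) F) (Σl-map (enode l) (insOs k N cs) F) ⟩
        Σl (appendAt N cs) (λ cs' → F (enode l cs')) + Σl (insOs k N cs) (λ cs' → F (enode l cs'))
      -- Deeper insertions keep the skeleton, so the predicate for old labels at this node may be
      -- frozen to `pm` before the induction hypothesis is applied.
      ≡⟨ cong₂ _+_ (direct-sum f cs l p len lt) (trans (Σl-congAll (All.map (λ {cs'} → same cs') (insOs-skel k N cs))) (insOs-sum pm f cs good)) ⟩
        k * f (suc (tot BV cs)) (suc (tot LV cs)) + Tk k f (tot (OV pm) cs) (tot LV cs) (tot (OV pm) cs) (tot (YV pm) cs) (tot BV cs) (tot CV cs)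
      ≡⟨ direct+deep k f cs pm old≤1 ⟩
        Tk k f (tot (OV pm) cs) (tot LV cs) (tot (OV pm) cs) (tot (YV pm) cs) (tot (OV pm) cs) ((1 ∸ m) + tot CV cs)
      ≡⟨ eqs (sym (OV-node p l c cs₀)) (sym (LV-node l c cs₀)) (sym (YV-node p l c cs₀))
           (trans (tot-OV pm cs) (cong (m +_) (sym (sumOs-tot oldN cs)))) (cong ((1 ∸ m) +_) (sym (sumOs-tot restN cs))) ⟩
        Tk k f (OV p (enode l cs)) (LV (enode l cs)) (OV p (enode l cs)) (YV p (enode l cs)) (BV (enode l cs)) (CV (enode l cs)) ∎
      where
      F = λ e' → f (OV p e') (LV e')
      pm = isMax (skel cs)
      m = leafCount pm (gcs cs)
      eqs : ∀ {O O' L L' y y' b b' c c'} → O ≡ O' → L ≡ L' → y ≡ y' → b ≡ b' → c ≡ c' → Tk k f O L O y b c ≡ Tk k f O' L' O' y' b' c'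
      eqs refl refl refl refl refl = refl
      same : ∀ cs' → skel cs' ≡ skel cs → F (enode l cs') ≡ f (tot (OV pm) cs') (tot LV cs')
      same [] ()
      same (c' ∷ cs') eq = cong₂ f (trans (OV-node p l c' cs') (cong (λ z → tot (OV (isMax z)) (c' ∷ cs')) eq)) (LV-node l c' cs')
    insOs-sum p f [] _ = sym (Tk-zero k f 0 0)
    insOs-sum p f (onode es ∷ os) (ge , go) = begin
        Σl (map (λ es' → onode es' ∷ os) (insEs k N es) ++ map (onode es ∷_) (insOs k N os)) F
      ≡⟨ Σl-++ (map (λ es' → onode es' ∷ os) (insEs k N es)) _ F ⟩
        Σl (map (λ es' → onode es' ∷ os) (insEs k N es)) F + Σl (map (onode es ∷_) (insOs k N os)) F
      ≡⟨ cong₂ _+_ (Σl-map _ (insEs k N es) F) (Σl-map _ (insOs k N os) F) ⟩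
        Σl (insEs k N es) (λ es' → f (Σl es' (OV p) + O₂) (Σl es' LV + L₂)) + Σl (insOs k N os) (λ os' → f (O₁ + tot (OV p) os') (L₁ + tot LV os'))
      ≡⟨ Tk-join k f O₁ O₂ L₁ L₂ (Σl es (YV p)) (Σl es BV) (Σl es CV) (tot (YV p) os) (tot BV os) (tot CV os)
           (insEs-sum p (λ a b → f (a + O₂) (b + L₂)) es ge)
           (trans (Σl-cong (insOs k N os) (λ os' → cong₂ f (+-comm O₁ _) (+-comm L₁ _))) (insOs-sum p (λ a b → f (a + O₁) (b + L₁)) os go)) ⟩
        Tk k f (O₁ + O₂) (L₁ + L₂) (O₁ + O₂) (tot (YV p) (onode es ∷ os)) (tot BV (onode es ∷ os)) (tot CV (onode es ∷ os)) ∎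
      where
      F = λ cs' → f (tot (OV p) cs') (tot LV cs')
      O₁ = Σl es (OV p)
      O₂ = tot (OV p) os
      L₁ = Σl es LV
      L₂ = tot LV os
    insEs-sum p f [] _ = sym (Tk-zero k f 0 0)
    insEs-sum p f (e ∷ es) (ge , go) = begin
        Σl (map (_∷ es) (insE k N e) ++ map (e ∷_) (insEs k N es)) F
      ≡⟨ Σl-++ (map (_∷ es) (insE k N e)) _ F ⟩
        Σl (map (_∷ es) (insE k N e)) F + Σl (map (e ∷_) (insEs k N es)) F
      ≡⟨ cong₂ _+_ (Σl-map _ (insE k N e) F) (Σl-map _ (insEs k N es) F) ⟩
        Σl (insE k N e) (λ e' → f (OV p e' + O₂) (LV e' + L₂)) + Σl (insEs k N es) (λ es' → f (O₁ + Σl es' (OV p)) (L₁ + Σl es' LV))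
      ≡⟨ Tk-join k f O₁ O₂ L₁ L₂ (YV p e) (BV e) (CV e) (Σl es (YV p)) (Σl es BV) (Σl es CV)
           (insE-sum p (λ a b → f (a + O₂) (b + L₂)) e ge)
           (trans (Σl-cong (insEs k N es) (λ es' → cong₂ f (+-comm O₁ _) (+-comm L₁ _))) (insEs-sum p (λ a b → f (a + O₁) (b + L₁)) es go)) ⟩
        Tk k f (O₁ + O₂) (L₁ + L₂) (O₁ + O₂) (Σl (e ∷ es) (YV p)) (Σl (e ∷ es) BV) (Σl (e ∷ es) CV) ∎
      where
      F = λ es' → f (Σl es' (OV p)) (Σl es' LV)
      O₁ = OV p e
      O₂ = Σl es (OV p)
      L₁ = LV e
      L₂ = Σl es LV

  -- Insertions seen from the roots: bar forests, hat forests and the last tree.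

  -- Condition (3) of removability, asked of all grand children of the root. For an old leaf this is
  -- the same, since its label is the greatest; in this form it also makes sense when there is no
  -- old leaf.
  below : Maybe ℕ → Skeleton → Bool
  below nothing sk = true
  below (just r) sk = all (λ l → suc l ≤ᵇ r) (concat sk)

  nx : Forest → Maybe ℕ
  nx [] = nothing
  nx (t ∷ _) = just (label t)

  firstOf : ℕ → Skeleton → Bool
  firstOf j sk = all null (take j sk)

  firstOf-[] : ∀ j → firstOf j [] ≡ true
  firstOf-[] zero = refl
  firstOf-[] (suc j) = refl

  -- Of the `suc j` slots only the last lies outside the first `j` children. So if the condition
  -- holds, one insertion preserves it and `j` destroy it; if it fails, none restores it.
  firstOf-appendAt : ∀ N (φ : Bool → ℕ) j cs → length cs ≡ suc j →
    Σl (appendAt N cs) (λ cs' → φ (firstOf j (skel cs')))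
      ≡ (if firstOf j (skel cs) then φ true + j * φ false else suc j * φ false)
  firstOf-appendAt N φ zero (onode es ∷ []) len = refl
  firstOf-appendAt N φ (suc j) (onode [] ∷ os) len = trans
    (cong (φ false +_) (trans (Σl-map _ (appendAt N os) _) (firstOf-appendAt N φ j os (suc-injective len))))
    (push (firstOf j (skel os)))
    where
    lem : ∀ a b c → b + (a + c) ≡ a + (b + c)
    lem = solve-∀
    push : ∀ b → φ false + (if b then φ true + j * φ false else suc j * φ false)
               ≡ (if b then φ true + suc j * φ false else suc (suc j) * φ false)
    push true = lem (φ true) (φ false) (j * φ false)
    push false = refl
  firstOf-appendAt N φ (suc j) (onode (e ∷ es) ∷ os) len = cong (φ false +_) (begin
      Σl (map (onode (e ∷ es) ∷_) (appendAt N os)) (λ cs' → φ (firstOf (suc j) (skel cs')))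
    ≡⟨ Σl-map _ (appendAt N os) _ ⟩
      Σl (appendAt N os) (λ _ → φ false)
    ≡⟨ firstOf-appendAt N (λ _ → φ false) j os (suc-injective len) ⟩
      (if firstOf j (skel os) then φ false + j * φ false else suc j * φ false)
    ≡⟨ const (firstOf j (skel os)) ⟩
      suc j * φ false ∎)
    where
    const : ∀ b → (if b then φ false + j * φ false else suc j * φ false) ≡ suc j * φ false
    const true = refl
    const false = refl

  firstOf-slots : ∀ k j cs → firstOf j (skel (slots k cs)) ≡ firstOf j (skel cs)
  firstOf-slots k j (c ∷ cs) = refl
  firstOf-slots k zero [] = refl
  firstOf-slots zero (suc j) [] = refl
  firstOf-slots (suc k) (suc j) [] = trans (firstOf-slots k j []) (firstOf-[] j)

  leafCount-∧ : ∀ b q gs → leafCount (λ m → b ∧ q m) gs ≤ leafCount q gs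
  leafCount-∧ true q gs = ≤-refl
  leafCount-∧ false q gs = subst (_≤ leafCount q gs) (sym (leafCount-zero (λ _ → false) (All.universal (λ _ → refl) gs))) z≤n

  module Root (j : ℕ) where
    k : ℕ
    k = suc j

    -- The labels counted as old at a root: none if an old leaf there would be removable.
    pR : Maybe ℕ → Skeleton → ℕ → Bool
    pR nxt sk m = not (firstOf j sk ∧ below nxt sk) ∧ isMax sk m

    RO RY RC : Maybe ℕ → ETree → ℕ
    RO nxt (enode l cs) = tot (OV (pR nxt (skel cs))) cs
    RY nxt (enode l cs) = tot (YV (pR nxt (skel cs))) cs
    RC nxt (enode l cs) = (1 ∸ leafCount (pR nxt (skel cs)) (gcs cs)) + tot CV cs

    -- `lastC` leaves out the root itself if its first `j` children are leaves: that root fits into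
    -- no class, and `TF` gives it terms of its own.
    RL lastC : ETree → ℕ
    RL (enode l cs) = tot LV cs
    lastC (enode l cs) = if firstOf j (skel cs) then tot CV cs else RC nothing (enode l cs)

    -- Singletons are covered, because `firstOf j []` holds.
    barT : ETree → Bool
    barT (enode l cs) = firstOf j (skel cs)

    bar : Forest → Bool
    bar [] = false
    bar (t ∷ []) = barT t
    bar (t ∷ t' ∷ ts) = bar (t' ∷ ts)

    -- FL counts the non-root leaves, FO the old leaves outside the trees that could have a removable one, FY = FL - FO,
    -- and FC the nodes of the fourth class of Tk, except the last root of a bar forest.
    FO FY FC FL : Forest → ℕ
    FO [] = 0
    FO (t ∷ ts) = RO (nx ts) t + FO ts
    FY [] = 0
    FY (t ∷ ts) = RY (nx ts) t + FY ts
    FL [] = 0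
    FL (t ∷ ts) = RL t + FL ts
    FC [] = 0
    FC (t ∷ []) = lastC t
    FC (t ∷ t' ∷ ts) = RC (just (label t')) t + FC (t' ∷ ts)

    -- The additional terms belong to the last root of a bar forest. In its last slot the new leaf
    -- keeps the forest bar and does not count as old, so only L grows. In each of its `j` other
    -- slots it produces a hat forest in which the new leaf counts, so O and L both grow.
    TF : Bool → (Bool → ℕ → ℕ → ℕ) → (O L y c : ℕ) → ℕ
    TF true f O L y c = Tk k (f true) O L O y O c + (f true O (suc L) + j * f false (suc O) (suc L))
    TF false f O L y c = Tk k (f false) O L O y O c

    pR≤1 : ∀ {N} nxt l cs → GoodE k N (enode l cs) → leafCount (pR nxt (skel cs)) (gcs cs) ≤ 1
    pR≤1 nxt l cs (old≤1 , _) = ≤-trans (leafCount-∧ (not (firstOf j (skel cs) ∧ below nxt (skel cs))) (isMax (skel cs)) (gcs cs)) old≤1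

    module _ (N : ℕ) where
      root-deep : ∀ nxt (f : Bool → ℕ → ℕ → ℕ) cs → GoodOs k N cs →
        Σl (insOs k N cs) (λ cs' → f (firstOf j (skel cs')) (tot (OV (pR nxt (skel cs'))) cs') (tot LV cs'))
          ≡ Tk k (f (firstOf j (skel cs))) (tot (OV (pR nxt (skel cs))) cs) (tot LV cs) (tot (OV (pR nxt (skel cs))) cs) (tot (YV (pR nxt (skel cs))) cs) (tot BV cs) (tot CV cs)
      root-deep nxt f cs good = trans
        (Σl-congAll (All.map (λ {cs'} e → cong (λ z → f (firstOf j z) (tot (OV (pR nxt z)) cs') (tot LV cs')) e) (insOs-skel k N cs)))
        (insOs-sum k N (pR nxt (skel cs)) (f (firstOf j (skel cs))) cs good)

      split : ∀ l cs (F : ETree → ℕ) → Σl (insE k N (enode l cs)) F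
        ≡ Σl (appendAt N (slots k cs)) (λ cs' → F (enode l cs')) + Σl (insOs k N cs) (λ cs' → F (enode l cs'))
      split l cs F = trans (Σl-++ (map (enode l) (appendAt N (slots k cs))) _ F)
        (cong₂ _+_ (Σl-map (enode l) (appendAt N (slots k cs)) F) (Σl-map (enode l) (insOs k N cs) F))

      module _ (cs : List OTree) (lt : All (λ g → label g < N) (gcs cs)) where
        private
          lt' : All (λ g → label g < N) (gcs (slots k cs))
          lt' = subst (All _) (sym (gcs-slots k cs)) lt

        root-inserted : ∀ nxt {cs'} → cs' ∈ appendAt N (slots k cs) →
          tot (OV (pR nxt (skel cs'))) cs' ≡ (if firstOf j (skel cs') ∧ below nxt (skel cs') then 0 else 1) + tot BV cs
        root-inserted nxt {cs'} i = trans (tot-OV (pR nxt (skel cs')) cs') (cong₂ _+_ (count (firstOf j (skel cs') ∧ below nxt (skel cs')))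
            (trans (All.lookup (tot-appendAt N BV (slots k cs)) i) (tot-slots k BV cs)))
          where
          mx = All.lookup (isMax-appendAt N (slots k cs) lt') i
          count : ∀ b → leafCount (λ m → not b ∧ isMax (skel cs') m) (gcs cs') ≡ (if b then 0 else 1)
          count true = leafCount-zero (λ _ → false) (All.universal (λ _ → refl) (gcs cs'))
          count false = leafCount-fresh N (isMax (skel cs')) (slots k cs) {cs'}
            (All.lookup (leafCount-appendAt N (isMax (skel cs')) (slots k cs)) i) lt' (proj₁ mx) (proj₂ mx)

        root-inserted-L : ∀ {cs'} → cs' ∈ appendAt N (slots k cs) → tot LV cs' ≡ suc (tot LV cs)
        root-inserted-L i = trans (All.lookup (tot-appendAt N LV (slots k cs)) i) (cong suc (tot-slots k LV cs))

        -- `N` is not below the next root `r`, so `below` fails after the insertion and `N` counts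
        -- as an old leaf in every slot, including the last one.
        inner-direct : ∀ r (f : ℕ → ℕ → ℕ) → r ≤ N → length (slots k cs) ≡ k →
          Σl (appendAt N (slots k cs)) (λ cs' → f (tot (OV (pR (just r) (skel cs'))) cs') (tot LV cs')) ≡ k * f (suc (tot BV cs)) (suc (tot LV cs))
        inner-direct r f r≤N len = trans (Σl-constAll (All.tabulate each)) (cong (_* f (suc (tot BV cs)) (suc (tot LV cs))) (trans (length-appendAt N (slots k cs)) len))
          where
          each : ∀ {cs'} → cs' ∈ appendAt N (slots k cs) → f (tot (OV (pR (just r) (skel cs'))) cs') (tot LV cs') ≡ f (suc (tot BV cs)) (suc (tot LV cs))
          each {cs'} i = cong₂ f (trans (root-inserted (just r) i) (cong (λ b → (if b then 0 else 1) + tot BV cs)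
              (trans (cong (firstOf j (skel cs') ∧_) notBelow) (∧-zeroʳ _)))) (root-inserted-L i)
            where
            notBelow : below (just r) (skel cs') ≡ false
            notBelow = trans (All.lookup (all-appendAt N (λ l → suc l ≤ᵇ r) (slots k cs)) i) (cong (_∧ all (λ l → suc l ≤ᵇ r) (concat (skel (slots k cs)))) (≤ᵇ-false (s≤s r≤N)))

        last-direct : ∀ (f : Bool → ℕ → ℕ → ℕ) → length (slots k cs) ≡ k →
          Σl (appendAt N (slots k cs)) (λ cs' → f (firstOf j (skel cs')) (tot (OV (pR nothing (skel cs'))) cs') (tot LV cs'))
            ≡ (if firstOf j (skel cs) then f true (tot BV cs) (suc (tot LV cs)) + j * f false (suc (tot BV cs)) (suc (tot LV cs))
               else k * f false (suc (tot BV cs)) (suc (tot LV cs)))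
        last-direct f len = trans (Σl-congAll (All.tabulate each))
            (trans (firstOf-appendAt N φ j (slots k cs) len) (cong (λ b → if b then φ true + j * φ false else suc j * φ false) (firstOf-slots k j cs)))
          where
          φ : Bool → ℕ
          φ b = f b ((if b then 0 else 1) + tot BV cs) (suc (tot LV cs))
          each : ∀ {cs'} → cs' ∈ appendAt N (slots k cs) → f (firstOf j (skel cs')) (tot (OV (pR nothing (skel cs'))) cs') (tot LV cs') ≡ φ (firstOf j (skel cs'))
          each {cs'} i = cong₂ (f (firstOf j (skel cs'))) (trans (root-inserted nothing i) (cong (λ b → (if b then 0 else 1) + tot BV cs) (∧-identityʳ _))) (root-inserted-L i)

      inner-sum : ∀ r (f : ℕ → ℕ → ℕ) t → r ≤ N → GoodE k N t →
        Σl (insE k N t) (λ t' → f (RO (just r) t') (RL t')) ≡ Tk k f (RO (just r) t) (RL t) (RO (just r) t) (RY (just r) t) (RO (just r) t) (RC (just r) t)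
      inner-sum r f (enode l cs) r≤N good@(_ , len , lt , go) = trans (split l cs (λ t' → f (RO (just r) t') (RL t')))
        (trans (cong₂ _+_ (inner-direct cs lt r f r≤N len) (root-deep (just r) (λ _ → f) cs go)) (direct+deep k f cs (pR (just r) (skel cs)) (pR≤1 (just r) l cs good)))

      last-sum : ∀ (f : Bool → ℕ → ℕ → ℕ) t → GoodE k N t →
        Σl (insE k N t) (λ t' → f (barT t') (RO nothing t') (RL t')) ≡ TF (barT t) f (RO nothing t) (RL t) (RY nothing t) (lastC t)
      last-sum f (enode l cs) good@(_ , len , lt , go) = trans (split l cs (λ t' → f (barT t') (RO nothing t') (RL t')))
        (trans (cong₂ _+_ (last-direct cs lt f len) (root-deep nothing f cs go)) (finish (firstOf j (skel cs)) refl))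
        where
        O = tot (OV (pR nothing (skel cs))) cs
        Y = tot (YV (pR nothing (skel cs))) cs
        L = tot LV cs
        finish : ∀ b → firstOf j (skel cs) ≡ b →
          (if b then f true (tot BV cs) (suc L) + j * f false (suc (tot BV cs)) (suc L) else k * f false (suc (tot BV cs)) (suc L))
            + Tk k (f b) O L O Y (tot BV cs) (tot CV cs)
          ≡ TF b f O L Y (if b then tot CV cs else RC nothing (enode l cs))
        finish true eq = trans (+-comm (f true (tot BV cs) (suc L) + j * f false (suc (tot BV cs)) (suc L)) _) (cong (λ z → Tk k (f true) O L O Y z (tot CV cs) + (f true z (suc L) + j * f false (suc z) (suc L))) BV≡O)
          where
          -- Without a next root `below` holds trivially, so in a bar tree no grand child of the
          -- root counts as old.
          BV≡O : tot BV cs ≡ O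
          BV≡O = sym (trans (tot-OV (pR nothing (skel cs)) cs) (cong (_+ tot BV cs)
            (leafCount-zero (pR nothing (skel cs)) (All.universal (λ g → cong (λ z → not (z ∧ true) ∧ isMax (skel cs) (label g)) eq) (gcs cs)))))
        finish false eq = direct+deep k (f false) cs (pR nothing (skel cs)) (pR≤1 nothing l cs good)

      TF-join : ∀ b (f : Bool → ℕ → ℕ → ℕ) O₁ O₂ L₁ L₂ y₁ c₁ y₂ c₂ {S₁ S₂} →
        S₁ ≡ Tk k (λ x z → f b (x + O₂) (z + L₂)) O₁ L₁ O₁ y₁ O₁ c₁ →
        S₂ ≡ TF b (λ b x z → f b (x + O₁) (z + L₁)) O₂ L₂ y₂ c₂ →
        S₁ + S₂ ≡ TF b f (O₁ + O₂) (L₁ + L₂) (y₁ + y₂) (c₁ + c₂)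
      TF-join false f O₁ O₂ L₁ L₂ y₁ c₁ y₂ c₂ p q = Tk-join k (f false) O₁ O₂ L₁ L₂ y₁ O₁ c₁ y₂ O₂ c₂ p q
      TF-join true f O₁ O₂ L₁ L₂ y₁ c₁ y₂ c₂ refl refl = trans (sym (+-assoc (Tk k (λ x z → f true (x + O₂) (z + L₂)) O₁ L₁ O₁ y₁ O₁ c₁) _ _))
        (cong₂ _+_ (Tk-join k (f true) O₁ O₂ L₁ L₂ y₁ O₁ c₁ y₂ O₂ c₂ refl refl)
          (cong₂ (λ x z → f true x (suc z) + j * f false (suc x) (suc z)) (+-comm O₂ O₁) (+-comm L₂ L₁)))

      nx-labels : ∀ {F G : Forest} → map label G ≡ map label F → nx G ≡ nx F
      nx-labels {[]} {[]} e = refl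
      nx-labels {_ ∷ _} {_ ∷ _} e = cong just (∷-injectiveˡ e)

      forest-sum : ∀ (f : Bool → ℕ → ℕ → ℕ) F → GoodEs k N F → All (λ t → label t < N) F →
        Σl (insEs k N F) (λ G → f (bar G) (FO G) (FL G)) ≡ TF (bar F) f (FO F) (FL F) (FY F) (FC F)
      forest-sum f [] _ _ = sym (Tk-zero k (f false) 0 0)
      forest-sum f (t ∷ []) (g , _) _ = begin
          Σl (map (_∷ []) (insE k N t) ++ []) H
        ≡⟨ Σl-++ (map (_∷ []) (insE k N t)) [] H ⟩
          Σl (map (_∷ []) (insE k N t)) H + 0
        ≡⟨ +-identityʳ _ ⟩
          Σl (map (_∷ []) (insE k N t)) H
        ≡⟨ Σl-map (_∷ []) (insE k N t) H ⟩
          Σl (insE k N t) (λ t' → f (barT t') (RO nothing t' + 0) (RL t' + 0))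
        ≡⟨ Σl-cong (insE k N t) (λ t' → cong₂ (f (barT t')) (+-identityʳ _) (+-identityʳ _)) ⟩
          Σl (insE k N t) (λ t' → f (barT t') (RO nothing t') (RL t'))
        ≡⟨ last-sum f t g ⟩
          TF (barT t) f (RO nothing t) (RL t) (RY nothing t) (lastC t)
        ≡⟨ eqs (sym (+-identityʳ (RO nothing t))) (sym (+-identityʳ (RL t))) (sym (+-identityʳ (RY nothing t))) ⟩
          TF (barT t) f (RO nothing t + 0) (RL t + 0) (RY nothing t + 0) (lastC t) ∎
        where
        H = λ G → f (bar G) (FO G) (FL G)
        eqs : ∀ {O O' L L' y y'} → O ≡ O' → L ≡ L' → y ≡ y' → TF (barT t) f O L y (lastC t) ≡ TF (barT t) f O' L' y' (lastC t)
        eqs refl refl refl = refl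
      forest-sum f (t ∷ F@(t₂ ∷ ts)) (g , gs) (_ ∷ lts@(lt ∷ _)) = begin
          Σl (map (_∷ F) (insE k N t) ++ map (t ∷_) (insEs k N F)) H
        ≡⟨ Σl-++ (map (_∷ F) (insE k N t)) _ H ⟩
          Σl (map (_∷ F) (insE k N t)) H + Σl (map (t ∷_) (insEs k N F)) H
        ≡⟨ cong₂ _+_ (Σl-map (_∷ F) (insE k N t) H) (Σl-map (t ∷_) (insEs k N F) H) ⟩
          Σl (insE k N t) (λ t' → f (bar F) (RO r t' + FO F) (RL t' + FL F)) + Σl (insEs k N F) (λ G → H (t ∷ G))
        ≡⟨ TF-join (bar F) f (RO r t) (FO F) (RL t) (FL F) (RY r t) (RC r t) (FY F) (FC F)
             (inner-sum (label t₂) (λ x z → f (bar F) (x + FO F) (z + FL F)) t (<⇒≤ lt) g)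
             (trans (Σl-congAll (All.map (λ {G} → same G) (insEs-labels k N F)))
               (forest-sum (λ b x z → f b (x + RO r t) (z + RL t)) F gs lts)) ⟩
          TF (bar F) f (RO r t + FO F) (RL t + FL F) (RY r t + FY F) (RC r t + FC F) ∎
        where
        H = λ G → f (bar G) (FO G) (FL G)
        r = just (label t₂)
        -- Insertions into later trees keep the root labels, hence the next root that decides what
        -- counts as old in `t`.
        same : ∀ G → map label G ≡ map label F → H (t ∷ G) ≡ f (bar G) (FO G + RO r t) (FL G + RL t)
        same [] ()
        same (t' ∷ G) eq = cong₂ (f (bar (t' ∷ G))) (trans (cong (λ z → RO z t + FO (t' ∷ G)) (nx-labels {F} {t' ∷ G} eq)) (+-comm (RO r t) _)) (+-comm (RL t) _)

  -- Every forest arises from exactly one insertion.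

  EmptyO : OTree → Set
  EmptyO o = o ≡ onode []

  labelsEs-++ : ∀ es fs → labelsEs (es ++ fs) ≡ labelsEs es ++ labelsEs fs
  labelsEs-++ [] fs = refl
  labelsEs-++ (e ∷ es) fs = trans (cong (labelsE e ++_) (labelsEs-++ es fs)) (sym (++-assoc (labelsE e) _ _))

  labels-snoc : ∀ N es → labelsEs (es ++ leaf N ∷ []) ↭ N ∷ labelsEs es
  labels-snoc N es = ↭-trans (↭-reflexive (labelsEs-++ es (leaf N ∷ []))) (↭-trans (shift N (labelsEs es) []) (↭-reflexive (cong (N ∷_) (++-identityʳ _))))

  labelsOs-slots : ∀ k cs → labelsOs (slots k cs) ≡ labelsOs cs
  labelsOs-slots k (c ∷ cs) = refl
  labelsOs-slots k [] = go k
    where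
    go : ∀ k → labelsOs (replicate k (onode [])) ≡ []
    go zero = refl
    go (suc k) = go k

  labels-appendAt : ∀ N cs → All (λ cs' → labelsOs cs' ↭ N ∷ labelsOs cs) (appendAt N cs)
  labels-appendAt N [] = []
  labels-appendAt N (onode es ∷ os) = ++⁺ʳ (labelsOs os) (labels-snoc N es)
    ∷ All.map⁺ (All.map (λ p → ↭-trans (++⁺ˡ (labelsEs es) p) (shift N (labelsEs es) (labelsOs os))) (labels-appendAt N os))

  label∈ : ∀ {P : ℕ → Set} cs → All P (labelsOs cs) → All (λ g → P (label g)) (gcs cs)
  label∈Es : ∀ {P : ℕ → Set} es → All P (labelsEs es) → All (λ g → P (label g)) es
  label∈Es [] ps = []
  label∈Es (enode l cs ∷ es) (p ∷ ps) = p ∷ label∈Es es (All.++⁻ʳ (labelsOs cs) ps)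
  label∈ [] ps = []
  label∈ (onode es ∷ os) ps = All.++⁺ (label∈Es es (All.++⁻ˡ (labelsEs es) ps)) (label∈ os (All.++⁻ʳ (labelsEs es) ps))

  skel-All⁻ : ∀ {P : ℕ → Set} cs → All P (concat (skel cs)) → All (λ g → P (label g)) (gcs cs)
  skel-All⁻ [] ps = []
  skel-All⁻ {P} (onode es ∷ os) ps = All.++⁺ (All.map⁻ (All.++⁻ˡ (map label es) ps)) (skel-All⁻ {P} os (All.++⁻ʳ (map label es) ps))

  gcs-All-resp : ∀ {P : ℕ → Set} cs cs' → skel cs' ≡ skel cs → All (λ g → P (label g)) (gcs cs) → All (λ g → P (label g)) (gcs cs')
  gcs-All-resp {P} cs cs' eq ps = skel-All⁻ {P} cs' (subst (λ z → All P (concat z)) (sym eq) (skel-All {P} cs ps))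

  empty-resp : ∀ cs cs' → skel cs' ≡ skel cs → All EmptyO cs' → All EmptyO cs
  empty-resp [] [] eq [] = []
  empty-resp (onode [] ∷ cs) (onode .[] ∷ cs') eq (refl ∷ ps) = refl ∷ empty-resp cs cs' (∷-injectiveʳ eq) ps
  empty-resp (onode (x ∷ es) ∷ cs) (onode .[] ∷ cs') () (refl ∷ ps)

  shape-resp : ∀ k cs cs' → skel cs' ≡ skel cs → PrunedShape k cs → PrunedShape k cs'
  shape-resp k [] [] eq s = s
  shape-resp k (c ∷ cs) cs' eq (inj₂ (len , ne)) = inj₂
    (trans (sym (length-map _ cs')) (trans (cong length eq) (trans (length-map _ (c ∷ cs)) len)) , ne ∘ empty-resp (c ∷ cs) cs' eq)

  slots-length : ∀ k cs → PrunedShape k cs → length (slots k cs) ≡ k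
  slots-length k [] s = length-replicate k
  slots-length k (c ∷ cs) (inj₂ (len , _)) = len

  linked-snoc : ∀ {N} xs → Linked _<_ xs → All (_< N) xs → Linked _<_ (xs ++ N ∷ [])
  linked-snoc [] [] [] = [-]
  linked-snoc (x ∷ []) [-] (p ∷ []) = p ∷ [-]
  linked-snoc (x ∷ y ∷ xs) (q ∷ ls) (p ∷ ps) = q ∷ linked-snoc (y ∷ xs) ls ps

  linked-init : ∀ xs {ys} → Linked _<_ (xs ++ ys) → Linked _<_ xs
  linked-init [] ls = []
  linked-init (x ∷ []) ls = [-]
  linked-init (x ∷ y ∷ xs) (q ∷ ls) = q ∷ linked-init (y ∷ xs) ls

  linked-labels-snoc : ∀ N es → Linked _<_ (map label es) → All (λ e → label e < N) es → Linked _<_ (map label (es ++ leaf N ∷ []))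
  linked-labels-snoc N es ls ps = subst (Linked _<_) (sym (map-++ label es (leaf N ∷ []))) (linked-snoc _ ls (All.map⁺ ps))

  module _ (k : ℕ) where
    wf-leaf : ∀ N → WfE k (leaf N)
    wf-leaf N = inj₁ refl , [] , tt

    wf-++ : ∀ es fs → WfEs k es → WfEs k fs → WfEs k (es ++ fs)
    wf-++ [] fs _ w = w
    wf-++ (e ∷ es) fs (w , ws) w' = w , wf-++ es fs ws w'

    wf-++⁻ : ∀ es fs → WfEs k (es ++ fs) → WfEs k es
    wf-++⁻ [] fs _ = tt
    wf-++⁻ (e ∷ es) fs (w , ws) = w , wf-++⁻ es fs ws

    wf-slots : ∀ cs → WfOs k cs → WfOs k (slots k cs)
    wf-slots (c ∷ cs) w = w
    wf-slots [] w = go k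
      where
      go : ∀ m → WfOs k (replicate m (onode []))
      go zero = tt
      go (suc m) = [] , tt , go m

    module _ (N : ℕ) where
      labels-insE : ∀ e → All (λ e' → labelsE e' ↭ N ∷ labelsE e) (insE k N e)
      labels-insOs : ∀ cs → All (λ cs' → labelsOs cs' ↭ N ∷ labelsOs cs) (insOs k N cs)
      labels-insEs : ∀ es → All (λ es' → labelsEs es' ↭ N ∷ labelsEs es) (insEs k N es)
      labels-insE (enode l cs) = All.++⁺
        (All.map⁺ (All.map (λ p → ↭-trans (prep l (↭-trans p (↭-reflexive (cong (N ∷_) (labelsOs-slots k cs))))) (shift N (l ∷ []) (labelsOs cs))) (labels-appendAt N (slots k cs))))
        (All.map⁺ (All.map (λ p → ↭-trans (prep l p) (shift N (l ∷ []) (labelsOs cs))) (labels-insOs cs)))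
      labels-insOs [] = []
      labels-insOs (onode es ∷ os) = All.++⁺
        (All.map⁺ (All.map (++⁺ʳ (labelsOs os)) (labels-insEs es)))
        (All.map⁺ (All.map (λ p → ↭-trans (++⁺ˡ (labelsEs es) p) (shift N (labelsEs es) (labelsOs os))) (labels-insOs os)))
      labels-insEs [] = []
      labels-insEs (e ∷ es) = All.++⁺
        (All.map⁺ (All.map (++⁺ʳ (labelsEs es)) (labels-insE e)))
        (All.map⁺ (All.map (λ p → ↭-trans (++⁺ˡ (labelsE e) p) (shift N (labelsE e) (labelsEs es))) (labels-insEs es)))

      labels-insF : ∀ F → All (λ G → labelsEs G ↭ N ∷ labelsEs F) (insF k N F)
      labels-insF F = labels-snoc N F ∷ labels-insEs F

      length-appendAt-each : ∀ cs → All (λ cs' → length cs' ≡ length cs) (appendAt N cs)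
      length-appendAt-each [] = []
      length-appendAt-each (onode es ∷ os) = refl ∷ All.map⁺ (All.map (cong suc) (length-appendAt-each os))

      appendAt-nonempty : ∀ cs → All (λ cs' → ¬ All EmptyO cs') (appendAt N cs)
      appendAt-nonempty [] = []
      appendAt-nonempty (onode es ∷ os) = snoc es ∷ All.map⁺ (All.map (λ f → λ { (_ ∷ ps) → f ps }) (appendAt-nonempty os))
        where
        snoc : ∀ es → ¬ All EmptyO (onode (es ++ leaf N ∷ []) ∷ os)
        snoc [] (() ∷ _)
        snoc (_ ∷ _) (() ∷ _)

      gcs-All-appendAt : ∀ {P : ℕ → Set} cs → P N → All (λ g → P (label g)) (gcs cs) → All (λ cs' → All (λ g → P (label g)) (gcs cs')) (appendAt N cs)
      gcs-All-appendAt [] pN ps = []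
      gcs-All-appendAt {P} (onode es ∷ os) pN ps =
        All.++⁺ (All.++⁺ (All.++⁻ˡ es ps) (pN ∷ [])) (All.++⁻ʳ es ps)
        ∷ All.map⁺ (All.map (All.++⁺ (All.++⁻ˡ es ps)) (gcs-All-appendAt {P} os pN (All.++⁻ʳ es ps)))

      gcs-All-appendAt⁻ : ∀ {P : ℕ → Set} cs → All (λ cs' → All (λ g → P (label g)) (gcs cs') → All (λ g → P (label g)) (gcs cs)) (appendAt N cs)
      gcs-All-appendAt⁻ [] = []
      gcs-All-appendAt⁻ {P} (onode es ∷ os) =
        (λ ps → All.++⁺ (All.++⁻ˡ es (All.++⁻ˡ (es ++ leaf N ∷ []) ps)) (All.++⁻ʳ (es ++ leaf N ∷ []) ps))
        ∷ All.map⁺ (All.map (λ f ps → All.++⁺ (All.++⁻ˡ es ps) (f (All.++⁻ʳ es ps))) (gcs-All-appendAt⁻ {P} os))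

      wf-appendAt : ∀ cs → WfOs k cs → All (_< N) (labelsOs cs) → All (WfOs k) (appendAt N cs)
      wf-appendAt [] _ _ = []
      wf-appendAt (onode es ∷ os) (ln , we , wo) lt =
        (linked-labels-snoc N es ln (label∈Es es (All.++⁻ˡ (labelsEs es) lt)) , wf-++ es (leaf N ∷ []) we (wf-leaf N , tt) , wo)
        ∷ All.map⁺ (All.map (λ w → ln , we , w) (wf-appendAt os wo (All.++⁻ʳ (labelsEs es) lt)))

      wf-insE : ∀ e → WfE k e → All (_< N) (labelsE e) → All (WfE k) (insE k N e)
      wf-insOs : ∀ cs → WfOs k cs → All (_< N) (labelsOs cs) → All (WfOs k) (insOs k N cs)
      wf-insEs : ∀ es → WfEs k es → All (_< N) (labelsEs es) → All (WfEs k) (insEs k N es)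
      wf-insE (enode l cs) (sh , inc , w) (l<N ∷ lt) = All.++⁺
        (All.map⁺ (All.tabulate λ i → inj₂ (trans (All.lookup (length-appendAt-each (slots k cs)) i) (slots-length k cs sh) , All.lookup (appendAt-nonempty (slots k cs)) i)
          , All.lookup (gcs-All-appendAt {l <_} (slots k cs) l<N (subst (All _) (sym (gcs-slots k cs)) inc)) i
          , All.lookup (wf-appendAt (slots k cs) (wf-slots cs w) (subst (All _) (sym (labelsOs-slots k cs)) lt)) i))
        (All.map⁺ (All.tabulate λ {cs'} i → let eq = All.lookup (insOs-skel k N cs) i in
          shape-resp k cs cs' eq sh , gcs-All-resp {l <_} cs cs' eq inc , All.lookup (wf-insOs cs w lt) i))
      wf-insOs [] _ _ = []
      wf-insOs (onode es ∷ os) (ln , we , wo) lt = All.++⁺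
        (All.map⁺ (All.tabulate λ i → subst (Linked _<_) (sym (All.lookup (insEs-labels k N es) i)) ln , All.lookup (wf-insEs es we (All.++⁻ˡ (labelsEs es) lt)) i , wo))
        (All.map⁺ (All.map (λ w → ln , we , w) (wf-insOs os wo (All.++⁻ʳ (labelsEs es) lt))))
      wf-insEs [] _ _ = []
      wf-insEs (e ∷ es) (w , ws) lt = All.++⁺
        (All.map⁺ (All.map (λ w' → w' , ws) (wf-insE e w (All.++⁻ˡ (labelsE e) lt))))
        (All.map⁺ (All.map (λ w' → w , w') (wf-insEs es ws (All.++⁻ʳ (labelsE e) lt))))

      linked-insF : ∀ F → Linked _<_ (map label F) → All (_< N) (labelsEs F) → All (λ G → Linked _<_ (map label G)) (insF k N F)
      linked-insF F ln lt = linked-labels-snoc N F ln (label∈Es F lt) ∷ All.map (λ eq → subst (Linked _<_) (sym eq) ln) (insEs-labels k N F)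

      wf-insF : ∀ F → WfEs k F → All (_< N) (labelsEs F) → All (WfEs k) (insF k N F)
      wf-insF F w lt = wf-++ F (leaf N ∷ []) w (wf-leaf N , tt) ∷ wf-insEs F w lt

      -- By pruning, an internal node has at least one grand child, and its label would be greater
      -- still.
      max-leaf : ∀ l cs → WfE k (enode l cs) → All (_≤ N) (labelsOs cs) → l ≡ N → cs ≡ []
      max-leaf l cs (inj₁ e , _) _ _ = e
      max-leaf l cs (inj₂ (_ , ne) , inc , _) le refl = ⊥-elim (ne (empties cs inc (label∈ cs le)))
        where
        empties : ∀ cs → All (λ g → l < label g) (gcs cs) → All (λ g → label g ≤ l) (gcs cs) → All EmptyO cs
        empties [] _ _ = []
        empties (onode [] ∷ os) a b = refl ∷ empties os a b
        empties (onode (e ∷ es) ∷ os) (p ∷ _) (q ∷ _) = ⊥-elim (<⇒≱ p q)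

      allEmpty? : ∀ cs → (All EmptyO cs) ⊎ (¬ All EmptyO cs)
      allEmpty? [] = inj₁ []
      allEmpty? (onode (_ ∷ _) ∷ os) = inj₂ λ { (() ∷ _) }
      allEmpty? (onode [] ∷ os) with allEmpty? os
      ... | inj₁ p = inj₁ (refl ∷ p)
      ... | inj₂ f = inj₂ λ { (_ ∷ ps) → f ps }

      allEmpty-replicate : ∀ cs → All EmptyO cs → cs ≡ replicate (length cs) (onode [])
      allEmpty-replicate [] [] = refl
      allEmpty-replicate (_ ∷ cs) (refl ∷ ps) = cong (_ ∷_) (allEmpty-replicate cs ps)

      -- A descent to the node labelled `N`, which is a leaf and the last of its siblings. The
      -- alternatives in `comp-Os` and `comp-Es` tell whether `N` sits directly in the given list,
      -- to be undone by the caller, or deeper.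
      comp-E : ∀ l cs → WfE k (enode l cs) → All (_≤ N) (labelsOs cs) → N ∈ labelsOs cs →
        Σ (List OTree) λ cs₀ → WfE k (enode l cs₀) × enode l cs ∈ insE k N (enode l cs₀)
      comp-Os : ∀ cs → WfOs k cs → All (_≤ N) (labelsOs cs) → N ∈ labelsOs cs →
        (Σ (List OTree) λ cs₀ → WfOs k cs₀ × cs ∈ appendAt N cs₀) ⊎ (Σ (List OTree) λ cs₀ → WfOs k cs₀ × cs ∈ insOs k N cs₀)
      comp-Es : ∀ es → WfEs k es → Linked _<_ (map label es) → All (_≤ N) (labelsEs es) → N ∈ labelsEs es →
        (Σ (List ETree) λ es₀ → es ≡ es₀ ++ leaf N ∷ []) ⊎ (Σ (List ETree) λ es₀ → WfEs k es₀ × es ∈ insEs k N es₀)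
      comp-E l (c ∷ cs) (inj₁ () , _)
      comp-E l cs (inj₂ (len , ne) , inc , w) le N∈ with comp-Os cs w le N∈
      ... | inj₂ (cs₀ , w₀ , i) = cs₀ , (shape-resp k cs cs₀ (sym eq) (inj₂ (len , ne)) , gcs-All-resp {l <_} cs cs₀ (sym eq) inc , w₀)
            , ∈-++⁺ʳ (map (enode l) (appendAt N (slots k cs₀))) (∈-map⁺ (enode l) i)
        where eq = All.lookup (insOs-skel k N cs₀) i
      -- If only childless children remain once `N` is taken away, they have to be pruned; the
      -- preimage is then a leaf, and `slots k []` restores precisely these children.
      ... | inj₁ (cs₀ , w₀ , i) with allEmpty? cs₀
      ...   | inj₁ emp = [] , wf-leaf l , ∈-++⁺ˡ (∈-map⁺ (enode l) (subst (λ z → cs ∈ appendAt N z) eq i))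
        where
        eq : cs₀ ≡ slots k []
        eq = trans (allEmpty-replicate cs₀ emp) (cong (λ m → replicate m (onode [])) (trans (sym (All.lookup (length-appendAt-each cs₀) i)) len))
      comp-E l cs (inj₂ (len , ne) , inc , w) le N∈ | inj₁ ([] , w₀ , i) | inj₂ ne₀ = ⊥-elim (ne₀ [])
      comp-E l cs (inj₂ (len , ne) , inc , w) le N∈ | inj₁ (cs₀@(_ ∷ _) , w₀ , i) | inj₂ ne₀ =
        cs₀ , (inj₂ (trans (sym (All.lookup (length-appendAt-each cs₀) i)) len , ne₀) , All.lookup (gcs-All-appendAt⁻ {l <_} cs₀) i inc , w₀) , ∈-++⁺ˡ (∈-map⁺ (enode l) i)
      comp-Os (onode es ∷ os) (ln , we , wo) le N∈ with ∈-++⁻ (labelsEs es) N∈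
      ... | inj₁ N∈es with comp-Es es we ln (All.++⁻ˡ (labelsEs es) le) N∈es
      ...   | inj₁ (es₀ , refl) = inj₁ (onode es₀ ∷ os , (linked-init (map label es₀) (subst (Linked _<_) (map-++ label es₀ (leaf N ∷ [])) ln) , wf-++⁻ es₀ _ we , wo) , here refl)
      ...   | inj₂ (es₀ , w₀ , i) = inj₂ (onode es₀ ∷ os , (subst (Linked _<_) (All.lookup (insEs-labels k N es₀) i) ln , w₀ , wo) , ∈-++⁺ˡ (∈-map⁺ (λ z → onode z ∷ os) i))
      comp-Os (onode es ∷ os) (ln , we , wo) le N∈ | inj₂ N∈os with comp-Os os wo (All.++⁻ʳ (labelsEs es) le) N∈os
      ...   | inj₁ (os₀ , w₀ , i) = inj₁ (onode es ∷ os₀ , (ln , we , w₀) , there (∈-map⁺ (onode es ∷_) i))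
      ...   | inj₂ (os₀ , w₀ , i) = inj₂ (onode es ∷ os₀ , (ln , we , w₀) , ∈-++⁺ʳ (map (λ z → onode z ∷ os₀) (insEs k N es)) (∈-map⁺ (onode es ∷_) i))
      comp-Es (enode l cs ∷ es) (w , ws) ln (l≤ ∷ le) N∈ with ∈-++⁻ (labelsE (enode l cs)) N∈
      comp-Es (enode l cs ∷ es) (w , ws) ln (l≤ ∷ le) N∈ | inj₁ (here N≡l) with max-leaf l cs w (All.++⁻ˡ (labelsOs cs) le) (sym N≡l)
      comp-Es (enode l .[] ∷ []) (w , ws) ln (l≤ ∷ le) N∈ | inj₁ (here refl) | refl = inj₁ ([] , refl)
      comp-Es (enode l .[] ∷ enode l₂ _ ∷ es) (w , ws) (l<l₂ ∷ ln) (l≤ ∷ (l₂≤ ∷ _)) N∈ | inj₁ (here refl) | refl = ⊥-elim (<⇒≱ l<l₂ l₂≤)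
      comp-Es (enode l cs ∷ es) (w , ws) ln (l≤ ∷ le) N∈ | inj₁ (there N∈cs) with comp-E l cs w (All.++⁻ˡ (labelsOs cs) le) N∈cs
      ... | cs₀ , w₀ , i = inj₂ (enode l cs₀ ∷ es , (w₀ , ws) , ∈-++⁺ˡ (∈-map⁺ (_∷ es) i))
      comp-Es (enode l cs ∷ es) (w , ws) ln (l≤ ∷ le) N∈ | inj₂ N∈es with comp-Es es ws (Linked.tail ln) (All.++⁻ʳ (labelsOs cs) le) N∈es
      ... | inj₁ (es₀ , refl) = inj₁ (enode l cs ∷ es₀ , refl)
      ... | inj₂ (es₀ , w₀ , i) = inj₂ (enode l cs ∷ es₀ , (w , w₀) , ∈-++⁺ʳ (map (_∷ es₀) (insE k N (enode l cs))) (∈-map⁺ (enode l cs ∷_) i))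

  prune : List OTree → List OTree
  prune cs = if all isOLeaf cs then [] else cs

  prune-pruned : ∀ k cs → PrunedShape k cs → prune cs ≡ cs
  prune-pruned k [] _ = refl
  prune-pruned k (c ∷ cs) (inj₂ (_ , ne)) with all isOLeaf (c ∷ cs) in eq
  ... | false = refl
  ... | true = ⊥-elim (ne (empties (c ∷ cs) eq))
    where
    empties : ∀ cs → all isOLeaf cs ≡ true → All EmptyO cs
    empties [] _ = []
    empties (onode [] ∷ cs) e = refl ∷ empties cs e

  prune-slots : ∀ k cs → PrunedShape k cs → prune (slots k cs) ≡ cs
  prune-slots k (c ∷ cs) s = prune-pruned k (c ∷ cs) s
  prune-slots k [] s = cong (λ b → if b then [] else replicate k (onode [])) (go k)
    where
    go : ∀ m → all isOLeaf (replicate m (onode [])) ≡ true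
    go zero = refl
    go (suc m) = go m

  ≡ᵇ-refl : ∀ m → (m ≡ᵇ m) ≡ true
  ≡ᵇ-refl zero = refl
  ≡ᵇ-refl (suc m) = ≡ᵇ-refl m

  ≡ᵇ-≢ : ∀ {m n} → m ≢ n → (m ≡ᵇ n) ≡ false
  ≡ᵇ-≢ {zero} {zero} p = ⊥-elim (p refl)
  ≡ᵇ-≢ {zero} {suc n} p = refl
  ≡ᵇ-≢ {suc m} {zero} p = refl
  ≡ᵇ-≢ {suc m} {suc n} p = ≡ᵇ-≢ (p ∘ cong suc)

  module _ (N : ℕ) where
    -- A left inverse of insertion: nodes labelled `N` are dropped and the result is pruned again.
    -- It shows that insertions into different forests give different results (`gen-unique`).
    delE : ETree → ETree
    delOs : List OTree → List OTree
    delEs : List ETree → List ETree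
    delE (enode l cs) = enode l (prune (delOs cs))
    delOs [] = []
    delOs (onode es ∷ os) = onode (delEs es) ∷ delOs os
    delEs [] = []
    delEs (e ∷ es) = if label e ≡ᵇ N then delEs es else delE e ∷ delEs es

    delEs-keep : ∀ {e es} → label e < N → delEs (e ∷ es) ≡ delE e ∷ delEs es
    delEs-keep {e} {es} lt = cong (λ b → if b then delEs es else delE e ∷ delEs es) (≡ᵇ-≢ (<⇒≢ lt))

    delEs-snoc : ∀ es → All (λ e → label e < N) es → delEs (es ++ leaf N ∷ []) ≡ delEs es
    delEs-snoc [] [] = cong (λ b → if b then [] else leaf N ∷ []) (≡ᵇ-refl N)
    delEs-snoc (e ∷ es) (p ∷ ps) = trans (delEs-keep {e} {es ++ leaf N ∷ []} p) (trans (cong (delE e ∷_) (delEs-snoc es ps)) (sym (delEs-keep {e} {es} p)))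

    delOs-replicate : ∀ m → delOs (replicate m (onode [])) ≡ replicate m (onode [])
    delOs-replicate zero = refl
    delOs-replicate (suc m) = cong (onode [] ∷_) (delOs-replicate m)

    module _ (k : ℕ) where
      delE-id : ∀ e → WfE k e → All (_< N) (labelsE e) → delE e ≡ e
      delOs-id : ∀ cs → WfOs k cs → All (_< N) (labelsOs cs) → delOs cs ≡ cs
      delEs-id : ∀ es → WfEs k es → All (_< N) (labelsEs es) → delEs es ≡ es
      delE-id (enode l cs) (sh , _ , w) (_ ∷ lt) = cong (enode l) (trans (cong prune (delOs-id cs w lt)) (prune-pruned k cs sh))
      delOs-id [] _ _ = refl
      delOs-id (onode es ∷ os) (_ , we , wo) lt = cong₂ (λ a b → onode a ∷ b) (delEs-id es we (All.++⁻ˡ (labelsEs es) lt)) (delOs-id os wo (All.++⁻ʳ (labelsEs es) lt))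
      delEs-id [] _ _ = refl
      delEs-id (enode l cs ∷ es) (w , ws) (p ∷ lt) = trans (delEs-keep {enode l cs} {es} p)
        (cong₂ _∷_ (delE-id (enode l cs) w (p ∷ All.++⁻ˡ (labelsOs cs) lt)) (delEs-id es ws (All.++⁻ʳ (labelsOs cs) lt)))

      delOs-appendAt : ∀ cs → delOs cs ≡ cs → All (λ g → label g < N) (gcs cs) → All (λ cs' → delOs cs' ≡ cs) (appendAt N cs)
      delOs-appendAt [] _ _ = []
      delOs-appendAt (onode es ∷ os) eq lt =
        trans (cong (λ z → onode z ∷ delOs os) (delEs-snoc es (All.++⁻ˡ es lt))) eq
        ∷ All.map⁺ (All.map (cong₂ _∷_ (∷-injectiveˡ eq)) (delOs-appendAt os (∷-injectiveʳ eq) (All.++⁻ʳ es lt)))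

      delOs-slots : ∀ cs → delOs cs ≡ cs → delOs (slots k cs) ≡ slots k cs
      delOs-slots [] _ = delOs-replicate k
      delOs-slots (c ∷ cs) eq = eq

      delE-insE : ∀ e → WfE k e → All (_< N) (labelsE e) → All (λ e' → delE e' ≡ e) (insE k N e)
      delOs-insOs : ∀ cs → WfOs k cs → All (_< N) (labelsOs cs) → All (λ cs' → delOs cs' ≡ cs) (insOs k N cs)
      delEs-insEs : ∀ es → WfEs k es → All (_< N) (labelsEs es) → All (λ es' → delEs es' ≡ es) (insEs k N es)
      delE-insE (enode l cs) (sh , _ , w) (_ ∷ lt) = All.++⁺
        (All.map⁺ (All.map (λ eq → cong (enode l) (trans (cong prune eq) (prune-slots k cs sh)))
          (delOs-appendAt (slots k cs) (delOs-slots cs (delOs-id cs w lt)) (subst (All _) (sym (gcs-slots k cs)) (label∈ cs lt)))))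
        (All.map⁺ (All.map (λ eq → cong (enode l) (trans (cong prune eq) (prune-pruned k cs sh))) (delOs-insOs cs w lt)))
      delOs-insOs [] _ _ = []
      delOs-insOs (onode es ∷ os) (_ , we , wo) lt = All.++⁺
        (All.map⁺ (All.map (λ eq → cong₂ (λ a b → onode a ∷ b) eq (delOs-id os wo (All.++⁻ʳ (labelsEs es) lt))) (delEs-insEs es we (All.++⁻ˡ (labelsEs es) lt))))
        (All.map⁺ (All.map (cong₂ (λ a b → onode a ∷ b) (delEs-id es we (All.++⁻ˡ (labelsEs es) lt))) (delOs-insOs os wo (All.++⁻ʳ (labelsEs es) lt))))
      delEs-insEs [] _ _ = []
      delEs-insEs (e@(enode l cs) ∷ es) (w , ws) (p ∷ lt) = All.++⁺
        (All.map⁺ (All.tabulate λ {e'} i → trans (delEs-keep {e'} {es} (subst (_< N) (sym (All.lookup (insE-label k N e) i)) p))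
          (cong₂ _∷_ (All.lookup (delE-insE e w (p ∷ All.++⁻ˡ (labelsOs cs) lt)) i) (delEs-id es ws (All.++⁻ʳ (labelsOs cs) lt)))))
        (All.map⁺ (All.map (λ {es'} eq → trans (delEs-keep {e} {es'} p)
          (cong₂ _∷_ (delE-id e w (p ∷ All.++⁻ˡ (labelsOs cs) lt)) eq)) (delEs-insEs es ws (All.++⁻ʳ (labelsOs cs) lt))))

      delEs-insF : ∀ F → WfEs k F → All (_< N) (labelsEs F) → All (λ G → delEs G ≡ F) (insF k N F)
      delEs-insF F w lt = trans (delEs-snoc F (label∈Es F lt)) (delEs-id F w lt) ∷ delEs-insEs F w lt

  longer : ∀ {N : ℕ} {xs} → ¬ (xs ↭ N ∷ xs)
  longer p = m≢1+m+n _ (trans (↭-length p) (sym (+-identityʳ _)))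

  tot-one-skel : ∀ cs → tot (λ _ → 1) cs ≡ length (concat (skel cs))
  tot-one-skel [] = refl
  tot-one-skel (onode es ∷ os) = trans (cong₂ _+_ (ones es) (tot-one-skel os)) (sym (length-++ (map label es)))
    where
    ones : ∀ es → Σl es (λ _ → 1) ≡ length (map label es)
    ones [] = refl
    ones (e ∷ es) = cong suc (ones es)

  module _ (k N : ℕ) where
    enode-injective : ∀ {l cs cs'} → enode l cs ≡ enode l cs' → cs ≡ cs'
    enode-injective refl = refl

    onode-injective : ∀ {es es'} → onode es ≡ onode es' → es ≡ es'
    onode-injective refl = refl

    appendAt-unique : ∀ cs → Unique (appendAt N cs)
    appendAt-unique [] = []
    appendAt-unique (onode es ∷ os) = All.tabulate (λ i eq → absurd (∈-map⁻ (onode es ∷_) i) eq) ∷ Unique.map⁺ ∷-injectiveʳ (appendAt-unique os)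
      where
      absurd : ∀ {cs'} → (Σ _ λ os' → os' ∈ appendAt N os × cs' ≡ onode es ∷ os') → onode (es ++ leaf N ∷ []) ∷ os ≡ cs' → ⊥
      absurd (os' , _ , refl) eq = longer (subst (_↭ N ∷ labelsEs es) (cong labelsEs (onode-injective (∷-injectiveˡ eq))) (labels-snoc N es))

    -- The concatenated lists are disjoint: a direct insertion changes the number of grand children
    -- of the node and a deeper one does not; in `insOs` and `insEs` the part that receives `N` has
    -- one label more.
    insE-unique : ∀ e → Unique (insE k N e)
    insOs-unique : ∀ cs → Unique (insOs k N cs)
    insEs-unique : ∀ es → Unique (insEs k N es)
    insE-unique (enode l []) = Unique.++⁺ (Unique.map⁺ enode-injective (appendAt-unique (slots k []))) [] λ { (_ , ()) }
    insE-unique (enode l cs@(_ ∷ _)) = Unique.++⁺ (Unique.map⁺ enode-injective (appendAt-unique cs)) (Unique.map⁺ enode-injective (insOs-unique cs))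
      λ { (i , i') → absurd (∈-map⁻ (enode l) i) (∈-map⁻ (enode l) i') }
      where
      absurd : ∀ {e'} → (Σ _ λ cs' → cs' ∈ appendAt N cs × e' ≡ enode l cs') → (Σ _ λ cs' → cs' ∈ insOs k N cs × e' ≡ enode l cs') → ⊥
      absurd (cs' , i , refl) (_ , i' , refl) = m≢1+m+n _ (trans
        (trans (tot-one-skel cs) (trans (cong (λ z → length (concat z)) (sym (All.lookup (insOs-skel k N cs) i'))) (sym (tot-one-skel cs'))))
        (trans (All.lookup (tot-appendAt N (λ _ → 1) cs) i) (sym (+-identityʳ _))))
    insOs-unique [] = []
    insOs-unique (onode es ∷ os) = Unique.++⁺ (Unique.map⁺ (onode-injective ∘ ∷-injectiveˡ) (insEs-unique es)) (Unique.map⁺ ∷-injectiveʳ (insOs-unique os))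
      λ { (i , i') → absurd (∈-map⁻ (λ es' → onode es' ∷ os) i) (∈-map⁻ (onode es ∷_) i') }
      where
      absurd : ∀ {cs'} → (Σ _ λ es' → es' ∈ insEs k N es × cs' ≡ onode es' ∷ os) → (Σ _ λ os' → os' ∈ insOs k N os × cs' ≡ onode es ∷ os') → ⊥
      absurd (es' , i , refl) (os' , i' , refl) = longer (All.lookup (labels-insEs k N es) i)
    insEs-unique [] = []
    insEs-unique (e ∷ es) = Unique.++⁺ (Unique.map⁺ ∷-injectiveˡ (insE-unique e)) (Unique.map⁺ ∷-injectiveʳ (insEs-unique es))
      λ { (i , i') → absurd (∈-map⁻ (_∷ es) i) (∈-map⁻ (e ∷_) i') }
      where
      absurd : ∀ {es'} → (Σ _ λ e' → e' ∈ insE k N e × es' ≡ e' ∷ es) → (Σ _ λ es″ → es″ ∈ insEs k N es × es' ≡ e ∷ es″) → ⊥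
      absurd (e' , i , refl) (_ , i' , refl) = longer (All.lookup (labels-insE k N e) i)

    insF-unique : ∀ F → Unique (insF k N F)
    insF-unique F = All.map (λ eq₁ eq₂ → m≢1+m+n (length F) (trans (sym (length-map label F)) (trans (cong length (sym (trans (cong (map label) eq₂) eq₁)))
        (trans (length-map label (F ++ leaf N ∷ [])) (trans (length-++ F) (+-suc (length F) 0)))))) (insEs-labels k N F) ∷ insEs-unique F

  -- `d` recovers the source of each element, so the lists of distinct sources are disjoint.
  unique-concatMap : ∀ {A B : Set} (f : A → List B) (d : B → A) xs → Unique xs → All (λ x → Unique (f x)) xs →
    All (λ x → All (λ y → d y ≡ x) (f x)) xs → Unique (concatMap f xs)
  unique-concatMap f d [] _ _ _ = []
  unique-concatMap f d (x ∷ xs) (x∉ ∷ u) (ux ∷ us) (dx ∷ ds) = Unique.++⁺ ux (unique-concatMap f d xs u us ds)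
    λ { (i , i') → absurd i (All.lookup source i') }
    where
    source : All (λ y → Any.Any (d y ≡_) xs) (concatMap f xs)
    source = go xs ds
      where
      go : ∀ xs → All (λ x → All (λ y → d y ≡ x) (f x)) xs → All (λ y → Any.Any (d y ≡_) xs) (concatMap f xs)
      go [] [] = []
      go (x ∷ xs) (dx ∷ ds) = All.++⁺ (All.map here dx) (All.map there (go xs ds))
    absurd : ∀ {y} → y ∈ f x → Any.Any (d y ≡_) xs → ⊥
    absurd i m = All.lookup x∉ (subst (_∈ xs) (All.lookup dx i) m) refl

  gen : ℕ → ℕ → List Forest
  gen k zero = [] ∷ []
  gen k (suc n) = concatMap (insF k (suc n)) (gen k n)

  upTo-snoc : ∀ n → applyUpTo suc (suc n) ↭ suc n ∷ applyUpTo suc n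
  upTo-snoc n = ↭-trans (↭-reflexive (snoc suc n)) (↭-trans (shift (suc n) (applyUpTo suc n) []) (↭-reflexive (cong (suc n ∷_) (++-identityʳ _))))
    where
    snoc : ∀ (f : ℕ → ℕ) n → applyUpTo f (suc n) ≡ applyUpTo f n ++ f n ∷ []
    snoc f zero = refl
    snoc f (suc n) = cong (f 0 ∷_) (snoc (f ∘ suc) n)

  labels≤ : ∀ n k F → InF n k F → All (_≤ n) (labelsEs F)
  labels≤ n k F (_ , _ , p) = All-resp-↭ (↭-sym p) (All.applyUpTo⁺₁ suc n (λ lt → lt))

  labels< : ∀ n k F → InF n k F → All (_< suc n) (labelsEs F)
  labels< n k F i = All.map s≤s (labels≤ n k F i)

  gen-sound : ∀ k n → All (InF n k) (gen k n)
  gen-sound k zero = (tt , [] , ↭-refl) ∷ []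
  gen-sound k (suc n) = All.concat⁺ (All.map⁺ (All.map (λ {F} → step F) (gen-sound k n)))
    where
    step : ∀ F → InF n k F → All (InF (suc n) k) (insF k (suc n) F)
    step F i@(w , ln , p) = All.tabulate λ m → All.lookup (wf-insF k (suc n) F w (labels< n k F i)) m
      , All.lookup (linked-insF k (suc n) F ln (labels< n k F i)) m
      , ↭-trans (All.lookup (labels-insF k (suc n) F) m) (↭-trans (prep (suc n) p) (↭-sym (upTo-snoc n)))

  gen-unique : ∀ k n → Unique (gen k n)
  gen-unique k zero = [] ∷ []
  gen-unique k (suc n) = unique-concatMap (insF k (suc n)) (delEs (suc n)) (gen k n) (gen-unique k n)
    (All.universal (insF-unique k (suc n)) (gen k n))
    (All.map (λ {F} i → delEs-insF (suc n) k F (proj₁ i) (labels< n k F i)) (gen-sound k n))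

  gen-complete : ∀ k n F → InF n k F → F ∈ gen k n
  gen-complete k zero [] _ = here refl
  gen-complete k zero (enode l cs ∷ F) (_ , _ , p) with ↭-length p
  ... | ()
  gen-complete k (suc n) G i@(w , ln , p) = split (comp-Es k (suc n) G w ln (labels≤ (suc n) k G i) (∈-resp-↭ (↭-sym (↭-trans p (upTo-snoc n))) (here refl)))
    where
    gen-step : ∀ F → WfEs k F → Linked _<_ (map label F) → G ∈ insF k (suc n) F → G ∈ gen k (suc n)
    gen-step F w₀ ln₀ m = ∈-concatMap⁺ (insF k (suc n)) (Any.map (λ { refl → m }) (gen-complete k n F (w₀ , ln₀ ,
      drop-∷ (↭-trans (↭-sym (All.lookup (labels-insF k (suc n) F) m)) (↭-trans p (upTo-snoc n))))))
    split : (Σ Forest λ F → G ≡ F ++ leaf (suc n) ∷ []) ⊎ (Σ Forest λ F → WfEs k F × G ∈ insEs k (suc n) F) → G ∈ gen k (suc n)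
    split (inj₁ (F , eq)) = gen-step F (wf-++⁻ k F _ (subst (WfEs k) eq w))
      (linked-init (map label F) (subst (Linked _<_) (trans (cong (map label) eq) (map-++ label F (leaf (suc n) ∷ []))) ln)) (here eq)
    split (inj₂ (F , w₀ , m)) = gen-step F w₀ (subst (Linked _<_) (All.lookup (insEs-labels k (suc n) F) m) ln) (there m)

  unique-resp-⊆ : ∀ {A : Set} {xs ys : List A} → xs ⊆ ys → Unique ys → Unique xs
  unique-resp-⊆ [] [] = []
  unique-resp-⊆ (_ ∷ʳ p) (_ ∷ u) = unique-resp-⊆ p u
  unique-resp-⊆ (refl ∷ p) (a ∷ u) = Sublist.All-resp-⊆ p a ∷ unique-resp-⊆ p u

  unique-++ˡ : ∀ {A : Set} (xs : List A) {ys} → Unique (xs ++ ys) → Unique xs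
  unique-++ˡ xs {ys} = unique-resp-⊆ (Sublist.++⁺ʳ ys ⊆-refl)

  unique-++ʳ : ∀ {A : Set} (xs : List A) {ys} → Unique (xs ++ ys) → Unique ys
  unique-++ʳ xs = unique-resp-⊆ (Sublist.++⁺ˡ xs ⊆-refl)

  roots⊆ : ∀ es → map label es ⊆ labelsEs es
  roots⊆ [] = []
  roots⊆ (enode l cs ∷ es) = refl ∷ Sublist.++⁺ˡ (labelsOs cs) (roots⊆ es)

  grandchildren⊆ : ∀ cs → map label (gcs cs) ⊆ labelsOs cs
  grandchildren⊆ [] = []
  grandchildren⊆ (onode es ∷ os) = subst (_⊆ (labelsEs es ++ labelsOs os)) (sym (map-++ label es (gcs os))) (Sublist.++⁺ (roots⊆ es) (grandchildren⊆ os))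

  ∧-true⁻ : ∀ a {b} → a ∧ b ≡ true → a ≡ true × b ≡ true
  ∧-true⁻ true e = refl , e

  all-true⁻ : ∀ {A : Set} (q : A → Bool) xs → all q xs ≡ true → All (λ x → q x ≡ true) xs
  all-true⁻ q [] _ = []
  all-true⁻ q (x ∷ xs) e = proj₁ (∧-true⁻ (q x) e) ∷ all-true⁻ q xs (proj₂ (∧-true⁻ (q x) e))

  ≤ᵇ-true⁻ : ∀ {m n} → (m ≤ᵇ n) ≡ true → m ≤ n
  ≤ᵇ-true⁻ {m} {n} e = ≤ᵇ⇒≤ m n (Equivalence.from T-≡ e)

  isMax⁻ : ∀ cs {m} → isMax (skel cs) m ≡ true → All (λ g → label g ≤ m) (gcs cs)
  isMax⁻ cs {m} e = skel-All⁻ {_≤ m} cs (All.map ≤ᵇ-true⁻ (all-true⁻ (_≤ᵇ m) _ e))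

  -- Two counted leaves would bound each other's labels, hence share a label.
  leafCount≤1 : ∀ p gs → Unique (map label gs) → All (λ g → p (label g) ≡ true → All (λ h → label h ≤ label g) gs) gs → leafCount p gs ≤ 1
  leafCount≤1 p [] _ _ = z≤n
  leafCount≤1 p (g ∷ gs) (g∉ ∷ u) (mg ∷ mgs) with isLeaf g ∧ p (label g) in eq
  ... | false = leafCount≤1 p gs u (All.map (λ f e → All.tail (f e)) mgs)
  ... | true = ≤-reflexive (cong suc (leafCount-zero p (All.tabulate others)))
    where
    pg = proj₂ (∧-true⁻ (isLeaf g) eq)
    others : ∀ {h} → h ∈ gs → p (label h) ≡ false
    others {h} i with p (label h) in ph
    ... | false = refl
    ... | true = ⊥-elim (All.lookup (All.map⁻ g∉) i (≤-antisym (All.head (All.lookup mgs i ph)) (All.lookup (All.tail (mg pg)) i)))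

  oldN≤1 : ∀ l cs → Unique (labelsOs cs) → oldN (enode l cs) ≤ 1
  oldN≤1 l cs u = leafCount≤1 (isMax (skel cs)) (gcs cs) (unique-resp-⊆ (grandchildren⊆ cs) u) (All.universal (λ g → isMax⁻ cs) (gcs cs))

  module _ (k N : ℕ) where
    goodE : ∀ e → WfE k e → Unique (labelsE e) → All (_< N) (labelsE e) → GoodE k N e
    goodOs : ∀ cs → WfOs k cs → Unique (labelsOs cs) → All (_< N) (labelsOs cs) → GoodOs k N cs
    goodEs : ∀ es → WfEs k es → Unique (labelsEs es) → All (_< N) (labelsEs es) → GoodEs k N es
    goodE (enode l cs) (sh , _ , w) (_ ∷ u) (_ ∷ lt) = oldN≤1 l cs u , slots-length k cs sh , label∈ cs lt , goodOs cs w u lt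
    goodOs [] _ _ _ = tt
    goodOs (onode es ∷ os) (_ , we , wo) u lt = goodEs es we (unique-++ˡ (labelsEs es) u) (All.++⁻ˡ (labelsEs es) lt)
      , goodOs os wo (unique-++ʳ (labelsEs es) u) (All.++⁻ʳ (labelsEs es) lt)
    goodEs [] _ _ _ = tt
    goodEs (e ∷ es) (w , ws) u lt = goodE e w (unique-++ˡ (labelsE e) u) (All.++⁻ˡ (labelsE e) lt)
      , goodEs es ws (unique-++ʳ (labelsE e) u) (All.++⁻ʳ (labelsE e) lt)

  unique-labels : ∀ n k F → InF n k F → Unique (labelsEs F)
  unique-labels n k F (_ , _ , p) = PermS.Unique-resp-↭ (setoid ℕ) (↭⇒↭ₛ (↭-sym p)) (Unique.applyUpTo⁺₁ suc n (λ i<j _ e → <⇒≢ i<j (suc-injective e)))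

  goodF : ∀ n k F → InF n k F → GoodEs k (suc n) F
  goodF n k F i = goodEs k (suc n) F (proj₁ i) (unique-labels n k F i) (labels< n k F i)

  -- Node counts.

  OV+YV : ∀ p e → OV p e + YV p e ≡ LV e
  OV+YV-Os : ∀ p cs → tot (OV p) cs + tot (YV p) cs ≡ tot LV cs
  OV+YV-Es : ∀ p es → Σl es (OV p) + Σl es (YV p) ≡ Σl es LV
  OV+YV p (enode l []) with p l
  ... | true = refl
  ... | false = refl
  OV+YV p (enode l (c ∷ cs)) = trans (cong₂ _+_ (OV-node p l c cs) (YV-node p l c cs)) (trans (OV+YV-Os (isMax (skel (c ∷ cs))) (c ∷ cs)) (sym (LV-node l c cs)))
  OV+YV-Os p [] = refl
  OV+YV-Os p (onode es ∷ os) = trans (+-interchange (Σl es (OV p)) _ _ _) (cong₂ _+_ (OV+YV-Es p es) (OV+YV-Os p os))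
  OV+YV-Es p [] = refl
  OV+YV-Es p (e ∷ es) = trans (+-interchange (OV p e) _ _ _) (cong₂ _+_ (OV+YV p e) (OV+YV-Es p es))

  -- Σ over the subtree of (leaf) + (owner of an old leaf) + (other internal node) counts every node once.
  LBC : ETree → ℕ
  LBC e = LV e + (BV e + CV e)

  complement : ∀ m → m ≤ 1 → m + (1 ∸ m) ≡ 1
  complement m le = m+[n∸m]≡n le

  tot-LBC : ∀ cs → tot LBC cs ≡ tot LV cs + (tot BV cs + tot CV cs)
  tot-LBC cs = trans (tot-+ LV (λ e → BV e + CV e) cs) (cong (tot LV cs +_) (tot-+ BV CV cs))

  private
    spread : ∀ l m b r c → l + ((m + b) + (r + c)) ≡ (m + r) + (l + (b + c))
    spread = solve-∀

  module _ (k N : ℕ) where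
    LBC-E : ∀ e → GoodE k N e → LBC e ≡ length (labelsE e)
    LBC-Os : ∀ cs → GoodOs k N cs → tot LBC cs ≡ length (labelsOs cs)
    LBC-Es : ∀ es → GoodEs k N es → Σl es LBC ≡ length (labelsEs es)
    LBC-E (enode l []) _ = refl
    LBC-E e@(enode l cs@(c ∷ cs₀)) (le , _ , _ , g) = begin
        LV e + (BV e + CV e)
      ≡⟨ cong₂ _+_ (LV-node l c cs₀) (cong₂ _+_ (cong (oldN e +_) (sumOs-tot oldN cs)) (cong ((1 ∸ oldN e) +_) (sumOs-tot restN cs))) ⟩
        tot LV cs + ((oldN e + tot BV cs) + ((1 ∸ oldN e) + tot CV cs))
      ≡⟨ spread (tot LV cs) (oldN e) (tot BV cs) (1 ∸ oldN e) (tot CV cs) ⟩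
        (oldN e + (1 ∸ oldN e)) + (tot LV cs + (tot BV cs + tot CV cs))
      ≡⟨ cong₂ _+_ (complement (oldN e) le) (trans (sym (tot-LBC cs)) (LBC-Os cs g)) ⟩
        suc (length (labelsOs cs)) ∎
    LBC-Os [] _ = refl
    LBC-Os (onode es ∷ os) (ge , go) = trans (cong₂ _+_ (LBC-Es es ge) (LBC-Os os go)) (sym (length-++ (labelsEs es)))
    LBC-Es [] _ = refl
    LBC-Es (e ∷ es) (g , gs) = trans (cong₂ _+_ (LBC-E e g) (LBC-Es es gs)) (sym (length-++ (labelsE e)))

  -- The size of a forest and the statistics of the theorem in terms of the state.

  module ForestStatistics (j : ℕ) where
    open Root j public

    FO+FY : ∀ F → FO F + FY F ≡ FL F
    FO+FY [] = refl
    FO+FY (enode l cs ∷ ts) = trans (+-interchange (RO (nx ts) (enode l cs)) _ _ _) (cong₂ _+_ (OV+YV-Os (pR (nx ts) (skel cs)) cs) (FO+FY ts))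

    root-size : ∀ N nxt t → GoodE k N t → RL t + (RO nxt t + RC nxt t) ≡ length (labelsE t)
    root-size N nxt (enode l cs) good@(_ , _ , _ , g) = begin
        tot LV cs + (tot (OV p) cs + ((1 ∸ m) + tot CV cs))
      ≡⟨ cong (λ z → tot LV cs + (z + ((1 ∸ m) + tot CV cs))) (tot-OV p cs) ⟩
        tot LV cs + ((m + tot BV cs) + ((1 ∸ m) + tot CV cs))
      ≡⟨ spread (tot LV cs) m (tot BV cs) (1 ∸ m) (tot CV cs) ⟩
        (m + (1 ∸ m)) + (tot LV cs + (tot BV cs + tot CV cs))
      ≡⟨ cong₂ _+_ (complement m (pR≤1 nxt l cs good)) (trans (sym (tot-LBC cs)) (LBC-Os k N cs g)) ⟩
        suc (length (labelsOs cs)) ∎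
      where
      p = pR nxt (skel cs)
      m = leafCount p (gcs cs)

    -- The summand `b2n (barT t)` stands for the root that `lastC` leaves out.
    last-size : ∀ N t → GoodE k N t → (RL t + (RO nothing t + lastC t)) + b2n (barT t) ≡ length (labelsE t)
    last-size N t@(enode l cs) good@(_ , _ , _ , g) = go (firstOf j (skel cs)) refl
      where
      go : ∀ b → firstOf j (skel cs) ≡ b → (tot LV cs + (RO nothing t + (if b then tot CV cs else RC nothing t))) + b2n b ≡ suc (length (labelsOs cs))
      go false eq = trans (+-identityʳ _) (root-size N nothing t good)
      go true eq = trans (+-comm _ 1) (cong suc (trans (cong (λ z → tot LV cs + (z + tot CV cs)) noOld) (trans (sym (tot-LBC cs)) (LBC-Os k N cs g))))
        where
        noOld : RO nothing t ≡ tot BV cs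
        noOld = trans (tot-OV (pR nothing (skel cs)) cs) (cong (_+ tot BV cs)
          (leafCount-zero (pR nothing (skel cs)) (All.universal (λ h → cong (λ z → not (z ∧ true) ∧ isMax (skel cs) (label h)) eq) (gcs cs))))

    forest-size : ∀ N F → GoodEs k N F → (FL F + (FO F + FC F)) + b2n (bar F) ≡ length (labelsEs F)
    forest-size N [] _ = refl
    forest-size N (t ∷ []) (g , _) = trans (cong (_+ b2n (barT t)) (cong₂ (λ a b → a + (b + lastC t)) (+-identityʳ (RL t)) (+-identityʳ (RO nothing t))))
      (trans (last-size N t g) (trans (sym (+-identityʳ _)) (sym (length-++ (labelsE t)))))
    forest-size N (t ∷ F@(t₂ ∷ ts)) (g , gs) = trans (rearrange (RL t) (FL F) (RO r t) (FO F) (RC r t) (FC F) (b2n (bar F)))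
      (trans (cong₂ _+_ (root-size N r t g) (forest-size N F gs)) (sym (length-++ (labelsE t))))
      where
      r = just (label t₂)
      rearrange : ∀ a b c d e f x → ((a + b) + ((c + d) + (e + f))) + x ≡ (a + (c + e)) + ((b + (d + f)) + x)
      rearrange = solve-∀

    bar-snoc : ∀ N F → bar (F ++ leaf N ∷ []) ≡ true
    bar-snoc N [] = firstOf-[] j
    bar-snoc N (t ∷ []) = bar-snoc N []
    bar-snoc N (t ∷ t' ∷ ts) = bar-snoc N (t' ∷ ts)

    FL-snoc : ∀ N F → FL (F ++ leaf N ∷ []) ≡ FL F
    FL-snoc N [] = refl
    FL-snoc N (t ∷ ts) = cong (RL t +_) (FL-snoc N ts)

    -- Only the formerly last tree gets a new next root, `N` in place of `nothing`. All its labels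
    -- are smaller than `N`, so `below` holds in both cases.
    FO-snoc : ∀ N F → All (_< N) (labelsEs F) → FO (F ++ leaf N ∷ []) ≡ FO F
    FO-snoc N [] _ = refl
    FO-snoc N (t ∷ t' ∷ ts) lt = cong (RO (just (label t')) t +_) (FO-snoc N (t' ∷ ts) (All.++⁻ʳ (labelsE t) lt))
    FO-snoc N (enode l cs ∷ []) (_ ∷ lt) = cong (_+ 0) (tot-cong cs λ e →
      cong (λ z → b2n (isLeaf e ∧ (not (firstOf j (skel cs) ∧ z) ∧ isMax (skel cs) (label e))) + sumE oldN e) under)
      where
      under : below (just N) (skel cs) ≡ true
      under = all-true (λ l → suc l ≤ᵇ N) (All.map ≤ᵇ-true (skel-All {_< N} cs (label∈ cs (All.++⁻ˡ (labelsOs cs) lt))))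

    insF-sum : ∀ n F → InF n k F → (f : Bool → ℕ → ℕ → ℕ) →
      Σl (insF k (suc n) F) (λ G → f (bar G) (FO G) (FL G)) ≡ f true (FO F) (FL F) + TF (bar F) f (FO F) (FL F) (FY F) (FC F)
    insF-sum n F i f = cong₂ _+_
      (cong₃ f (bar-snoc (suc n) F) (FO-snoc (suc n) F (labels< n k F i)) (FL-snoc (suc n) F))
      (forest-sum (suc n) f F (goodF n k F i) (label∈Es F (labels< n k F i)))
      where
      cong₃ : ∀ (f : Bool → ℕ → ℕ → ℕ) {a a' b b' c c'} → a ≡ a' → b ≡ b' → c ≡ c' → f a b c ≡ f a' b' c'
      cong₃ f refl refl refl = refl

    -- A labelled node is a non-root leaf, the owner of a counted old leaf, a node of the fourth
    -- class or the exceptional root. So `FC` is determined by `n`, O, L and the kind of the forest.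
    size : ∀ n F → InF n k F → (FL F + (FO F + FC F)) + b2n (bar F) ≡ n
    size n F i@(_ , _ , p) = trans (forest-size (suc n) F (goodF n k F i)) (trans (↭-length p) (length-applyUpTo suc n))

    firstLeaves-skel : ∀ m cs → all isOLeaf (take m cs) ≡ firstOf m (skel cs)
    firstLeaves-skel zero cs = refl
    firstLeaves-skel (suc m) [] = refl
    firstLeaves-skel (suc m) (onode [] ∷ cs) = firstLeaves-skel m cs
    firstLeaves-skel (suc m) (onode (_ ∷ _) ∷ cs) = refl

    isBar≡bar : ∀ F → isBar k F ≡ bar F
    isBar≡bar F = trans (unfold F) (lst F)
      where
      barLast : Maybe ETree → Bool
      barLast nothing = false
      barLast (just t) = isLeaf t ∨ firstLeaves k t
      unfold : ∀ F → isBar k F ≡ barLast (last F)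
      unfold F with last F
      ... | nothing = refl
      ... | just t = refl
      one : ∀ t → isLeaf t ∨ firstLeaves k t ≡ barT t
      one (enode l []) = sym (firstOf-[] j)
      one (enode l (c ∷ cs)) = firstLeaves-skel j (c ∷ cs)
      lst : ∀ F → barLast (last F) ≡ bar F
      lst [] = refl
      lst (t ∷ []) = one t
      lst (t ∷ t' ∷ ts) = lst (t' ∷ ts)

    leafN-b2n : ∀ t → leafN t ≡ b2n (isLeaf t)
    leafN-b2n (enode l []) = refl
    leafN-b2n (enode l (_ ∷ _)) = refl

    ≟-true : ∀ b → does (b Bool.≟ true) ≡ b
    ≟-true true = refl
    ≟-true false = refl

    filter-count : ∀ {A : Set} (q : A → Bool) xs → length (filter (λ x → q x Bool.≟ true) xs) ≡ Σl xs (λ x → b2n (q x))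
    filter-count q xs = trans (length-filter (λ x → q x Bool.≟ true) xs) (Σl-cong xs (λ x → cong b2n (≟-true (q x))))

    -- A root is a leaf exactly when its tree is a singleton. Hence the truncated subtraction is
    -- exact.
    lleaf-si : ∀ F → lleaf F ∸ si F ≡ FL F
    lleaf-si F = trans (cong (_∸ si F) (trans (leaves F) (cong (FL F +_) (sym (filter-count isLeaf F))))) (m+n∸n≡m (FL F) (si F))
      where
      lem : ∀ a b c d → (a + b) + (c + d) ≡ (b + c) + (a + d)
      lem = solve-∀
      leaves : ∀ F → sumEs leafN F ≡ FL F + Σl F (λ t → b2n (isLeaf t))
      leaves [] = refl
      leaves (enode l cs ∷ ts) = trans (cong₂ _+_ (cong₂ _+_ (leafN-b2n (enode l cs)) (sumOs-tot leafN cs)) (leaves ts))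
        (lem (b2n (isLeaf (enode l cs))) (tot LV cs) (FL ts) _)

    all-gcs : ∀ q cs → all (λ h → q (label h)) (gcs cs) ≡ all q (concat (skel cs))
    all-gcs q [] = refl
    all-gcs q (onode es ∷ os) = trans (all-++ (λ h → q (label h)) es (gcs os)) (trans (cong₂ _∧_ (all-labels es) (all-gcs q os)) (sym (all-++ q (map label es) (concat (skel os)))))
      where
      all-labels : ∀ es → all (λ h → q (label h)) es ≡ all q (map label es)
      all-labels [] = refl
      all-labels (e ∷ es) = cong (q (label e) ∧_) (all-labels es)

    isOld-isMax : ∀ l cs g → isOld (enode l cs) g ≡ isMax (skel cs) (label g)
    isOld-isMax l cs g = all-gcs (_≤ᵇ label g) cs

    sumE-cong : ∀ {f g : ETree → ℕ} → (∀ u → f u ≡ g u) → ∀ e → sumE f e ≡ sumE g e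
    sumOs-cong : ∀ {f g : ETree → ℕ} → (∀ u → f u ≡ g u) → ∀ cs → sumOs f cs ≡ sumOs g cs
    sumEs-cong : ∀ {f g : ETree → ℕ} → (∀ u → f u ≡ g u) → ∀ es → sumEs f es ≡ sumEs g es
    sumE-cong h (enode l cs) = cong₂ _+_ (h (enode l cs)) (sumOs-cong h cs)
    sumOs-cong h [] = refl
    sumOs-cong h (onode es ∷ os) = cong₂ _+_ (sumEs-cong h es) (sumOs-cong h os)
    sumEs-cong h [] = refl
    sumEs-cong h (e ∷ es) = cong₂ _+_ (sumE-cong h e) (sumEs-cong h es)

    oldLeaves-oldN : ∀ F → oldLeaves F ≡ sumEs oldN F
    oldLeaves-oldN = sumEs-cong each
      where
      each : ∀ u → length (filter (λ g → (isLeaf g ∧ isOld u g) Bool.≟ true) (grandchildren u)) ≡ oldN u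
      each u@(enode l cs) = trans (filter-count (λ g → isLeaf g ∧ isOld u g) (gcs cs)) (Σl-cong (gcs cs) (λ g → cong (λ z → b2n (isLeaf g ∧ z)) (isOld-isMax l cs g)))

    youngLeaves-youngN : ∀ F → youngLeaves F ≡ sumEs youngN F
    youngLeaves-youngN = sumEs-cong each
      where
      each : ∀ u → length (filter (λ g → (isLeaf g ∧ not (isOld u g)) Bool.≟ true) (grandchildren u)) ≡ youngN u
      each u@(enode l cs) = trans (filter-count (λ g → isLeaf g ∧ not (isOld u g)) (gcs cs)) (Σl-cong (gcs cs) (λ g → cong (λ z → b2n (isLeaf g ∧ not z)) (isOld-isMax l cs g)))

    old+young : ∀ F → sumEs oldN F + sumEs youngN F ≡ FL F
    old+young [] = refl
    old+young (enode l cs ∷ ts) = trans (+-interchange (sumE oldN (enode l cs)) _ _ _) (cong₂ _+_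
      (trans (cong₂ _+_ (trans (cong (oldN (enode l cs) +_) (sumOs-tot oldN cs)) (sym (tot-OV (isMax (skel cs)) cs)))
                        (trans (cong (youngN (enode l cs) +_) (sumOs-tot youngN cs)) (sym (tot-YV (isMax (skel cs)) cs))))
             (OV+YV-Os (isMax (skel cs)) cs))
      (old+young ts))

    -- The old leaves that `RO` leaves out. Removability demands in addition that the old leaf be
    -- the only leaf among the grand children; the two notions agree once there are no young leaves.
    RR : Maybe ℕ → ETree → ℕ
    RR nxt (enode l cs) = if firstOf j (skel cs) ∧ below nxt (skel cs) then oldN (enode l cs) else 0

    FR : Forest → ℕ
    FR [] = 0
    FR (t ∷ ts) = RR (nx ts) t + FR ts

    FO+FR : ∀ F → FO F + FR F ≡ sumEs oldN F
    FO+FR [] = refl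
    FO+FR (t@(enode l cs) ∷ ts) = trans (+-interchange (RO (nx ts) t) _ _ _) (cong₂ _+_ one (FO+FR ts))
      where
      lem : ∀ a b c → (a + b) + c ≡ (a + c) + b
      lem = solve-∀
      pick : ∀ b → leafCount (λ m → not b ∧ isMax (skel cs) m) (gcs cs) + (if b then oldN t else 0) ≡ oldN t
      pick true = cong (_+ oldN t) (leafCount-zero (λ _ → false) (All.universal (λ _ → refl) (gcs cs)))
      pick false = +-identityʳ _
      one : RO (nx ts) t + RR (nx ts) t ≡ sumE oldN t
      one = trans (cong (_+ RR (nx ts) t) (tot-OV (pR (nx ts) (skel cs)) cs)) (trans (lem (leafCount (pR (nx ts) (skel cs)) (gcs cs)) (tot BV cs) (RR (nx ts) t))
        (cong₂ _+_ (pick (firstOf j (skel cs) ∧ below (nx ts) (skel cs))) (sym (sumOs-tot oldN cs))))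

    any-false : ∀ {A : Set} (q : A → Bool) {xs} → All (λ x → q x ≡ false) xs → any q xs ≡ false
    any-false q [] = refl
    any-false q (e ∷ es) = cong₂ _∨_ e (any-false q es)

    any-true : ∀ {A : Set} (q : A → Bool) {x xs} → x ∈ xs → q x ≡ true → any q xs ≡ true
    any-true q {xs = x ∷ xs} (here refl) e = cong (_∨ any q xs) e
    any-true q {x} {y ∷ xs} (there i) e = trans (cong (q y ∨_) (any-true q i e)) (∨-zeroʳ (q y))

    leafCount-pos : ∀ p gs → leafCount p gs ≢ 0 → Σ ETree λ g → g ∈ gs × (isLeaf g ∧ p (label g)) ≡ true
    leafCount-pos p [] ne = ⊥-elim (ne refl)
    leafCount-pos p (g ∷ gs) ne with isLeaf g ∧ p (label g) in eq
    ... | true = g , here refl , eq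
    ... | false with leafCount-pos p gs ne
    ...   | h , i , e = h , there i , e

    leafCount-zero⁻ : ∀ p {gs} → leafCount p gs ≡ 0 → All (λ g → (isLeaf g ∧ p (label g)) ≡ false) gs
    leafCount-zero⁻ p {[]} _ = []
    leafCount-zero⁻ p {g ∷ gs} e with isLeaf g ∧ p (label g) in eq
    ... | false = eq ∷ leafCount-zero⁻ p e

    below-label : ∀ nxt cs {m} → All (λ g → label g ≤ m) (gcs cs) → ∀ u → label u ≡ m → belowNext nxt u ≡ true → below nxt (skel cs) ≡ true
    below-label nothing cs le u eq e = refl
    below-label (just r) cs {m} le u refl e = all-true (λ l → suc l ≤ᵇ r) (All.map (λ q → ≤ᵇ-true (≤-<-trans q (≤ᵇ-true⁻ {suc m} {r} e))) (skel-All {_≤ m} cs le))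

    below-belowNext : ∀ nxt cs {u} → u ∈ gcs cs → below nxt (skel cs) ≡ true → belowNext nxt u ≡ true
    below-belowNext nothing cs i e = refl
    below-belowNext (just r) cs i e = All.lookup (all-true⁻ (λ h → suc (label h) ≤ᵇ r) (gcs cs) (trans (all-gcs (λ l → suc l ≤ᵇ r) cs) e)) i

    -- A removable old leaf has the greatest label among the grand children, so condition (3) for it
    -- implies `below`, and `RR` would count it.
    removableT-false : ∀ nxt t → RR nxt t ≡ 0 → hasRemovableT k t nxt ≡ false
    removableT-false nxt t@(enode l cs) rr = any-false _ (All.tabulate each)
      where
      cnt = length (filter (λ g → isLeaf g Bool.≟ true) (grandchildren t)) ≡ᵇ 1
      each : ∀ {u} → u ∈ gcs cs → (isLeaf u ∧ isOld t u ∧ cnt ∧ firstLeaves k t ∧ belowNext nxt u) ≡ false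
      each {u} i with isLeaf u in lf
      ... | false = refl
      ... | true with isOld t u in old
      ...   | false = refl
      ...   | true with cnt
      ...     | false = refl
      ...     | true with firstLeaves k t in fl
      ...       | false = refl
      ...       | true with belowNext nxt u in bn
      ...         | false = refl
      ...         | true = ⊥-elim (contra (trans (sym (cong₂ _∧_ lf mx)) (All.lookup (leafCount-zero⁻ (isMax (skel cs)) {gcs cs} old0) i)))
        where
        contra : true ≡ false → ⊥
        contra ()
        mx : isMax (skel cs) (label u) ≡ true
        mx = trans (sym (isOld-isMax l cs u)) old
        cond : (firstOf j (skel cs) ∧ below nxt (skel cs)) ≡ true
        cond = cong₂ _∧_ (trans (sym (firstLeaves-skel j cs)) fl) (below-label nxt cs (isMax⁻ cs mx) u refl bn)
        old0 : oldN t ≡ 0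
        old0 = trans (sym (cong (λ z → if z then oldN t else 0) cond)) rr

    -- Without young leaves an old leaf is the only leaf among the grand children, which is what
    -- condition (1) asks; the other conditions are those under which `RR` counts.
    removableT-none : ∀ nxt t → oldN t ≤ 1 → youngN t ≡ 0 → hasRemovableT k t nxt ≡ false → RR nxt t ≡ 0
    removableT-none nxt t@(enode l cs) le y0 nr with firstOf j (skel cs) ∧ below nxt (skel cs) in cond
    ... | false = refl
    ... | true with oldN t in o
    ...   | zero = refl
    ...   | suc (suc m) = ⊥-elim (<⇒≱ (s≤s (s≤s z≤n)) le)
    ...   | suc zero with leafCount-pos (isMax (skel cs)) (gcs cs) (λ e → 1≢0 (trans (sym o) e))
      where
      1≢0 : 1 ≡ 0 → ⊥
      1≢0 ()
    ...     | u , i , e = ⊥-elim (contra (trans (sym nr) (any-true _ i good)))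
      where
      contra : false ≡ true → ⊥
      contra ()
      old-or-young : ∀ p gs → Σl gs (λ g → b2n (isLeaf g)) ≡ leafCount p gs + leafCount (not ∘ p) gs
      old-or-young p gs = trans (Σl-cong gs (λ g → cases (isLeaf g) (p (label g)))) (Σl-+ gs (λ g → b2n (isLeaf g ∧ p (label g))) (λ g → b2n (isLeaf g ∧ not (p (label g)))))
        where
        cases : ∀ a b → b2n a ≡ b2n (a ∧ b) + b2n (a ∧ not b)
        cases false b = refl
        cases true true = refl
        cases true false = refl
      single : (length (filter (λ g → isLeaf g Bool.≟ true) (grandchildren t)) ≡ᵇ 1) ≡ true
      single = cong (_≡ᵇ 1) (trans (filter-count isLeaf (gcs cs)) (trans (old-or-young (isMax (skel cs)) (gcs cs)) (cong₂ _+_ o y0)))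
      good : (isLeaf u ∧ isOld t u ∧ (length (filter (λ g → isLeaf g Bool.≟ true) (grandchildren t)) ≡ᵇ 1) ∧ firstLeaves k t ∧ belowNext nxt u) ≡ true
      good = cong₂ _∧_ (proj₁ (∧-true⁻ (isLeaf u) e)) (cong₂ _∧_ (trans (isOld-isMax l cs u) (proj₂ (∧-true⁻ (isLeaf u) e)))
        (cong₂ _∧_ single (cong₂ _∧_ (trans (firstLeaves-skel j cs) (proj₁ (∧-true⁻ (firstOf j (skel cs)) cond)))
          (below-belowNext nxt cs i (proj₂ (∧-true⁻ (firstOf j (skel cs)) cond))))))

    hasRemovable-step : ∀ t ts → hasRemovable k (t ∷ ts) ≡ hasRemovableT k t (nx ts) ∨ hasRemovable k ts
    hasRemovable-step t [] = sym (∨-identityʳ _)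
    hasRemovable-step t (_ ∷ _) = refl

    ∨-false⁻ : ∀ a {b} → a ∨ b ≡ false → a ≡ false × b ≡ false
    ∨-false⁻ false e = refl , e

    removable-false : ∀ F → FR F ≡ 0 → hasRemovable k F ≡ false
    removable-false [] _ = refl
    removable-false (t ∷ ts) e = trans (hasRemovable-step t ts) (cong₂ _∨_ (removableT-false (nx ts) t (m+n≡0⇒m≡0 _ e)) (removable-false ts (m+n≡0⇒n≡0 (RR (nx ts) t) e)))

    removable-none : ∀ N F → GoodEs k N F → sumEs youngN F ≡ 0 → hasRemovable k F ≡ false → FR F ≡ 0
    removable-none N [] _ _ _ = refl
    removable-none N (t@(enode l cs) ∷ ts) ((le , _) , gs) y nr = cong₂ _+_
      (removableT-none (nx ts) t le (m+n≡0⇒m≡0 (youngN t) (m+n≡0⇒m≡0 (sumE youngN t) y)) (proj₁ parts))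
      (removable-none N ts gs (m+n≡0⇒n≡0 (sumE youngN t) y) (proj₂ parts))
      where parts = ∨-false⁻ (hasRemovableT k t (nx ts)) (trans (sym (hasRemovable-step t ts)) nr)

    private
      total : ∀ F → (FO F + FR F) + sumEs youngN F ≡ FL F
      total F = trans (cong (_+ sumEs youngN F) (FO+FR F)) (old+young F)

    -- By `total`, L exceeds O by the left-out old leaves and the young leaves. So O = L says that
    -- both are absent, and then O is the number of all old leaves.
    minimal⇒ : ∀ n F i → InF n k F → oldLeaves F ≡ i → youngLeaves F ≡ 0 → hasRemovable k F ≡ false → FO F ≡ i × FL F ≡ i
    minimal⇒ n F i inF o y r = fo , trans (sym (total F)) (trans (cong₂ _+_ (cong₂ _+_ fo fr) yn) (trans (+-identityʳ _) (+-identityʳ i)))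
      where
      yn = trans (sym (youngLeaves-youngN F)) y
      fr = removable-none (suc n) F (goodF n k F inF) yn r
      fo = trans (sym (+-identityʳ _)) (trans (cong (FO F +_) (sym fr)) (trans (FO+FR F) (trans (sym (oldLeaves-oldN F)) o)))

    minimal⇐ : ∀ F i → FO F ≡ i → FL F ≡ i → oldLeaves F ≡ i × youngLeaves F ≡ 0 × hasRemovable k F ≡ false
    minimal⇐ F i fo fl = trans (oldLeaves-oldN F) (trans (sym (FO+FR F)) (trans (cong₂ _+_ fo fr) (+-identityʳ i)))
      , trans (youngLeaves-youngN F) (m+n≡0⇒n≡0 (FR F) extra) , removable-false F fr
      where
      extra : FR F + sumEs youngN F ≡ 0
      extra = +-cancelˡ-≡ (FO F) _ _ (trans (sym (+-assoc (FO F) _ _)) (trans (total F) (trans fl (trans (sym fo) (sym (+-identityʳ _))))))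
      fr = m+n≡0⇒m≡0 (FR F) extra

  -- Cardinalities from duplicate-free lists.

  _≟E_ : DecidableEquality ETree
  _≟Os_ : DecidableEquality (List OTree)
  _≟Es_ : DecidableEquality (List ETree)
  enode l cs ≟E enode l' cs' with l ≟ l' | cs ≟Os cs'
  ... | yes refl | yes refl = yes refl
  ... | no ne | _ = no λ { refl → ne refl }
  ... | yes _ | no ne = no λ { refl → ne refl }
  [] ≟Os [] = yes refl
  [] ≟Os (_ ∷ _) = no λ ()
  (_ ∷ _) ≟Os [] = no λ ()
  (onode es ∷ os) ≟Os (onode es' ∷ os') with es ≟Es es' | os ≟Os os'
  ... | yes refl | yes refl = yes refl
  ... | no ne | _ = no λ { refl → ne refl }
  ... | yes _ | no ne = no λ { refl → ne refl }
  [] ≟Es [] = yes refl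
  [] ≟Es (_ ∷ _) = no λ ()
  (_ ∷ _) ≟Es [] = no λ ()
  (e ∷ es) ≟Es (e' ∷ es') with e ≟E e' | es ≟Es es'
  ... | yes refl | yes refl = yes refl
  ... | no ne | _ = no λ { refl → ne refl }
  ... | yes _ | no ne = no λ { refl → ne refl }

  index-lookup : ∀ {A : Set} {xs : List A} → Unique xs → ∀ i (m : lookup xs i ∈ xs) → Any.index m ≡ i
  index-lookup {xs = x ∷ xs} (x∉ ∷ u) zero (here _) = refl
  index-lookup {xs = x ∷ xs} (x∉ ∷ u) zero (there m) = ⊥-elim (All.lookup x∉ m refl)
  index-lookup {xs = x ∷ xs} (x∉ ∷ u) (suc i) (here e) = ⊥-elim (All.lookup x∉ (∈-lookup {xs = xs} i) (sym e))
  index-lookup {xs = x ∷ xs} (x∉ ∷ u) (suc i) (there m) = cong suc (index-lookup u i m)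

  -- `Card` keeps the proof of `P` irrelevant, so it cannot be used to compute a position in the
  -- list. Membership is recomputed by deciding it, which takes the decidable equality of forests.
  card-list : ∀ {P : Forest → Set} xs → Unique xs → All P xs → (∀ F → P F → F ∈ xs) → Card P (length xs)
  card-list {P} xs u sound complete = mk↔ₛ′ to from to∘from (λ i → index-lookup u i _)
    where
    open import Data.List.Membership.DecPropositional _≟Es_ using (_∈?_)
    to : Fin (length xs) → Σ Forest (λ F → Irrelevant (P F))
    to i = lookup xs i , [ All.lookup sound (∈-lookup i) ]
    mem : ∀ F → .(P F) → F ∈ xs
    mem F p = recompute (F ∈? xs) (complete F p)
    from : Σ Forest (λ F → Irrelevant (P F)) → Fin (length xs)
    from (F , [ p ]) = Any.index (mem F p)
    pair : ∀ {F G} (a : Irrelevant (P F)) (b : Irrelevant (P G)) → F ≡ G → _≡_ {A = Σ Forest (λ F → Irrelevant (P F))} (F , a) (G , b)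
    pair [ _ ] [ _ ] refl = refl
    to∘from : ∀ s → to (from s) ≡ s
    to∘from (F , [ p ]) = pair _ _ (sym (lookup-index (mem F p)))

  -- Blocks of states and their growth under insertion.

  δ : ℕ → ℕ → ℕ
  δ a b = b2n (a ≡ᵇ b)

  δ-refl : ∀ a → δ a a ≡ 1
  δ-refl a = cong b2n (≡ᵇ-refl a)

  δ-≢ : ∀ {a b} → a ≢ b → δ a b ≡ 0
  δ-≢ ne = cong b2n (≡ᵇ-≢ ne)

  δ-mirror : ∀ {a b m m'} → a + b ≡ m + m' → δ a m ≡ δ b m'
  δ-mirror {a} {b} {m} {m'} e with a ≟ m
  ... | yes refl = trans (δ-refl a) (sym (trans (cong (λ z → δ z m') (+-cancelˡ-≡ a b m' e)) (δ-refl m')))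
  ... | no ne with b ≟ m'
  ...   | yes refl = ⊥-elim (ne (+-cancelʳ-≡ b a m e))
  ...   | no ne' = trans (δ-≢ ne) (sym (δ-≢ ne'))

  δ-* : ∀ a b → a * δ a b ≡ b * δ a b
  δ-* a b with a ≟ b
  ... | yes refl = refl
  ... | no ne rewrite δ-≢ ne = trans (*-zeroʳ a) (sym (*-zeroʳ b))

  Bin-flip : ∀ M g → Bin M g ≡ Bin M (λ a b → g b a)
  Bin-flip zero g = refl
  Bin-flip (suc M) g = trans (Bin-flip M (λ a b → g (suc a) b + g a (suc b))) (Bin-cong M (λ a b _ → +-comm (g (suc b) a) (g b (suc a))))

  Bin-zero : ∀ M → Bin M (λ _ _ → 0) ≡ 0
  Bin-zero zero = refl
  Bin-zero (suc M) = Bin-zero M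

  -- The coefficient of x^m in x^i (1 + x)^M.
  β : ℕ → ℕ → ℕ → ℕ
  β i M m = Bin M (λ y _ → δ (i + y) m)

  -- x^i (1 + x)^M is palindromic with centre (2 i + M)/2; exchanging the two arguments in `Bin` is
  -- the symmetry C(M , y) = C(M , M - y).
  β-mirror : ∀ i M {m m'} → m + m' ≡ i + (i + M) → β i M m ≡ β i M m'
  β-mirror i M {m} {m'} e = trans (Bin-flip M _) (Bin-cong M (λ y c q → δ-mirror {i + c} {i + y} {m} {m'} (trans (lem i y c) (trans (cong (λ z → i + (i + z)) q) (sym e)))))
    where
    lem : ∀ i y c → (i + c) + (i + y) ≡ i + (i + (y + c))
    lem = solve-∀

  β-above : ∀ i M {m} → i + M < m → β i M m ≡ 0
  β-above i M lt = trans (Bin-cong M (λ y c q → δ-≢ (<⇒≢ (≤-<-trans (+-monoʳ-≤ i (≤-trans (m≤m+n y c) (≤-reflexive q))) lt)))) (Bin-zero M)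

  β-start : ∀ i M → β i M i ≡ 1
  β-start i M = trans (Bin-cong M (λ y c _ → δ-mirror {i + y} {0} {i} {y} (+-identityʳ _))) (go M)
    where
    go : ∀ M → Bin M (λ y _ → δ 0 y) ≡ 1
    go zero = refl
    go (suc M) = go M

  record Block : Set where
    constructor block
    field
      kind : Bool
      low width : ℕ

  open Block

  -- The states (kind , low , low + y), each with multiplicity C(width , y).
  weigh : (Bool → ℕ → ℕ → ℕ) → Block → ℕ
  weigh f (block b i M) = Bin M (λ y _ → f b i (i + y))

  Fits : ℕ → Block → Set
  Fits n (block b i M) = (i + (i + M)) + b2n b ≡ n

  module Blocks (j : ℕ) where
    open ForestStatistics j

    -- In a bar forest the new singleton and the bar-preserving slot of the last root account for
    -- one copy with width M + 1, and the remaining `j` slots of that root for the hat blocks; in a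
    -- hat forest the singleton alone gives the one bar block. The k i copies come from counted old
    -- leaves and their owners, the 2 k M copies from the other two classes. For M = 0 the latter
    -- are absent, so `M ∸ 1` never truncates in a block that occurs.
    expand : Block → List Block
    expand (block true i M) = replicate (1 + k * i) (block true i (suc M)) ++ replicate (k * (2 * M)) (block true (suc i) (M ∸ 1)) ++ replicate j (block false (suc i) M)
    expand (block false i M) = block true i M ∷ replicate (k * i) (block false i (suc M)) ++ replicate (k * (2 * M)) (block false (suc i) (M ∸ 1))

    blocks : ℕ → List Block
    blocks zero = block false 0 0 ∷ []
    blocks (suc n) = concatMap expand (blocks n)

    replicate-All : ∀ {P : Block → Set} m {x} → (m ≢ 0 → P x) → All P (replicate m x)
    replicate-All zero p = []
    replicate-All (suc m) p = p (λ ()) ∷ replicate-All m (λ _ → p (λ ()))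

    private
      narrow : ∀ {n b} i M → Fits n (block b i M) → k * (2 * M) ≢ 0 → Fits (suc n) (block b (suc i) (M ∸ 1))
      narrow {n} {b} i zero fit ne = ⊥-elim (ne (*-zeroʳ k))
      narrow {n} {b} i (suc M) fit _ = trans (lem i M (b2n b)) (cong suc fit)
        where
        lem : ∀ i M b → (suc i + (suc i + M)) + b ≡ suc ((i + (i + suc M)) + b)
        lem = solve-∀

    expand-fits : ∀ {n} B → Fits n B → All (Fits (suc n)) (expand B)
    expand-fits (block true i M) fit = All.++⁺ (replicate-All (1 + k * i) λ _ → trans (lem₁ i M) (cong suc fit))
      (All.++⁺ (replicate-All (k * (2 * M)) (narrow {b = true} i M fit)) (replicate-All j λ _ → trans (lem₂ i M) (cong suc fit)))
      where
      lem₁ : ∀ i M → (i + (i + suc M)) + 1 ≡ suc ((i + (i + M)) + 1)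
      lem₁ = solve-∀
      lem₂ : ∀ i M → (suc i + (suc i + M)) + 0 ≡ suc ((i + (i + M)) + 1)
      lem₂ = solve-∀
    expand-fits (block false i M) fit = trans (lem₁ i M) (cong suc fit) ∷ All.++⁺ (replicate-All (k * i) λ _ → trans (lem₂ i M) (cong suc fit))
      (replicate-All (k * (2 * M)) (narrow {b = false} i M fit))
      where
      lem₁ : ∀ i M → (i + (i + M)) + 1 ≡ suc ((i + (i + M)) + 0)
      lem₁ = solve-∀
      lem₂ : ∀ i M → (i + (i + suc M)) + 0 ≡ suc ((i + (i + M)) + 0)
      lem₂ = solve-∀

    blocks-fit : ∀ n → All (Fits n) (blocks n)
    blocks-fit zero = refl ∷ []
    blocks-fit (suc n) = All.concat⁺ (All.map⁺ (All.map (λ {B} → expand-fits B) (blocks-fit n)))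

    LowPos : Block → Set
    LowPos (block true i M) = ⊤
    LowPos (block false i M) = 1 ≤ i

    -- The empty forest counts as a hat forest with `low` 0, but its block expands into a single bar
    -- block. Every later hat block has positive `low`; hence the second gamma expansion starts at 1
    -- and b can be multiplied by x.
    blocks-low : ∀ n → All LowPos (blocks (suc n))
    blocks-low n = All.concat⁺ (All.map⁺ (All.universal expand-low (blocks n)))
      where
      expand-low : ∀ B → All LowPos (expand B)
      expand-low (block true i M) = All.++⁺ (replicate-All (1 + k * i) λ _ → tt) (All.++⁺ (replicate-All (k * (2 * M)) λ _ → tt) (replicate-All j λ _ → s≤s z≤n))
      expand-low (block false i M) = tt ∷ All.++⁺ (replicate-All (k * i) (pos i)) (replicate-All (k * (2 * M)) λ _ → s≤s z≤n)
        where
        pos : ∀ i → k * i ≢ 0 → 1 ≤ i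
        pos zero ne = ⊥-elim (ne (*-zeroʳ k))
        pos (suc i) _ = s≤s z≤n

    -- The pull-back of a test function along all insertions, with the class sizes `FY` and `FC`
    -- recovered from the state alone.
    step : ℕ → (Bool → ℕ → ℕ → ℕ) → Bool → ℕ → ℕ → ℕ
    step n f b o L = f true o L + TF b f o L (L ∸ o) (n ∸ (L + o) ∸ b2n b)

    S : ℕ → (Bool → ℕ → ℕ → ℕ) → ℕ
    S n f = Σl (gen k n) (λ F → f (bar F) (FO F) (FL F))

    FY≡ : ∀ F → FY F ≡ FL F ∸ FO F
    FY≡ F = sym (trans (cong (_∸ FO F) (sym (FO+FY F))) (m+n∸m≡n (FO F) (FY F)))

    FC≡ : ∀ n F → InF n k F → FC F ≡ n ∸ (FL F + FO F) ∸ b2n (bar F)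
    FC≡ n F i = sym (trans (cong (λ z → z ∸ (FL F + FO F) ∸ b2n (bar F)) (trans (sym (size n F i)) (lem (FL F) (FO F) (FC F) (b2n (bar F)))))
      (trans (cong (_∸ b2n (bar F)) (m+n∸m≡n (FL F + FO F) (FC F + b2n (bar F)))) (m+n∸n≡m (FC F) (b2n (bar F)))))
      where
      lem : ∀ a b c d → (a + (b + c)) + d ≡ (a + b) + (c + d)
      lem = solve-∀

    S-suc : ∀ n f → S (suc n) f ≡ Σl (gen k n) (λ F → f true (FO F) (FL F) + TF (bar F) f (FO F) (FL F) (FY F) (FC F))
    S-suc n f = trans (Σl-concatMap (insF k (suc n)) (gen k n) _) (Σl-congAll (All.map (λ {F} i → insF-sum n F i f) (gen-sound k n)))

    S-step : ∀ n f → S (suc n) f ≡ S n (step n f)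
    S-step n f = trans (S-suc n f) (Σl-congAll (All.map (λ {F} i → cong₂ (λ y c → f true (FO F) (FL F) + TF (bar F) f (FO F) (FL F) y c) (FY≡ F) (FC≡ n F i)) (gen-sound k n)))

    private
      lessLow : ∀ i y → (i + y) ∸ i ≡ y
      lessLow i y = m+n∸m≡n i y

      lessAll : ∀ {n} b i M y c → Fits n (block b i M) → y + c ≡ M → n ∸ ((i + y) + i) ∸ b2n b ≡ c
      lessAll {n} b i M y c fit q = trans (cong (λ z → z ∸ ((i + y) + i) ∸ b2n b) (trans (sym fit) (trans (cong (λ z → (i + (i + z)) + b2n b) (sym q)) (lem i y c (b2n b)))))
        (trans (cong (_∸ b2n b) (m+n∸m≡n ((i + y) + i) (c + b2n b))) (m+n∸n≡m c (b2n b)))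
        where
        lem : ∀ i y c b → (i + (i + (y + c))) + b ≡ ((i + y) + i) + (c + b)
        lem = solve-∀

      Bin-lift : ∀ M (g : ℕ → ℕ) → Bin M (λ y _ → g y + g (suc y)) ≡ Bin (suc M) (λ y _ → g y)
      Bin-lift M g = Bin-cong M (λ y _ _ → +-comm (g y) (g (suc y)))

    -- In the state (i , i + y) of a block the class sizes are i, y, i and c = M - y. The two
    -- classes of size i give C(M , y) + C(M , y - 1) = C(M + 1 , y), a wider block; the classes of
    -- sizes y and c are handled by `Bin-derivative`.
    weigh-step : ∀ n f B → Fits n B → weigh (step n f) B ≡ Σl (expand B) (weigh f)
    weigh-step n f (block true i M) fit = begin
        Bin M (λ y _ → step n f true i (i + y))
      ≡⟨ Bin-cong M simplify ⟩
        Bin M (λ y c → ((1 + k * i) * u y c + k * v y c) + j * e y)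
      ≡⟨ Bin-+ M (λ y c → (1 + k * i) * u y c + k * v y c) (λ y _ → j * e y) ⟩
        Bin M (λ y c → (1 + k * i) * u y c + k * v y c) + Bin M (λ y _ → j * e y)
      ≡⟨ cong₂ _+_ (Bin-+ M (λ y c → (1 + k * i) * u y c) (λ y c → k * v y c)) (Bin-* M j (λ y _ → e y)) ⟩
        (Bin M (λ y c → (1 + k * i) * u y c) + Bin M (λ y c → k * v y c)) + j * Bin M (λ y _ → e y)
      ≡⟨ cong (_+ j * Bin M (λ y _ → e y)) (cong₂ _+_
           (trans (Bin-* M (1 + k * i) u) (cong ((1 + k * i) *_) (Bin-lift M g)))
           (trans (Bin-* M k v) (cong (k *_) (Bin-derivative M h)))) ⟩
        ((1 + k * i) * Bin (suc M) (λ y _ → g y) + k * (2 * M * Bin (M ∸ 1) (λ y _ → h (suc y)))) + j * Bin M (λ y _ → e y)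
      ≡⟨ cong (λ z → ((1 + k * i) * Bin (suc M) (λ y _ → g y) + z) + j * Bin M (λ y _ → e y))
           (trans (sym (*-assoc k (2 * M) _)) (cong (k * (2 * M) *_) (Bin-cong (M ∸ 1) (λ y _ _ → cong (f true (suc i)) (+-suc i y))))) ⟩
        ((1 + k * i) * weigh f B₁ + k * (2 * M) * weigh f B₂) + j * weigh f B₃
      ≡⟨ trans (+-assoc ((1 + k * i) * weigh f B₁) _ _) (sym (trans (Σl-++ (replicate (1 + k * i) B₁) _ (weigh f)) (cong₂ _+_ (Σl-replicate (1 + k * i) B₁ (weigh f))
           (trans (Σl-++ (replicate (k * (2 * M)) B₂) _ (weigh f)) (cong₂ _+_ (Σl-replicate (k * (2 * M)) B₂ (weigh f)) (Σl-replicate j B₃ (weigh f))))))) ⟩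
        Σl (expand (block true i M)) (weigh f) ∎
      where
      B₁ = block true i (suc M)
      B₂ = block true (suc i) (M ∸ 1)
      B₃ = block false (suc i) M
      g h e : ℕ → ℕ
      g y = f true i (i + y)
      h y = f true (suc i) (i + y)
      e y = f false (suc i) (suc i + y)
      u v : ℕ → ℕ → ℕ
      u y _ = g y + g (suc y)
      v y c = y * h y + c * h (suc y)
      arith : ∀ k j i y c g g' h h' e → g + (k * (i * g + (y * h + (i * g' + c * h'))) + (g' + j * e)) ≡ ((1 + k * i) * (g + g') + k * (y * h + c * h')) + j * e
      arith = solve-∀
      simplify : ∀ y c → y + c ≡ M → step n f true i (i + y) ≡ ((1 + k * i) * u y c + k * v y c) + j * e y
      simplify y c q rewrite lessLow i y | lessAll true i M y c fit q | +-suc i y = arith k j i y c (g y) (f true i (suc (i + y))) (h y) (f true (suc i) (suc (i + y))) (e y)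
    weigh-step n f (block false i M) fit = begin
        Bin M (λ y _ → step n f false i (i + y))
      ≡⟨ Bin-cong M simplify ⟩
        Bin M (λ y c → e y + ((k * i) * u y c + k * v y c))
      ≡⟨ Bin-+ M (λ y _ → e y) (λ y c → (k * i) * u y c + k * v y c) ⟩
        Bin M (λ y _ → e y) + Bin M (λ y c → (k * i) * u y c + k * v y c)
      ≡⟨ cong (weigh f (block true i M) +_) (Bin-+ M (λ y c → (k * i) * u y c) (λ y c → k * v y c)) ⟩
        weigh f (block true i M) + (Bin M (λ y c → (k * i) * u y c) + Bin M (λ y c → k * v y c))
      ≡⟨ cong (weigh f (block true i M) +_) (cong₂ _+_
           (trans (Bin-* M (k * i) u) (cong ((k * i) *_) (Bin-lift M g)))
           (trans (Bin-* M k v) (trans (cong (k *_) (Bin-derivative M h))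
             (trans (sym (*-assoc k (2 * M) _)) (cong (k * (2 * M) *_) (Bin-cong (M ∸ 1) (λ y _ _ → cong (f false (suc i)) (+-suc i y)))))))) ⟩
        weigh f (block true i M) + ((k * i) * weigh f B₁ + k * (2 * M) * weigh f B₂)
      ≡⟨ cong (weigh f (block true i M) +_) (sym (trans (Σl-++ (replicate (k * i) B₁) _ (weigh f)) (cong₂ _+_ (Σl-replicate (k * i) B₁ (weigh f)) (Σl-replicate (k * (2 * M)) B₂ (weigh f))))) ⟩
        Σl (expand (block false i M)) (weigh f) ∎
      where
      B₁ = block false i (suc M)
      B₂ = block false (suc i) (M ∸ 1)
      g h e : ℕ → ℕ
      g y = f false i (i + y)
      h y = f false (suc i) (i + y)
      e y = f true i (i + y)
      u v : ℕ → ℕ → ℕ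
      u y _ = g y + g (suc y)
      v y c = y * h y + c * h (suc y)
      arith : ∀ k i y c g g' h h' e → e + k * (i * g + (y * h + (i * g' + c * h'))) ≡ e + ((k * i) * (g + g') + k * (y * h + c * h'))
      arith = solve-∀
      simplify : ∀ y c → y + c ≡ M → step n f false i (i + y) ≡ e y + ((k * i) * u y c + k * v y c)
      simplify y c q rewrite lessLow i y | lessAll false i M y c fit q | +-suc i y = arith k i y c (g y) (f false i (suc (i + y))) (h y) (f false (suc i) (suc (i + y))) (e y)

    -- The induction runs through the test function: the hypothesis for `n` is applied to
    -- `step n f`.
    S-blocks : ∀ n f → S n f ≡ Σl (blocks n) (weigh f)
    S-blocks zero f = refl
    S-blocks (suc n) f = trans (S-step n f) (trans (S-blocks n (step n f))
      (trans (Σl-congAll (All.map (λ {B} → weigh-step n f B) (blocks-fit n))) (sym (Σl-concatMap expand (blocks n) (weigh f)))))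

    -- These are the coefficients of the 1/k-Eulerian polynomial.
    total : ℕ → ℕ → ℕ
    total n m = S n (λ _ _ L → δ L m)

    -- A forest on [n] with L non-root leaves has 1 + k n insertions. The new singleton and the k L
    -- slots below these leaves keep L; the other k (n - L) raise it by one. The negative term is
    -- moved to the left, as in `A-suc`.
    total-recurrence : ∀ n m → total (suc n) (suc m) + k * m * total n m ≡ (1 + k * suc m) * total n (suc m) + k * n * total n m
    total-recurrence n m = begin
        total (suc n) (suc m) + k * m * total n m
      ≡⟨ cong₂ _+_ (S-suc n f) (sym (Σl-* (gen k n) (k * m) _)) ⟩
        Σl (gen k n) (λ F → V F) + Σl (gen k n) (λ F → k * m * δ (FL F) m)
      ≡⟨ sym (Σl-+ (gen k n) V (λ F → k * m * δ (FL F) m)) ⟩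
        Σl (gen k n) (λ F → V F + k * m * δ (FL F) m)
      ≡⟨ Σl-congAll (All.map (λ {F} → each F) (gen-sound k n)) ⟩
        Σl (gen k n) (λ F → (1 + k * suc m) * δ (FL F) (suc m) + k * n * δ (FL F) m)
      ≡⟨ Σl-+ (gen k n) (λ F → (1 + k * suc m) * δ (FL F) (suc m)) (λ F → k * n * δ (FL F) m) ⟩
        Σl (gen k n) (λ F → (1 + k * suc m) * δ (FL F) (suc m)) + Σl (gen k n) (λ F → k * n * δ (FL F) m)
      ≡⟨ cong₂ _+_ (Σl-* (gen k n) (1 + k * suc m) _) (Σl-* (gen k n) (k * n) _) ⟩
        (1 + k * suc m) * total n (suc m) + k * n * total n m ∎
      where
      f : Bool → ℕ → ℕ → ℕ
      f _ _ L = δ L (suc m)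
      V : Forest → ℕ
      V F = f true (FO F) (FL F) + TF (bar F) f (FO F) (FL F) (FY F) (FC F)
      each : ∀ F → InF n k F → V F + k * m * δ (FL F) m ≡ (1 + k * suc m) * δ (FL F) (suc m) + k * n * δ (FL F) m
      each F i = go (bar F) (size n F i)
        where
        d = δ (FL F) (suc m)
        d' = δ (FL F) m
        hat : ∀ k O Y C d d' m → (d + k * (O * d + (Y * d + (O * d' + C * d')))) + k * m * d' ≡ (d + k * ((O + Y) * d)) + k * ((O + C) * d' + m * d')
        hat = solve-∀
        bar' : ∀ j O Y C d d' m → (d + (suc j * (O * d + (Y * d + (O * d' + C * d'))) + (d' + j * d'))) + suc j * m * d'
          ≡ (d + suc j * ((O + Y) * d)) + suc j * ((O + C + 1) * d' + m * d')
        bar' = solve-∀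
        swap : ∀ a l d → a * d + l * d ≡ (l + a) * d
        swap = solve-∀
        shape : ∀ k m n d d' → d + k * (suc m * d) + k * (n * d') ≡ (1 + k * suc m) * d + k * n * d'
        shape = solve-∀
        finish : ∀ X → FL F + X ≡ n → (d + k * ((FO F + FY F) * d)) + k * (X * d' + m * d') ≡ (1 + k * suc m) * d + k * n * d'
        finish X e = begin
            (d + k * ((FO F + FY F) * d)) + k * (X * d' + m * d')
          -- `d` and `d'` vanish unless L is suc m and m respectively, so next to them L may be
          -- exchanged for these numbers.
          ≡⟨ cong₂ (λ a b → (d + k * a) + k * (X * d' + b)) (trans (cong (_* d) (FO+FY F)) (δ-* (FL F) (suc m))) (sym (δ-* (FL F) m)) ⟩
            (d + k * (suc m * d)) + k * (X * d' + FL F * d')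
          ≡⟨ cong (λ z → (d + k * (suc m * d)) + k * z) (trans (swap X (FL F) d') (cong (_* d') e)) ⟩
            (d + k * (suc m * d)) + k * (n * d')
          ≡⟨ shape k m n d d' ⟩
            (1 + k * suc m) * d + k * n * d' ∎
        go : ∀ b → (FL F + (FO F + FC F)) + b2n b ≡ n → (f true (FO F) (FL F) + TF b f (FO F) (FL F) (FY F) (FC F)) + k * m * d' ≡ (1 + k * suc m) * d + k * n * d'
        go false e = trans (hat k (FO F) (FY F) (FC F) d d' m) (finish (FO F + FC F) (trans (sym (+-identityʳ _)) e))
        go true e = trans (bar' j (FO F) (FY F) (FC F) d d' m) (finish (FO F + FC F + 1) (trans (sym (+-assoc (FL F) _ 1)) e))

    total-zero : ∀ n → total (suc n) 0 ≡ total n 0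
    total-zero n = trans (S-suc n (λ _ _ L → δ L 0)) (Σl-congAll (All.map (λ {F} _ → each F) (gen-sound k n)))
      where
      each : ∀ F → δ (FL F) 0 + TF (bar F) (λ _ _ L → δ L 0) (FO F) (FL F) (FY F) (FC F) ≡ δ (FL F) 0
      each F = go (bar F)
        where
        d = δ (FL F) 0
        nil : FL F * d ≡ 0
        nil = δ-* (FL F) 0
        hat : ∀ k O Y C d → d + k * (O * d + (Y * d + (O * 0 + C * 0))) ≡ d + k * ((O + Y) * d)
        hat = solve-∀
        bar' : ∀ j O Y C d → d + (suc j * (O * d + (Y * d + (O * 0 + C * 0))) + (0 + j * 0)) ≡ d + suc j * ((O + Y) * d)
        bar' = solve-∀
        finish : d + k * ((FO F + FY F) * d) ≡ d
        finish = trans (cong (λ z → d + k * z) (trans (cong (_* d) (FO+FY F)) nil)) (trans (cong (d +_) (*-zeroʳ k)) (+-identityʳ d))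
        go : ∀ b → d + TF b (λ _ _ L → δ L 0) (FO F) (FL F) (FY F) (FC F) ≡ d
        go false = trans (hat k (FO F) (FY F) (FC F) d) finish
        go true = trans (bar' j (FO F) (FY F) (FC F) d) finish

    sel : Bool → Bool → ℕ
    sel true true = 1
    sel false false = 1
    sel _ _ = 0

    count gamma : Bool → ℕ → ℕ → ℕ
    count b n m = S n (λ b' _ L → sel b b' * δ L m)
    gamma b n i = S n (λ b' o L → sel b b' * (δ o i * δ L i))

    total-count : ∀ n m → total n m ≡ count true n m + count false n m
    total-count n m = sym (trans (sym (Σl-+ (gen k n) (λ F → sel true (bar F) * δ (FL F) m) (λ F → sel false (bar F) * δ (FL F) m)))
      (Σl-cong (gen k n) (λ F → one (bar F) (δ (FL F) m))))
      where
      one : ∀ b x → sel true b * x + sel false b * x ≡ x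
      one true x = trans (+-identityʳ _) (+-identityʳ x)
      one false x = +-identityʳ x

    count-blocks : ∀ b n m → count b n m ≡ Σl (blocks n) (λ B → sel b (kind B) * β (low B) (width B) m)
    count-blocks b n m = trans (S-blocks n (λ b' _ L → sel b b' * δ L m)) (Σl-cong (blocks n) (λ { (block b' i M) → Bin-* M (sel b b') (λ y _ → δ (i + y) m) }))

    -- A block meets the diagonal O = L only at y = 0, where its multiplicity is C(M , 0) = 1. So
    -- the gamma coefficients count blocks by `low`.
    gamma-blocks : ∀ b n i → gamma b n i ≡ Σl (blocks n) (λ B → sel b (kind B) * δ (low B) i)
    gamma-blocks b n i₀ = trans (S-blocks n (λ b' o L → sel b b' * (δ o i₀ * δ L i₀))) (Σl-cong (blocks n) (λ { (block b' i M) →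
        trans (Bin-* M (sel b b') (λ y _ → δ i i₀ * δ (i + y) i₀)) (cong (sel b b' *_) (trans (Bin-* M (δ i i₀) (λ y _ → δ (i + y) i₀)) (only i M))) }))
      where
      only : ∀ i M → δ i i₀ * β i M i₀ ≡ δ i i₀
      only i M with i ≟ i₀
      ... | yes refl = trans (cong (δ i i *_) (β-start i M)) (*-identityʳ _)
      ... | no ne rewrite δ-≢ ne = refl

    -- Palindromic of centre (n - 1)/2 or n/2, because every block is.
    count-mirror : ∀ b n {m m'} → (m + m') + b2n b ≡ n → count b n m ≡ count b n m'
    count-mirror b n {m} {m'} e = trans (count-blocks b n m) (trans (Σl-congAll (All.map (λ {B} → one B) (blocks-fit n))) (sym (count-blocks b n m')))
      where
      one : ∀ B → Fits n B → sel b (kind B) * β (low B) (width B) m ≡ sel b (kind B) * β (low B) (width B) m'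
      one (block b' i M) fit = go b b' e fit
        where
        go : ∀ b b' → (m + m') + b2n b ≡ n → (i + (i + M)) + b2n b' ≡ n → sel b b' * β i M m ≡ sel b b' * β i M m'
        go true true e fit = cong (1 *_) (β-mirror i M (+-cancelʳ-≡ 1 _ _ (trans e (sym fit))))
        go false false e fit = cong (1 *_) (β-mirror i M (+-cancelʳ-≡ 0 _ _ (trans e (sym fit))))
        go true false _ _ = refl
        go false true _ _ = refl

    count-above : ∀ b n {m} → n < m + b2n b → count b n m ≡ 0
    count-above b n {m} lt = trans (count-blocks b n m) (trans (Σl-congAll (All.map (λ {B} → one B) (blocks-fit n))) (trans (Σl-* (blocks n) 0 (λ _ → 0)) refl))
      where
      one : ∀ B → Fits n B → sel b (kind B) * β (low B) (width B) m ≡ 0 * 0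
      one (block b' i M) fit = go b b' lt fit
        where
        small : ∀ {x} → (i + (i + M)) + x ≡ n → n < m + x → i + M < m
        small {x} fit lt = ≤-<-trans (m≤n+m (i + M) i) (+-cancelʳ-< x _ _ (subst (_< m + x) (sym fit) lt))
        go : ∀ b b' → n < m + b2n b → (i + (i + M)) + b2n b' ≡ n → sel b b' * β i M m ≡ 0
        go true true lt fit = cong (1 *_) (β-above i M (small fit lt))
        go false false lt fit = cong (1 *_) (β-above i M (small fit lt))
        go true false _ _ = refl
        go false true _ _ = refl

    count-hat-zero : ∀ n → count false (suc n) 0 ≡ 0
    count-hat-zero n = trans (count-blocks false (suc n) 0) (trans (Σl-congAll (All.map (λ {B} → one B) (blocks-low n))) (trans (Σl-* (blocks (suc n)) 0 (λ _ → 0)) refl))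
      where
      one : ∀ B → LowPos B → sel false (kind B) * β (low B) (width B) 0 ≡ 0 * 0
      one (block true i M) _ = refl
      one (block false (suc i) M) _ = cong (1 *_) (Bin-zero M)

    Σl-pick : ∀ (f : ℕ → ℕ) c (z : ℕ → ℕ) t → (∀ {x y} → f x ≡ f y → x ≡ y) → t < c → Σl (applyUpTo f c) (λ i → δ (f t) i * z i) ≡ z (f t)
    Σl-pick f (suc c) z zero inj _ = trans (cong₂ _+_ (trans (cong (_* z (f 0)) (δ-refl (f 0))) (+-identityʳ _))
        (trans (Σl-congAll (All.applyUpTo⁺₂ (λ x → f (suc x)) c (λ x → cong (_* z (f (suc x))) (δ-≢ (λ e → 0≢1+n (inj e)))))) (Σl-* (applyUpTo (λ x → f (suc x)) c) 0 z))) (+-identityʳ _)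
    Σl-pick f (suc c) z (suc t) inj (s≤s lt) = trans (cong (_+ Σl (applyUpTo (λ x → f (suc x)) c) (λ i → δ (f (suc t)) i * z i)) (cong (_* z (f 0)) (δ-≢ (λ e → 0≢1+n (sym (inj e))))))
      (Σl-pick (λ x → f (suc x)) c z t (λ e → suc-injective (inj e)) lt)

    range-pick : ∀ lo hi a (z : ℕ → ℕ) → lo ≤ a → a ≤ hi → Σl (range lo hi) (λ i → δ a i * z i) ≡ z a
    range-pick lo hi a z lo≤a a≤hi = subst (λ a → Σl (range lo hi) (λ i → δ a i * z i) ≡ z a) (m+[n∸m]≡n lo≤a)
      (Σl-pick (lo +_) (suc hi ∸ lo) z (a ∸ lo) (λ {x} {y} → +-cancelˡ-≡ lo x y) (∸-monoˡ-< (s≤s a≤hi) lo≤a))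

    Σl-swap : ∀ {A B : Set} (xs : List A) (ys : List B) (h : A → B → ℕ) → Σl xs (λ x → Σl ys (h x)) ≡ Σl ys (λ y → Σl xs (λ x → h x y))
    Σl-swap [] ys h = sym (trans (Σl-* ys 0 (λ _ → 0)) refl)
    Σl-swap (x ∷ xs) ys h = trans (cong (Σl ys (h x) +_) (Σl-swap xs ys h)) (sym (Σl-+ ys (h x) (λ y → Σl xs (λ x → h x y))))

    -- Sorts the blocks of kind `b` by `low`. The hypothesis says that the range catches each of
    -- them and that `z` at its `low` gives its weight; for this the width must be determined by
    -- `low`, which `Fits` ensures.
    gamma-expansion : ∀ b n lo hi (z : ℕ → ℕ) (w : Block → ℕ) →
      All (λ B → sel b (kind B) * Σl (range lo hi) (λ i → δ (low B) i * z i) ≡ sel b (kind B) * w B) (blocks n) →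
      Σl (range lo hi) (λ i → gamma b n i * z i) ≡ Σl (blocks n) (λ B → sel b (kind B) * w B)
    gamma-expansion b n lo hi z w hyp = begin
        Σl (range lo hi) (λ i → gamma b n i * z i)
      ≡⟨ Σl-cong (range lo hi) (λ i → trans (cong (_* z i) (gamma-blocks b n i)) (trans (*-comm _ (z i)) (trans (sym (Σl-* (blocks n) (z i) _)) (Σl-cong (blocks n) (λ B → lem (z i) (sel b (kind B)) (δ (low B) i)))))) ⟩
        Σl (range lo hi) (λ i → Σl (blocks n) (λ B → sel b (kind B) * (δ (low B) i * z i)))
      ≡⟨ Σl-swap (range lo hi) (blocks n) _ ⟩
        Σl (blocks n) (λ B → Σl (range lo hi) (λ i → sel b (kind B) * (δ (low B) i * z i)))
      ≡⟨ Σl-cong (blocks n) (λ B → Σl-* (range lo hi) (sel b (kind B)) (λ i → δ (low B) i * z i)) ⟩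
        Σl (blocks n) (λ B → sel b (kind B) * Σl (range lo hi) (λ i → δ (low B) i * z i))
      ≡⟨ Σl-congAll hyp ⟩
        Σl (blocks n) (λ B → sel b (kind B) * w B) ∎
      where
      lem : ∀ z s d → z * (s * d) ≡ s * (d * z)
      lem = solve-∀

    private
      half : ∀ {i M n} → i + (i + M) ≡ n → i ≤ n / 2 × M ≡ n ∸ 2 * i
      half {i} {M} {n} e = subst (_≤ n / 2) (m*n/n≡m i 2) (/-monoˡ-≤ 2 (subst (i * 2 ≤_) e (subst (_≤ i + (i + M)) (sym (twice i)) (+-monoʳ-≤ i (m≤m+n i M)))))
        , sym (trans (cong (_∸ 2 * i) (trans (sym e) (lem i M))) (m+n∸m≡n (2 * i) M))
        where
        twice : ∀ i → i * 2 ≡ i + i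
        twice = solve-∀
        lem : ∀ i M → i + (i + M) ≡ 2 * i + M
        lem = solve-∀

    count-gamma-bar : ∀ n m → count true (suc n) m ≡ Σl (range 0 (n / 2)) (λ i → gamma true (suc n) i * β i (n ∸ 2 * i) m)
    count-gamma-bar n m = trans (count-blocks true (suc n) m)
      (sym (gamma-expansion true (suc n) 0 (n / 2) (λ i → β i (n ∸ 2 * i) m) (λ B → β (low B) (width B) m) (All.map (λ {B} → one B) (blocks-fit (suc n)))))
      where
      one : ∀ B → Fits (suc n) B → sel true (kind B) * Σl (range 0 (n / 2)) (λ i → δ (low B) i * β i (n ∸ 2 * i) m)
        ≡ sel true (kind B) * β (low B) (width B) m
      one (block false i M) _ = refl
      one (block true i M) fit = cong (1 *_) (trans (range-pick 0 (n / 2) i (λ i → β i (n ∸ 2 * i) m) z≤n (proj₁ h)) (cong (λ z → β i z m) (sym (proj₂ h))))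
        where h = half {i} {M} {n} (suc-injective (trans (+-comm 1 _) fit))

    count-gamma-hat : ∀ n m → count false (suc n) m ≡ Σl (range 1 (suc n / 2)) (λ i → gamma false (suc n) i * β i (suc n ∸ 2 * i) m)
    count-gamma-hat n m = trans (count-blocks false (suc n) m)
      (sym (gamma-expansion false (suc n) 1 (suc n / 2) (λ i → β i (suc n ∸ 2 * i) m) (λ B → β (low B) (width B) m) (All.zipWith (λ {B} (f , l) → one B f l) (blocks-fit (suc n) , blocks-low n))))
      where
      one : ∀ B → Fits (suc n) B → LowPos B → sel false (kind B) * Σl (range 1 (suc n / 2)) (λ i → δ (low B) i * β i (suc n ∸ 2 * i) m)
        ≡ sel false (kind B) * β (low B) (width B) m
      one (block true i M) _ _ = refl
      one (block false i M) fit pos = cong (1 *_) (trans (range-pick 1 (suc n / 2) i (λ i → β i (suc n ∸ 2 * i) m) pos (proj₁ h)) (cong (λ z → β i z m) (sym (proj₂ h))))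
        where h = half {i} {M} {suc n} (trans (sym (+-identityʳ _)) fit)

-- Coefficients of power series and the identities of the theorem.

module Comparison where
  open import Algebra.Properties.Group using (∙-cancelʳ)
  open import Data.Nat as ℕ using (ℕ; zero; suc; _≤_; _<_; _∸_; s≤s; z≤n)
  import Data.Nat.Properties as ℕ
  open import Data.Bool as Bool using (Bool; true; false; _∧_; if_then_else_)
  open import Data.List using (List; []; _∷_; map; filter)
  open import Data.List.Relation.Unary.All as All using (All)
  open import Data.List.Membership.Propositional.Properties using (∈-filter⁺; ∈-filter⁻)
  import Data.List.Relation.Unary.Unique.Propositional.Properties as Unique
  open import Data.Product using (_×_; _,_; proj₁; proj₂)
  open import Data.Rational using (ℚ; 0ℚ; 1ℚ; _+_; _*_; _-_)
  open import Data.Rational.Properties using (*-zeroˡ; *-identityˡ; +-identityˡ; +-comm; +-0-group)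
  open import Data.Rational.Solver using (module +-*-Solver)
  open import Function using (_∘_)
  open import Relation.Nullary using (Dec; yes; no; does)
  open import Relation.Nullary.Decidable using (_×-dec_)
  open import Relation.Binary.PropositionalEquality
  open import Defs
  open Combinatorics
  open Eulerian

  open S using (_·_; _≋_; tail)
  open +-*-Solver using (solve; _:+_; _:-_; _:=_; con)

  X-tail : tail X ≋ S.const 1ℚ
  X-tail zero = refl
  X-tail (suc m) = refl

  X-zero : ∀ r → (X · r) 0 ≡ 0ℚ
  X-zero r = *-zeroˡ (r 0)

  X-suc : ∀ r m → (X · r) (suc m) ≡ r m
  X-suc r m = trans (cong₂ _+_ (*-zeroˡ (r (suc m))) (trans (S.·-cong {q = r} X-tail (λ _ → refl) m) (SR.*-identityˡ r m))) (+-identityˡ (r m))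

  β-series : ∀ i M m → (powS X i ⊗ powS (constS 1ℚ ⊕ X) M) m ≡ ℕ→ℚ (β i M m)
  β-series i M m = trans (⊗-· (powS X i) (powS (constS 1ℚ ⊕ X) M) m)
    (trans (S.·-cong (powS-pow X i) (powS-pow (constS 1ℚ ⊕ X) M) m) (shifted i M m))
    where
    B : ℕ → Series
    B = Sν.pow (constS 1ℚ ⊕ X)
    binomial : ∀ M m → B M m ≡ ℕ→ℚ (β 0 M m)
    binomial zero zero = refl
    binomial zero (suc m) = refl
    binomial (suc M) m = trans (S.·-distribʳ (B M) (constS 1ℚ) X m) (trans (cong (_+ (X · B M) m) (trans (S.·-cong {q = B M} (constS-const 1ℚ) (λ _ → refl) m) (SR.*-identityˡ (B M) m))) (pascal m))
      where
      split : ∀ m → ℕ→ℚ (β 0 (suc M) m) ≡ ℕ→ℚ (Bin M (λ y _ → δ (suc y) m)) + ℕ→ℚ (β 0 M m)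
      split m = trans (cong ℕ→ℚ (Bin-+ M (λ y _ → δ (suc y) m) (λ y _ → δ y m))) (ℕ→ℚ-+ (Bin M (λ y _ → δ (suc y) m)) (β 0 M m))
      pascal : ∀ m → B M m + (X · B M) m ≡ ℕ→ℚ (β 0 (suc M) m)
      pascal zero = trans (cong₂ _+_ (binomial M 0) (X-zero (B M))) (trans (+-comm (ℕ→ℚ (β 0 M 0)) 0ℚ) (sym (trans (split 0) (cong (λ z → ℕ→ℚ z + ℕ→ℚ (β 0 M 0)) (Bin-zero M)))))
      pascal (suc m) = trans (cong₂ _+_ (binomial M (suc m)) (trans (X-suc (B M) m) (binomial M m))) (trans (+-comm (ℕ→ℚ (β 0 M (suc m))) (ℕ→ℚ (β 0 M m))) (sym (split (suc m))))
    shifted : ∀ i M m → (Sν.pow X i · B M) m ≡ ℕ→ℚ (β i M m)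
    shifted zero M m = trans (SR.*-identityˡ (B M) m) (binomial M m)
    shifted (suc i) M zero = trans (S.·-assoc X (Sν.pow X i) (B M) 0) (trans (X-zero (Sν.pow X i · B M)) (sym (cong ℕ→ℚ (Bin-zero M))))
    shifted (suc i) M (suc m) = trans (S.·-assoc X (Sν.pow X i) (B M) (suc m)) (trans (X-suc (Sν.pow X i · B M) m) (shifted i M m))

  sumℚ-Σl : ∀ is (g b : ℕ → ℕ) → sumℚ (map (λ i → ℕ→ℚ (g i) * ℕ→ℚ (b i)) is) ≡ ℕ→ℚ (Σl is (λ i → g i ℕ.* b i))
  sumℚ-Σl [] g b = refl
  sumℚ-Σl (i ∷ is) g b = trans (cong₂ _+_ (sym (ℕ→ℚ-* (g i) (b i))) (sumℚ-Σl is g b)) (sym (ℕ→ℚ-+ (g i ℕ.* b i) (Σl is (λ i → g i ℕ.* b i))))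

  sumℚ-cong : ∀ (is : List ℕ) {f g : ℕ → ℚ} → (∀ i → f i ≡ g i) → sumℚ (map f is) ≡ sumℚ (map g is)
  sumℚ-cong [] e = refl
  sumℚ-cong (i ∷ is) e = cong₂ _+_ (e i) (sumℚ-cong is e)

  γ-series : ∀ is (g M : ℕ → ℕ) m → ΣS is (λ i → scale (ℕ→ℚ (g i)) (powS X i ⊗ powS (constS 1ℚ ⊕ X) (M i))) m ≡ ℕ→ℚ (Σl is (λ i → g i ℕ.* β i (M i) m))
  γ-series is g M m = trans (sumℚ-cong is (λ i → cong (ℕ→ℚ (g i) *_) (β-series i (M i) m))) (sumℚ-Σl is g (λ i → β i (M i) m))

  -- The geometric series sums coefficients, so it suffices to know that f = (1 - x) g.
  telescope : ∀ (f g : Series) → f 0 ≡ g 0 → (∀ m → f (suc m) ≡ g (suc m) - g m) → (geom ⊗ f) ≗ₛ g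
  telescope f g f0 fs m = trans (⊗-· geom f m) (go m)
    where
    go : ∀ m → (geom · f) m ≡ g m
    go zero = trans (*-identityˡ (f 0)) f0
    go (suc m) = trans (cong₂ _+_ (trans (*-identityˡ (f (suc m))) (fs m)) (go m)) (solve 2 (λ a b → (a :- b) :+ b := a) refl (g (suc m)) (g m))

  module Theorem (n j : ℕ) (A : Fam) (isA : IsOneOverKEulerian (suc j) A) where
    open Blocks j
    open ForestStatistics j using (k; bar; FO; FL; isBar≡bar; lleaf-si; minimal⇒; minimal⇐)
    open Flow.Solution j A isA

    -- Induction on n along the recurrences `A-suc` and `total-recurrence`, which have the same
    -- shape; the summand `c` on both left sides is cancelled.
    A-total : ∀ n m → A n m ≡ ℕ→ℚ (total n m)
    A-total zero m = trans (proj₁ isA m) (base m)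
      where
      base : ∀ m → constS 1ℚ m ≡ ℕ→ℚ (total 0 m)
      base zero = refl
      base (suc m) = refl
    A-total (suc n) zero = trans (A-zero n) (trans (A-total n zero) (cong ℕ→ℚ (sym (total-zero n))))
    A-total (suc n) (suc m) = ∙-cancelʳ +-0-group c (A (suc n) (suc m)) (ℕ→ℚ (total (suc n) (suc m))) (trans (A-suc n m) (trans (cong₂ (λ u v → (1ℚ + K * ℕ→ℚ (suc m)) * u + (K * ℕ→ℚ n) * v) (A-total n (suc m)) (A-total n m))
        (trans (sym castʳ) (trans (cong ℕ→ℚ (sym (total-recurrence n m))) (trans castˡ (cong (λ z → ℕ→ℚ (total (suc n) (suc m)) + (K * ℕ→ℚ m) * z) (sym (A-total n m))))))))
      where
      K = ℕ→ℚ k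
      c = (K * ℕ→ℚ m) * A n m
      cast : ∀ a b → ℕ→ℚ (k ℕ.* a ℕ.* b) ≡ (K * ℕ→ℚ a) * ℕ→ℚ b
      cast a b = trans (ℕ→ℚ-* (k ℕ.* a) b) (cong (_* ℕ→ℚ b) (ℕ→ℚ-* k a))
      castˡ : ℕ→ℚ (total (suc n) (suc m) ℕ.+ k ℕ.* m ℕ.* total n m) ≡ ℕ→ℚ (total (suc n) (suc m)) + (K * ℕ→ℚ m) * ℕ→ℚ (total n m)
      castˡ = trans (ℕ→ℚ-+ (total (suc n) (suc m)) (k ℕ.* m ℕ.* total n m)) (cong (_+_ (ℕ→ℚ (total (suc n) (suc m)))) (cast m (total n m)))
      castʳ : ℕ→ℚ ((1 ℕ.+ k ℕ.* suc m) ℕ.* total n (suc m) ℕ.+ k ℕ.* n ℕ.* total n m) ≡ (1ℚ + K * ℕ→ℚ (suc m)) * ℕ→ℚ (total n (suc m)) + (K * ℕ→ℚ n) * ℕ→ℚ (total n m)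
      castʳ = trans (ℕ→ℚ-+ ((1 ℕ.+ k ℕ.* suc m) ℕ.* total n (suc m)) (k ℕ.* n ℕ.* total n m)) (cong₂ _+_
        (trans (ℕ→ℚ-* (1 ℕ.+ k ℕ.* suc m) (total n (suc m))) (cong (_* ℕ→ℚ (total n (suc m))) (trans (ℕ→ℚ-+ 1 (k ℕ.* suc m)) (cong (_+_ 1ℚ) (ℕ→ℚ-* k (suc m))))))
        (cast n (total n m)))

    N : ℕ
    N = suc n

    P Q : Series
    P m = ℕ→ℚ (count true N m)
    Q m = ℕ→ℚ (count false N m)

    A≡P+Q : ∀ m → A N m ≡ P m + Q m
    A≡P+Q m = trans (A-total N m) (trans (cong ℕ→ℚ (total-count N m)) (ℕ→ℚ-+ (count true N m) (count false N m)))

    P-mirror : ∀ {m m'} → m ℕ.+ m' ≡ n → P m ≡ P m'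
    P-mirror e = cong ℕ→ℚ (count-mirror true N (trans (ℕ.+-comm _ 1) (cong suc e)))

    Q-mirror : ∀ {m m'} → m ℕ.+ m' ≡ N → Q m ≡ Q m'
    Q-mirror e = cong ℕ→ℚ (count-mirror false N (trans (ℕ.+-identityʳ _) e))

    P-above : ∀ {m} → n < m → P m ≡ 0ℚ
    P-above {m} lt = cong ℕ→ℚ (count-above true N (subst (N <_) (ℕ.+-comm 1 m) (s≤s lt)))

    Q-above : ∀ {m} → N < m → Q m ≡ 0ℚ
    Q-above {m} lt = cong ℕ→ℚ (count-above false N (subst (N <_) (sym (ℕ.+-identityʳ m)) lt))

    Q-zero : Q 0 ≡ 0ℚ
    Q-zero = cong ℕ→ℚ (count-hat-zero n)

    rev-inside : ∀ {N m} p → m ≤ N → rev N p m ≡ p (N ∸ m)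
    rev-inside {N} {m} p le = cong (λ b → if b then p (N ∸ m) else 0ℚ) (≤ᵇ-true le)

    rev-outside : ∀ {N m} p → N < m → rev N p m ≡ 0ℚ
    rev-outside {N} {m} p lt = cong (λ b → if b then p (N ∸ m) else 0ℚ) (≤ᵇ-false lt)

    -- P is palindromic with centre n/2 and Q with centre N/2, so x^N A(1/x) = x P + Q, and
    -- subtracting this from A = P + Q leaves (1 - x) P. Beyond the degree N both sides vanish and
    -- are treated separately.
    aPoly≡ : aPoly A N ≗ₛ P
    aPoly≡ = telescope (A N ⊖ rev N (A N)) P start next
      where
      start : A N 0 - rev N (A N) 0 ≡ P 0
      start = trans (cong₂ _-_ (A≡P+Q 0) (trans (rev-inside {N} {0} (A N) z≤n) (trans (A≡P+Q N) (cong₂ _+_ (P-above (ℕ.n<1+n n)) (Q-mirror {N} {0} (ℕ.+-identityʳ N))))))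
        (solve 2 (λ p q → (p :+ q) :- (con 0ℚ :+ q) := p) refl (P 0) (Q 0))
      next : ∀ m → A N (suc m) - rev N (A N) (suc m) ≡ P (suc m) - P m
      next m = go (suc m ℕ.≤? N)
        where
        go : Dec (suc m ≤ N) → A N (suc m) - rev N (A N) (suc m) ≡ P (suc m) - P m
        go (yes le) = trans (cong₂ _-_ (A≡P+Q (suc m)) (trans (rev-inside {N} (A N) le) (trans (A≡P+Q (N ∸ suc m))
              (cong₂ _+_ (sym (P-mirror {m} (ℕ.m+[n∸m]≡n (ℕ.≤-pred le)))) (sym (Q-mirror {suc m} (ℕ.m+[n∸m]≡n le)))))))
            (solve 3 (λ p q r → (p :+ q) :- (r :+ q) := p :- r) refl (P (suc m)) (Q (suc m)) (P m))
        go (no nle) = trans (cong₂ _-_ (trans (A≡P+Q (suc m)) (cong (_+_ (P (suc m))) (Q-above lt))) (rev-outside {N} (A N) lt))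
            (trans (solve 1 (λ p → (p :+ con 0ℚ) :- con 0ℚ := p :- con 0ℚ) refl (P (suc m))) (cong (λ z → P (suc m) - z) (sym (P-above (ℕ.≤-pred lt)))))
          where
          lt : N < suc m
          lt = ℕ.≰⇒> nle

    -- By the same symmetries x^n A(1/x) = P + Q/x, so the numerator is (1 - x) Q/x. The division by
    -- x is exact because Q has no constant term.
    bPoly≡ : bPoly A N ≗ₛ (Q ∘ suc)
    bPoly≡ = telescope (rev n (A N) ⊖ A N) (Q ∘ suc) start next
      where
      start : rev n (A N) 0 - A N 0 ≡ Q 1
      start = trans (cong₂ _-_ (trans (rev-inside {n} {0} (A N) z≤n) (trans (A≡P+Q n) (cong₂ _+_ (P-mirror {n} {0} (ℕ.+-identityʳ n)) (Q-mirror {n} {1} (ℕ.+-comm n 1)))))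
          (trans (A≡P+Q 0) (cong (_+_ (P 0)) Q-zero)))
        (solve 2 (λ p q → (p :+ q) :- (p :+ con 0ℚ) := q) refl (P 0) (Q 1))
      next : ∀ m → rev n (A N) (suc m) - A N (suc m) ≡ Q (suc (suc m)) - Q (suc m)
      next m = go (suc m ℕ.≤? n)
        where
        go : Dec (suc m ≤ n) → rev n (A N) (suc m) - A N (suc m) ≡ Q (suc (suc m)) - Q (suc m)
        go (yes le) = trans (cong₂ _-_ (trans (rev-inside {n} (A N) le) (trans (A≡P+Q (n ∸ suc m))
              (cong₂ _+_ (sym (P-mirror {suc m} (ℕ.m+[n∸m]≡n le))) (sym (Q-mirror {suc (suc m)} (cong suc (ℕ.m+[n∸m]≡n le))))))) (A≡P+Q (suc m)))
            (solve 3 (λ p q r → (p :+ r) :- (p :+ q) := r :- q) refl (P (suc m)) (Q (suc m)) (Q (suc (suc m))))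
        go (no nle) = trans (cong₂ _-_ (rev-outside {n} (A N) lt) (trans (A≡P+Q (suc m)) (cong (_+ Q (suc m)) (P-above lt))))
            (trans (solve 1 (λ q → con 0ℚ :- (con 0ℚ :+ q) := con 0ℚ :- q) refl (Q (suc m))) (cong (λ z → z - Q (suc m)) (sym (Q-above (s≤s lt)))))
          where
          lt : n < suc m
          lt = ℕ.≰⇒> nle

    X-bPoly≡ : (X ⊗ bPoly A N) ≗ₛ Q
    X-bPoly≡ m = trans (⊗-· X (bPoly A N) m) (go m)
      where
      go : ∀ m → (X · bPoly A N) m ≡ Q m
      go zero = trans (X-zero (bPoly A N)) (sym Q-zero)
      go (suc m) = trans (X-suc (bPoly A N) m) (bPoly≡ m)

    card-filter : ∀ {P R : Forest → Set} (R? : ∀ F → Dec (R F)) → (∀ F → InF N k F → R F → P F) → (∀ F → P F → InF N k F × R F) →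
      (c : ℕ) → Σl (gen k N) (λ F → b2n (does (R? F))) ≡ c → Card P c
    card-filter {P} R? to from c eq = subst (Card P) (trans (length-filter R? (gen k N)) eq)
      (card-list (filter R? (gen k N)) (Unique.filter⁺ R? (gen-unique k N))
        (All.tabulate λ i → let m , r = ∈-filter⁻ R? {xs = gen k N} i in to _ (All.lookup (gen-sound k N) m) r)
        (λ F p → ∈-filter⁺ R? (gen-complete k N F (proj₁ (from F p))) (proj₂ (from F p))))

    sel-does : ∀ b b' x → b2n (does (b' Bool.≟ b) ∧ x) ≡ sel b b' ℕ.* b2n x
    sel-does true true x = sym (ℕ.+-identityʳ _)
    sel-does false false x = sym (ℕ.+-identityʳ _)
    sel-does true false x = refl
    sel-does false true x = refl

    b2n-∧ : ∀ x y → b2n (x ∧ y) ≡ b2n x ℕ.* b2n y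
    b2n-∧ true y = sym (ℕ.+-identityʳ _)
    b2n-∧ false y = refl

    card-count : ∀ b m → Card (λ F → InF N k F × isBar k F ≡ b × lleaf F ∸ si F ≡ m) (count b N m)
    card-count b m = card-filter (λ F → (bar F Bool.≟ b) ×-dec (FL F ℕ.≟ m))
      (λ F i (p , q) → i , trans (isBar≡bar F) p , trans (lleaf-si F) q)
      (λ F (i , p , q) → i , trans (sym (isBar≡bar F)) p , trans (sym (lleaf-si F)) q)
      (count b N m) (Σl-cong (gen k N) (λ F → sel-does b (bar F) (does (FL F ℕ.≟ m))))

    card-gamma : ∀ b i → Card (λ F → InF N k F × isBar k F ≡ b × oldLeaves F ≡ i × youngLeaves F ≡ 0 × hasRemovable k F ≡ false) (gamma b N i)
    card-gamma b i = card-filter (λ F → (bar F Bool.≟ b) ×-dec ((FO F ℕ.≟ i) ×-dec (FL F ℕ.≟ i)))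
      (λ F inF (p , o , l) → inF , trans (isBar≡bar F) p , minimal⇐ F i o l)
      (λ F (inF , p , o , y , r) → inF , trans (sym (isBar≡bar F)) p , minimal⇒ N F i inF o y r)
      (gamma b N i) (Σl-cong (gen k N) (λ F → trans (sel-does b (bar F) (does (FO F ℕ.≟ i) ∧ does (FL F ℕ.≟ i))) (cong (sel b (bar F) ℕ.*_) (b2n-∧ (does (FO F ℕ.≟ i)) (does (FL F ℕ.≟ i))))))

open import Defs
open import Data.Nat using (ℕ; suc; _≤_; _∸_; _*_)
open import Data.Nat.DivMod using (_/_)
open import Data.Bool using (true; false)
open import Data.Product using (Σ; _×_; _,_)
open import Data.Rational using (1ℚ)
open import Function using (_∘_)
open import Relation.Binary.PropositionalEquality using (_≡_; cong; sym; trans)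

theorem2p4 : (n k : ℕ) → 1 ≤ n → 1 ≤ k → (A : Fam) → IsOneOverKEulerian k A →
    Σ (ℕ → ℕ) λ cbar → Σ (ℕ → ℕ) λ chat → Σ (ℕ → ℕ) λ gbar → Σ (ℕ → ℕ) λ ghat →
    (∀ m → Card (λ F → InF n k F × isBar k F ≡ true × lleaf F ∸ si F ≡ m) (cbar m))
    × (∀ m → Card (λ F → InF n k F × isBar k F ≡ false × lleaf F ∸ si F ≡ m) (chat m))
    × (∀ i → Card (λ F → InF n k F × isBar k F ≡ true × oldLeaves F ≡ i × youngLeaves F ≡ 0 × hasRemovable k F ≡ false) (gbar i))
    × (∀ i → Card (λ F → InF n k F × isBar k F ≡ false × oldLeaves F ≡ i × youngLeaves F ≡ 0 × hasRemovable k F ≡ false) (ghat i))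
    × (aPoly A n ≗ₛ (ℕ→ℚ ∘ cbar))
    × ((ℕ→ℚ ∘ cbar) ≗ₛ ΣS (range 0 ((n ∸ 1) / 2)) (λ i → scale (ℕ→ℚ (gbar i)) (powS X i ⊗ powS (constS 1ℚ ⊕ X) (n ∸ 1 ∸ 2 * i))))
    × ((X ⊗ bPoly A n) ≗ₛ (ℕ→ℚ ∘ chat))
    × ((ℕ→ℚ ∘ chat) ≗ₛ ΣS (range 1 (n / 2)) (λ i → scale (ℕ→ℚ (ghat i)) (powS X i ⊗ powS (constS 1ℚ ⊕ X) (n ∸ 2 * i))))
theorem2p4 (suc n) (suc j) _ _ A isA =
  count true (suc n) , count false (suc n) , gamma true (suc n) , gamma false (suc n)
  , card-count true , card-count false , card-gamma true , card-gamma false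
  , aPoly≡
  , (λ m → trans (cong ℕ→ℚ (count-gamma-bar n m)) (sym (Comparison.γ-series (range 0 (n / 2)) (gamma true (suc n)) (λ i → n ∸ 2 * i) m)))
  , X-bPoly≡
  , (λ m → trans (cong ℕ→ℚ (count-gamma-hat n m)) (sym (Comparison.γ-series (range 1 (suc n / 2)) (gamma false (suc n)) (λ i → suc n ∸ 2 * i) m)))
  where
  open Comparison.Theorem n j A isA
  open Combinatorics.Blocks j
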